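{- Let $\mathcal{G}$ be the family of (connected) graphs of pathwidth two, and let $\delta_{\mathcal{G}}(n)=\max\{\delta(\mathcal{A}(G)) : G\in\mathcal{G},\ |V(G)|=n\}$. Then $\delta_{\mathcal{G}}(n)=\Theta(n\log n)$.
   Context: All graphs are finite, simple and connected. For a graph $G=(V,E)$, a search tree on $G$ is a rooted tree with vertex set $V$ defined recursively: its root is some vertex $r\in V$, and $r$ is joined to the roots of search trees on each connected component of $G-r$. The tubes of a search tree are the vertex sets of its subtrees. Two search trees on $G$ are related by a rotation if their sets of tubes have symmetric difference of size exactly two. The graph associahedron $\mathcal{A}(G)$ is a polytope whose skeleton is isomorphic to the graph on search trees of $G$ with adjacency given by rotations; $\delta(\mathcal{A}(G))$ is the diameter of this graph. Pathwidth is the usual graph parameter (one less than the smallest clique number of an interval supergraph of $G$). -}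

module Defs where

open import Data.Nat using (ℕ; zero; suc; _+_; _*_; _≤_; _<_)
open import Data.Fin using (Fin)
open import Data.Fin.Subset using (Subset; _∈_; _∉_; ⊤; Nonempty) renaming (_-_ to _minus_)
open import Data.Bool using (Bool; true; false)
import Data.List
open import Data.List using (List; []; _∷_; _++_)
open import Data.List.Membership.Propositional renaming (_∈_ to _∈ᴸ_; _∉_ to _∉ᴸ_)
open import Data.List.Relation.Unary.All using (All)
open import Data.List.Relation.Unary.Any using (Any)
open import Data.List.Relation.Unary.AllPairs using (AllPairs)
open import Data.List.Relation.Unary.Unique.Propositional using (Unique)
open import Data.Product using (Σ; ∃; ∃-syntax; _×_; _,_)
open import Relation.Binary.PropositionalEquality using (_≡_; _≢_)
open import Relation.Nullary using (¬_)
open import Function.Bundles using (_⇔_)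

record Graph (n : ℕ) : Set where
  field
    adj   : Fin n → Fin n → Bool
    sym   : ∀ u v → adj u v ≡ adj v u
    irrefl : ∀ v → adj v v ≡ false
open Graph public

module _ {n : ℕ} (G : Graph n) where

  data WalkIn (C : Subset n) : Fin n → Fin n → Set where
    here : ∀ {x} → x ∈ C → WalkIn C x x
    step : ∀ {x z y} → x ∈ C → adj G x z ≡ true → WalkIn C z y → WalkIn C x y

  ConnectedOn : Subset n → Set
  ConnectedOn C = ∀ x y → x ∈ C → y ∈ C → WalkIn C x y

  Connected : Set
  Connected = ConnectedOn ⊤

  Separated : Subset n → Subset n → Set
  Separated C D = ∀ x y → x ∈ C → y ∈ D → (x ≢ y) × (adj G x y ≡ false)

  IsComponents : Subset n → List (Subset n) → Set
  IsComponents S Cs =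
    All Nonempty Cs × All ConnectedOn Cs × AllPairs Separated Cs ×
    (∀ x → (x ∈ S) ⇔ Any (x ∈_) Cs)

  -- Tree C T  : T is the list of tubes of a search tree on G[C] (C connected)
  -- Forest Cs F : F is the list of tubes of a family of search trees,
  --               one on each G[C] for C in Cs
  data Tree : Subset n → List (Subset n) → Set
  data Forest : List (Subset n) → List (Subset n) → Set

  data Tree where
    node : ∀ {C r Cs F} → r ∈ C → IsComponents (C minus r) Cs → Forest Cs F →
           Tree C (C ∷ F)

  data Forest where
    []  : Forest [] []
    _∷_ : ∀ {C Cs T F} → Tree C T → Forest Cs F → Forest (C ∷ Cs) (T ++ F)

  SearchTree : List (Subset n) → Set
  SearchTree T = Tree ⊤ T

  Rotation : List (Subset n) → List (Subset n) → Set
  Rotation T T' = ∃[ A ] ∃[ B ]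
    (A ∈ᴸ T × A ∉ᴸ T' × B ∈ᴸ T' × B ∉ᴸ T ×
     (∀ X → X ∈ᴸ T → X ∉ᴸ T' → X ≡ A) ×
     (∀ X → X ∈ᴸ T' → X ∉ᴸ T → X ≡ B))

  SameSet : List (Subset n) → List (Subset n) → Set
  SameSet T T' = ∀ X → (X ∈ᴸ T) ⇔ (X ∈ᴸ T')

  -- a walk of length k in the rotation graph (skeleton of A(G))
  data FlipWalk : ℕ → List (Subset n) → List (Subset n) → Set where
    done : ∀ {T T'} → SameSet T T' → FlipWalk zero T T'
    flip : ∀ {k T U T'} → SearchTree U → Rotation T U → FlipWalk k U T' →
           FlipWalk (suc k) T T'

  IsDiameter : ℕ → Set
  IsDiameter d =
    (∀ T T' → SearchTree T → SearchTree T' → ∃[ k ] (k ≤ d × FlipWalk k T T')) ×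
    (∃[ T ] ∃[ T' ] (SearchTree T × SearchTree T' ×
                      (∀ k → FlipWalk k T T' → d ≤ k)))

record Intervals (n : ℕ) : Set where
  field
    lo hi  : Fin n → ℕ
    lo≤hi  : ∀ v → lo v ≤ hi v
open Intervals public

IAdj : ∀ {n} → Intervals n → Fin n → Fin n → Set
IAdj I u v = (u ≢ v) × (lo I u ≤ hi I v) × (lo I v ≤ hi I u)

IsSupergraph : ∀ {n} → Graph n → Intervals n → Set
IsSupergraph G I = ∀ u v → adj G u v ≡ true → IAdj I u v

IsClique : ∀ {n} → Intervals n → List (Fin n) → Set
IsClique I K = Unique K × AllPairs (IAdj I) K

CliqueNumber≤ : ∀ {n} → Intervals n → ℕ → Set
CliqueNumber≤ I w = ∀ K → IsClique I K → Data.List.length K ≤ w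

Pathwidth≤ : ∀ {n} → Graph n → ℕ → Set
Pathwidth≤ G k = Σ (Intervals _) λ I → (IsSupergraph G I × CliqueNumber≤ I (suc k))

PathwidthTwo : ∀ {n} → Graph n → Set
PathwidthTwo G = Pathwidth≤ G 2 × ¬ Pathwidth≤ G 1

IsMaxDiam : ℕ → ℕ → Set
IsMaxDiam n m =
  (∀ (G : Graph n) → Connected G → PathwidthTwo G → ∀ d → IsDiameter G d → d ≤ m) ×
  (Σ (Graph n) λ G → (Connected G × PathwidthTwo G × IsDiameter G m))

{-# OPTIONS --safe #-}

-- Upper bound.  In a graph of pathwidth two some bag of at most three vertices leaves connected pieces of
-- at most half the size.  Lifting a vertex to the root of a search tree on C takes at most |C| rotations,
-- so lifting the bag in two given trees and recursing on the pieces costs 6 |C| rotations per halving.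
--
-- Lower bound.  In the strip with edges x ~ x + 1, and x ~ x + 2 for even x, the odd vertices can be
-- eliminated in any order.  For a dyadic interval I with midpoint c, colour the vertices of I by the half of I
-- they lie in and count the colour changes along the root path of c.  A rotation of u and v affects only the
-- interval whose two halves u and v lie in, and changes its count by at most 3.  In bit-reversal
-- order every interval alternates all the time, while in descending order there are no changes at all, so
-- these two trees are Ω(n log n) rotations apart (a potential in the spirit of Wilber's bound).
--
-- The maximum exists constructively because search trees, rotation walks, graphs and interval
-- representations can all be enumerated, up to the obvious equivalences.

module Submission where

open import Defs
open import Data.Bool using (Bool; true; false)
import Data.Bool.Properties as Boolₚ
open import Data.Empty using (⊥; ⊥-elim)
open import Data.Fin as Fin using (Fin; toℕ)
import Data.Fin.Properties as Finₚ
open import Data.Fin.Subset using (Subset; _∈_; _∉_; _⊆_; ⊤; Nonempty; ∣_∣; _∪_; ⁅_⁆; _─_; ⋃) renaming (_-_ to _minus_; ⊥ to ∅)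
open import Data.Fin.Subset.Properties
open import Data.List using (List; []; _∷_; _++_; map; length; filter; downFrom; allFin; concatMap; cartesianProductWith; cartesianProduct; take)
open import Data.List.Membership.Propositional using (find; lose) renaming (_∈_ to _∈ᴸ_; _∉_ to _∉ᴸ_)
open import Data.List.Membership.Propositional.Properties
  using (∈-lookup; ∈-∃++; ∈-filter⁺; ∈-filter⁻; ∈-downFrom⁺; ∈-downFrom⁻; ∈-++⁺ˡ; ∈-++⁺ʳ; ∈-++⁻; ∈-map⁺; ∈-map⁻; ∈-allFin;
         ∈-concatMap⁺; ∈-concatMap⁻; ∈-cartesianProductWith⁺; ∈-cartesianProductWith⁻; ∈-cartesianProduct⁺; ∈-cartesianProduct⁻)
import Data.List.Properties as Listₚ
open import Data.List.Relation.Binary.Permutation.Propositional as Perm using (_↭_; ↭-sym)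
import Data.List.Relation.Binary.Permutation.Propositional.Properties as Permₚ
open import Data.List.Relation.Unary.All as All using (All; []; _∷_)
import Data.List.Relation.Unary.All.Properties as Allₚ
open import Data.List.Relation.Unary.AllPairs as AllPairs using (AllPairs; []; _∷_)
import Data.List.Relation.Unary.AllPairs.Properties as AllPairsₚ
open import Data.List.Relation.Unary.Any as Any using (Any; here; there)
import Data.List.Relation.Unary.Any.Properties as Anyₚ
open import Data.List.Relation.Unary.Unique.Propositional using (Unique)
import Data.List.Relation.Unary.Unique.Propositional.Properties as Uniqueₚ
open import Data.Maybe using (Maybe; just; nothing)
open import Data.Nat using (ℕ; zero; suc; _+_; _*_; _∸_; _^_; _≤_; _<_; z≤n; s≤s; _≤?_; _<?_; _≡ᵇ_; ⌊_/2⌋)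
open import Data.Nat.ListAction using (sum)
open import Data.Nat.Logarithm using (⌊log₂_⌋; ⌊log₂⌋-mono-≤; ⌊log₂⌊n/2⌋⌋≡⌊log₂n⌋∸1; ⌊log₂[2^n]⌋≡n)
import Data.Nat.Properties as ℕₚ
open import Data.Nat.Solver using (module +-*-Solver)
open +-*-Solver using (solve; _:+_; _:*_; _:=_; con)
open import Data.Product using (Σ; ∃; ∃₂; ∃-syntax; _×_; _,_; proj₁; proj₂)
open import Data.Sum as Sum using (_⊎_; inj₁; inj₂; [_,_]′)
open import Data.Vec using (Vec; here; there) renaming (_∷_ to _∷ᵛ_; [] to []ᵛ)
import Data.Vec.Properties as Vecₚ
open import Function using (_∘_; id; _∋_)
open import Function.Bundles using (_⇔_; mk⇔; Equivalence)
open Equivalence using (to; from)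
import Level
open import Relation.Binary.Definitions using (tri<; tri≈; tri>)
open import Relation.Binary.PropositionalEquality using (_≡_; _≢_; refl; trans; cong; cong₂; subst; subst₂; ≢-sym) renaming (sym to ≡-sym)
open import Relation.Nullary using (¬_; Dec; yes; no; contradiction)
open import Relation.Nullary.Decidable using (_×-dec_; _⊎-dec_; _→-dec_; ¬?; map′; decidable-stable)
open import Relation.Unary using (Decidable)

-- Search trees

-- The changes for an interval are counted on the root path of its midpoint c because c lies inside
-- the interval. When a rotation of u and v removes u from that path, v separates u from c, which in
-- the strip puts v between them in the order; so if u is coloured, v is too. Unless the two lie in
-- different halves they then share a colour, and the removed entry stood right before v, so no
-- change is lost. Otherwise a single rotation could disturb logarithmically many intervals. Even
-- vertices carry the separation: a connected set with vertices on both sides of an even vertex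
-- contains it. Midpoints are even as well, except in intervals of length two, so they are absent
-- from the bit-reversed list of odd vertices and have all of it on their root paths. The formal
-- obstacle is that `Tree` lists components in arbitrary order, while rotations see only sets of
-- tubes. The lower bound therefore reads a tree through its tubes alone (`Shape`), and the upper
-- bound reorders forests before comparing them (`realign`).

_≟ˢ_ : ∀ {n} (C D : Subset n) → Dec (C ≡ D)
_≟ˢ_ = Vecₚ.≡-dec Boolₚ._≟_

AllPairs-lookup : ∀ {a ℓ} {A : Set a} {R : A → A → Set ℓ} {xs : List A} {x y : A} →
  AllPairs R xs → x ∈ᴸ xs → y ∈ᴸ xs → x ≡ y ⊎ R x y ⊎ R y x
AllPairs-lookup (px ∷ _)  (here refl) (here refl) = inj₁ refl
AllPairs-lookup (px ∷ _)  (here refl) (there q)   = inj₂ (inj₁ (All.lookup px q))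
AllPairs-lookup (px ∷ _)  (there p)   (here refl) = inj₂ (inj₂ (All.lookup px p))
AllPairs-lookup (_  ∷ ps) (there p)   (there q)   = AllPairs-lookup ps p q

infix 4 _∈ᴸ?_
_∈ᴸ?_ : ∀ {n} (X : Subset n) (T : List (Subset n)) → Dec (X ∈ᴸ T)
X ∈ᴸ? T = Any.any? (X ≟ˢ_) T

∈-minus⁻ : ∀ {n} {C : Subset n} {x r} → x ∈ C minus r → x ∈ C × x ≢ r
∈-minus⁻ {C = C} {x} {r} x∈ = p─q⊆p C ⁅ r ⁆ x∈ , λ { refl → x∉ C x∈ }
  where
  x∉ : ∀ {n} (C : Subset n) {x} → ¬ (x ∈ C minus x)
  x∉ (_ ∷ᵛ C) {Fin.suc x} (there q) = x∉ C q
  x∉ (true ∷ᵛ C) {Fin.zero} ()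
  x∉ (false ∷ᵛ C) {Fin.zero} ()

∈-minus⁺ : ∀ {n} {C : Subset n} {x r} → x ∈ C → x ≢ r → x ∈ C minus r
∈-minus⁺ = x∈p∧x≢y⇒x∈p-y

module Search {n : ℕ} (G : Graph n) where

  walk-start : ∀ {C x y} → WalkIn G C x y → x ∈ C
  walk-start (here p)     = p
  walk-start (step p _ _) = p

  walk-end : ∀ {C x y} → WalkIn G C x y → y ∈ C
  walk-end (here p)     = p
  walk-end (step _ _ w) = walk-end w

  walk-mono : ∀ {C D x y} → C ⊆ D → WalkIn G C x y → WalkIn G D x y
  walk-mono s (here p)     = here (s p)
  walk-mono s (step p e w) = step (s p) e (walk-mono s w)

  walk-trans : ∀ {C x y z} → WalkIn G C x y → WalkIn G C y z → WalkIn G C x z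
  walk-trans (here _)     w′ = w′
  walk-trans (step p e w) w′ = step p e (walk-trans w w′)

  adj-sym : ∀ {x y} → adj G x y ≡ true → adj G y x ≡ true
  adj-sym {x} {y} e = trans (sym G y x) e

  walk-sym : ∀ {C x y} → WalkIn G C x y → WalkIn G C y x
  walk-sym (here p)     = here p
  walk-sym (step p e w) = walk-trans (walk-sym w) (step (walk-start w) (adj-sym e) (here p))

  Component : Subset n → Fin n → Subset n → Set
  Component S c D = ∀ y → (y ∈ D → WalkIn G S c y) × (WalkIn G S c y → y ∈ D)

  module _ {S c D} (comp : Component S c D) where

    component-self : c ∈ S → c ∈ D
    component-self c∈S = proj₂ (comp c) (here c∈S)

    component-⊆ : D ⊆ S
    component-⊆ y∈D = walk-end (proj₁ (comp _) y∈D)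

    component-within : ∀ {x y} → x ∈ D → WalkIn G S x y → WalkIn G D x y
    component-within x∈D (here _)       = here x∈D
    component-within x∈D (step x∈S e w) = step x∈D e (component-within z∈D w)
      where z∈D = proj₂ (comp _) (walk-trans (proj₁ (comp _) x∈D) (step x∈S e (here (walk-start w))))

    component-connected : ConnectedOn G D
    component-connected x y x∈D y∈D =
      component-within x∈D (walk-trans (walk-sym (proj₁ (comp x) x∈D)) (proj₁ (comp y) y∈D))

    component-rebase : ∀ {d} → d ∈ D → Component S d D
    component-rebase d∈D y =
      (λ y∈D → walk-trans (walk-sym (proj₁ (comp _) d∈D)) (proj₁ (comp y) y∈D)) ,
      (λ w → proj₂ (comp y) (walk-trans (proj₁ (comp _) d∈D) w))

  component-unique : ∀ {S c D D′} → Component S c D → Component S c D′ → D ≡ D′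
  component-unique p q = ⊆-antisym (λ {y} y∈D → proj₂ (q y) (proj₁ (p y) y∈D))
                                   (λ {y} y∈D → proj₂ (p y) (proj₁ (q y) y∈D))

  -- A walk in S′ from c is also a walk in S, so it never leaves D. Deleting further vertices inside
  -- D thus yields the same component as deleting them from all of S, and a descent through two
  -- levels of a tree becomes one deletion of two vertices.
  component-nested : ∀ {S S′ c D D′} → Component S c D → S′ ⊆ S → (∀ {x} → x ∈ D → x ∈ S′ → x ∈ D′) → D′ ⊆ S′ →
    ∀ {F} → c ∈ D → Component D′ c F → Component S′ c F
  component-nested comp S′⊆S meet D′⊆S′ c∈D f y =
    (λ y∈F → walk-mono D′⊆S′ (proj₁ (f y) y∈F)) , (λ w → proj₂ (f y) (go c∈D w))
    where
    go : ∀ {x y} → x ∈ _ → WalkIn G _ x y → WalkIn G _ x y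
    go x∈D (here x∈S′)     = here (meet x∈D x∈S′)
    go x∈D (step x∈S′ e w) = step (meet x∈D x∈S′) e
      (go (proj₂ (comp _) (walk-trans (proj₁ (comp _) x∈D) (step (S′⊆S x∈S′) e (here (S′⊆S (walk-start w)))))) w)

  components⇒component : ∀ {S Cs D c} → IsComponents G S Cs → D ∈ᴸ Cs → c ∈ D → Component S c D
  components⇒component {S} {Cs} {D} {c} (_ , conn , sep , cover) D∈Cs c∈D y =
    (λ y∈D → walk-mono (λ x∈D → from (cover _) (lose′ D∈Cs x∈D)) (All.lookup conn D∈Cs c y c∈D y∈D)) , stay c∈D
    where
    lose′ : ∀ {x} {X : Subset n} → X ∈ᴸ Cs → x ∈ X → Any (x ∈_) Cs
    lose′ X∈ x∈X = lose X∈ x∈X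
    stay : ∀ {x y} → x ∈ D → WalkIn G S x y → y ∈ D
    stay x∈D (here _) = x∈D
    stay {x} x∈D (step {z = z} _ e w) with find (to (cover z) (walk-start w))
    ... | X , X∈Cs , z∈X with AllPairs-lookup sep D∈Cs X∈Cs
    ... | inj₁ refl = stay z∈X w
    ... | inj₂ (inj₁ s) = contradiction (trans (≡-sym e) (proj₂ (s x z x∈D z∈X))) λ ()
    ... | inj₂ (inj₂ s) = contradiction (trans (≡-sym (adj-sym e)) (proj₂ (s z x z∈X x∈D))) λ ()

  tree-nonempty : ∀ {C T} → Tree G C T → Nonempty C
  tree-nonempty (node r∈C _ _) = _ , r∈C

  mutual
    tree-tubes : ∀ {C T X} → Tree G C T → X ∈ᴸ T → X ⊆ C × Nonempty X
    tree-tubes (node r∈C _ _) (here refl) = id , (_ , r∈C)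
    tree-tubes {X = X} (node {r = r} r∈C comps f) (there q) with forest-tubes f q
    ... | D , D∈ , X⊆D , ne = (λ x∈X → proj₁ (∈-minus⁻ (from (proj₂ (proj₂ (proj₂ comps)) _) (lose D∈ (X⊆D x∈X))))) , ne

    forest-tubes : ∀ {Cs F X} → Forest G Cs F → X ∈ᴸ F → ∃[ D ] (D ∈ᴸ Cs × X ⊆ D × Nonempty X)
    forest-tubes (_∷_ {T = T} t f) q with ∈-++⁻ T q
    ... | inj₁ q′ = _ , here refl , tree-tubes t q′
    ... | inj₂ q′ with forest-tubes f q′
    ... | D , D∈ , rest = D , there D∈ , rest

  -- A search tree as seen by its tubes: the subtree below the root containing a given vertex c
  -- lives on the component of c, and its tubes are the tubes inside that component.
  data Shape : Subset n → List (Subset n) → Set where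
    shape : ∀ {C T} (r : Fin n) → r ∈ C → C ∈ᴸ T →
      (∀ {X} → X ∈ᴸ T → X ⊆ C × Nonempty X) →
      (∀ {X} → X ∈ᴸ T → X ≢ C → r ∉ X × (∀ {c D} → c ∈ X → Component (C minus r) c D → X ⊆ D)) →
      (∀ {c} → c ∈ C → c ≢ r → ∃₂ λ D U → Component (C minus r) c D ×
         (∀ X → (X ∈ᴸ U → X ∈ᴸ T × X ⊆ D) × (X ∈ᴸ T → X ⊆ D → X ∈ᴸ U)) × Shape D U) →
      Shape C T

  private
    disjoint : ∀ {C D x} → Separated G C D → x ∈ C → x ∈ D → ⊥
    disjoint s x∈C x∈D = proj₁ (s _ _ x∈C x∈D) refl

  mutual
    tree-shape : ∀ {C T} → Tree G C T → Shape C T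
    tree-shape {C} t@(node {r = r} {Cs} {F} r∈C comps@(_ , conn , sep , cover) f) =
      shape r r∈C (here refl) (tree-tubes t) below children
      where
      ⊆-rest : ∀ {X D} → D ∈ᴸ Cs → X ⊆ D → X ⊆ C minus r
      ⊆-rest D∈ X⊆D x∈X = from (cover _) (lose D∈ (X⊆D x∈X))

      below : ∀ {X} → X ∈ᴸ C ∷ F → X ≢ C → r ∉ X × (∀ {c D} → c ∈ X → Component (C minus r) c D → X ⊆ D)
      below (here refl) X≢C = contradiction refl X≢C
      below (there q) _ with forest-tubes f q
      ... | E , E∈ , X⊆E , _ = (λ r∈X → proj₂ (∈-minus⁻ (⊆-rest E∈ X⊆E r∈X)) refl) ,
        λ c∈X compD → subst (_ ⊆_) (component-unique (components⇒component comps E∈ (X⊆E c∈X)) compD) X⊆E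

      children : ∀ {c} → c ∈ C → c ≢ r → ∃₂ λ D U → Component (C minus r) c D ×
         (∀ X → (X ∈ᴸ U → X ∈ᴸ C ∷ F × X ⊆ D) × (X ∈ᴸ C ∷ F → X ⊆ D → X ∈ᴸ U)) × Shape D U
      children c∈C c≢r with find (to (cover _) (∈-minus⁺ c∈C c≢r))
      ... | D , D∈ , c∈D with forest-shape f sep D∈
      ... | U , tubes , s , _ = D , U , components⇒component comps D∈ c∈D ,
        (λ X → (λ X∈U → there (proj₁ (proj₁ (tubes X) X∈U)) , proj₂ (proj₁ (tubes X) X∈U)) ,
               λ { (here refl) C⊆D → contradiction refl (proj₂ (∈-minus⁻ (⊆-rest D∈ C⊆D r∈C)))
                 ; (there X∈F) X⊆D → proj₂ (tubes X) X∈F X⊆D }) , s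

    forest-shape : ∀ {Cs F D} → Forest G Cs F → AllPairs (Separated G) Cs → D ∈ᴸ Cs →
      ∃ λ U → (∀ X → (X ∈ᴸ U → X ∈ᴸ F × X ⊆ D) × (X ∈ᴸ F → X ⊆ D → X ∈ᴸ U)) × Shape D U × Tree G D U
    forest-shape (_∷_ {T = T} t f) (s ∷ _) (here refl) = T ,
      (λ X → (λ q → ∈-++⁺ˡ q , proj₁ (tree-tubes t q)) ,
             λ q X⊆C → [ id , (λ q′ → let (E , E∈ , X⊆E , (_ , x∈X)) = forest-tubes f q′ in
                                ⊥-elim (disjoint (All.lookup s E∈) (X⊆C x∈X) (X⊆E x∈X))) ]′ (∈-++⁻ T q)) ,
      tree-shape t , t
    forest-shape (_∷_ {T = T} t f) (s ∷ ss) (there D∈) with forest-shape f ss D∈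
    ... | U , tubes , sub = U ,
      (λ X → (λ q → ∈-++⁺ʳ T (proj₁ (proj₁ (tubes X) q)) , proj₂ (proj₁ (tubes X) q)) ,
             λ q X⊆D → [ (λ q′ → let (X⊆C , (_ , x∈X)) = tree-tubes t q′ in
                           ⊥-elim (disjoint (All.lookup s D∈) (X⊆C x∈X) (X⊆D x∈X)))
                       , (λ q′ → proj₂ (tubes X) q′ X⊆D) ]′ (∈-++⁻ T q)) , sub

-- How the root path of a vertex c may change under a rotation exchanging u and v; Sep v u c says that
-- v separates u from c (in particular when v = c).
data Swapped {a ℓ} {A : Set a} (Sep : A → A → A → Set ℓ) (u v c : A) : List A → List A → Set (a Level.⊔ ℓ) where
  same : ∀ {w} → Swapped Sep u v c w w
  keep : ∀ {x w w′} → Swapped Sep u v c w w′ → Swapped Sep u v c (x ∷ w) (x ∷ w′)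
  swap : ∀ {w} → Swapped Sep u v c (u ∷ v ∷ w) (v ∷ u ∷ w)
  drop : ∀ {w} → Sep v u c → Swapped Sep u v c (u ∷ v ∷ w) (v ∷ w)
  add  : ∀ {w} → Sep u v c → Swapped Sep u v c (u ∷ w) (v ∷ u ∷ w)

-- Root paths, and why they depend only on the tubes

module Paths {n : ℕ} (G : Graph n) where
  open Search G

  Separates : Fin n → Fin n → Fin n → Set
  Separates v u c = ∃[ C ] (ConnectedOn G C × u ∈ C × c ∈ C × ¬ WalkIn G (C minus v) u c)

  path : ∀ {C T} → Shape C T → Fin n → List (Fin n)
  path {C} (shape r _ _ _ _ children) c with c Fin.≟ r | c ∈? C
  ... | no c≢r | yes c∈C = r ∷ path (proj₂ (proj₂ (proj₂ (proj₂ (children c∈C c≢r))))) c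
  -- This covers the end of the path at c = r and, as a default value, c ∉ C.
  ... | _      | _       = r ∷ []

  root : ∀ {C T} → Shape C T → Fin n
  root (shape r _ _ _ _ _) = r

  record Child {C T} (t : Shape C T) (c : Fin n) : Set where
    field
      {D}   : Subset n
      {U}   : List (Subset n)
      comp  : Component (C minus root t) c D
      tubes : ∀ X → (X ∈ᴸ U → X ∈ᴸ T × X ⊆ D) × (X ∈ᴸ T → X ⊆ D → X ∈ᴸ U)
      sub   : Shape D U

    inner : ∀ {X} → X ∈ᴸ U → X ∈ᴸ T
    inner X∈U = proj₁ (proj₁ (tubes _) X∈U)

  module _ {C : Subset n} {T : List (Subset n)} where
    root∈ : (t : Shape C T) → root t ∈ C
    root∈ (shape _ r∈ _ _ _ _) = r∈

    top∈ : Shape C T → C ∈ᴸ T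
    top∈ (shape _ _ C∈ _ _ _) = C∈

    tube-⊆ : Shape C T → ∀ {X} → X ∈ᴸ T → X ⊆ C
    tube-⊆ (shape _ _ _ b _ _) X∈ = proj₁ (b X∈)

    tube-nonempty : Shape C T → ∀ {X} → X ∈ᴸ T → Nonempty X
    tube-nonempty (shape _ _ _ b _ _) X∈ = proj₂ (b X∈)

    root∉ : (t : Shape C T) → ∀ {X} → X ∈ᴸ T → X ≢ C → root t ∉ X
    root∉ (shape _ _ _ _ s _) X∈ ne = proj₁ (s X∈ ne)

    tube-within : (t : Shape C T) → ∀ {X} → X ∈ᴸ T → X ≢ C → ∀ {c D} → c ∈ X → Component (C minus root t) c D → X ⊆ D
    tube-within (shape _ _ _ _ s _) X∈ ne = proj₂ (s X∈ ne)

    child : (t : Shape C T) → ∀ {c} → c ∈ C → c ≢ root t → Child t c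
    child (shape _ _ _ _ _ ch) c∈C c≢r with ch c∈C c≢r
    ... | D , U , comp , tubes , s = record { comp = comp ; tubes = tubes ; sub = s }

  child∈ : ∀ {C T} {t : Shape C T} {c} (ch : Child t c) → c ∈ C → c ≢ root t → c ∈ Child.D ch
  child∈ ch c∈C c≢r = component-self (Child.comp ch) (∈-minus⁺ c∈C c≢r)

  root∉child : ∀ {C T} {t : Shape C T} {c} (ch : Child t c) → root t ∉ Child.D ch
  root∉child ch r∈ = proj₂ (∈-minus⁻ (component-⊆ (Child.comp ch) r∈)) refl

  child-⊆ : ∀ {C T} {t : Shape C T} {c} (ch : Child t c) → Child.D ch ⊆ C
  child-⊆ ch x∈ = proj₁ (∈-minus⁻ (component-⊆ (Child.comp ch) x∈))

  child≢ : ∀ {C T} {t : Shape C T} {c} (ch : Child t c) → Child.D ch ≢ C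
  child≢ {t = t} ch refl = root∉child ch (root∈ t)

  child-top∈ : ∀ {C T} {t : Shape C T} {c} (ch : Child t c) → Child.D ch ∈ᴸ T
  child-top∈ ch = Child.inner ch (top∈ (Child.sub ch))

  -- `path` enters the child given by the proofs that the two decisions return, so these proofs come
  -- with the equation.
  path-unfold : ∀ {C T} (t : Shape C T) {c} → c ∈ C → c ≢ root t →
    ∃₂ λ p q → path t c ≡ root t ∷ path (Child.sub (child t {c} p q)) c
  path-unfold {C} t@(shape r _ _ _ _ children) {c} c∈C c≢r with c Fin.≟ r | c ∈? C
  ... | yes eq | _ = contradiction eq c≢r
  ... | no _ | no c∉C = contradiction c∈C c∉C
  ... | no c≢r′ | yes c∈C′ = c∈C′ , c≢r′ , refl

  path-child : ∀ {C T} (t : Shape C T) {c} → c ∈ C → c ≢ root t →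
    ∃[ ch ] path t c ≡ root t ∷ path (Child.sub {t = t} {c} ch) c
  path-child t c∈C c≢r = let (p , q , eq) = path-unfold t c∈C c≢r in child t p q , eq

  path-root : ∀ {C T} (t : Shape C T) {c} → root t ≡ c → path t c ≡ root t ∷ []
  path-root (shape r _ _ _ _ _) refl with r Fin.≟ r
  ... | yes _ = refl
  ... | no ne = contradiction refl ne

  -- If the roots differed, the subtree of t′ containing `root t` would be a proper tube of T, but
  -- `root t` lies in no proper tube of T.
  root-unique : ∀ {C T T′} (t : Shape C T) (t′ : Shape C T′) → (∀ {X} → X ∈ᴸ T′ → X ∈ᴸ T) → root t ≡ root t′
  root-unique t t′ T′⊆T with root t Fin.≟ root t′
  ... | yes eq = eq
  ... | no ne = contradiction (child∈ ch (root∈ t) ne) (root∉ t (T′⊆T (child-top∈ ch)) (child≢ ch))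
    where ch = child t′ (root∈ t) ne

  -- The tubes determine the root, then the component of c below it, and so on down the tree; the
  -- order in which components are listed has no influence.
  path-cong : ∀ {C D T U} (t : Shape C T) (u : Shape D U) → C ≡ D → (∀ {X} → X ∈ᴸ T → X ∈ᴸ U) → (∀ {X} → X ∈ᴸ U → X ∈ᴸ T) →
    ∀ {c} → c ∈ C → path t c ≡ path u c
  path-cong t t′ refl incl excl {c} c∈C = go t t′ incl excl c∈C
    where
    go : ∀ {C T T′} (t : Shape C T) (t′ : Shape C T′) → (∀ {X} → X ∈ᴸ T → X ∈ᴸ T′) → (∀ {X} → X ∈ᴸ T′ → X ∈ᴸ T) →
      ∀ {c} → c ∈ C → path t c ≡ path t′ c
    go t@(shape r _ _ _ _ children) t′@(shape r′ _ _ _ _ children′) incl excl {c} c∈C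
      with root-unique t t′ excl | r Fin.≟ c
    ... | refl | yes refl = trans (path-root t refl) (≡-sym (path-root t′ refl))
    ... | refl | no r≢c with ≢-sym r≢c
    ... | c≢r with path-unfold t c∈C c≢r | path-unfold t′ c∈C c≢r
    ... | p , q , eq | p′ , q′ , eq′ with children p q | children′ p′ q′
    ... | D , U , comp , tubes , s | D′ , U′ , comp′ , tubes′ , s′ with component-unique comp comp′
    ... | refl = trans eq (trans (cong (r ∷_) (go s s′
        (λ X∈ → let (X∈T , X⊆D) = proj₁ (tubes _) X∈ in proj₂ (tubes′ _) (incl X∈T) X⊆D)
        (λ X∈ → let (X∈T , X⊆D) = proj₁ (tubes′ _) X∈ in proj₂ (tubes _) (excl X∈T) X⊆D)
        (component-self comp (∈-minus⁺ c∈C c≢r)))) (≡-sym eq′))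

  -- No search tree has strictly fewer tubes than another on the same C: the roots agree, and every
  -- proper tube lies in a child component, where the comparison recurses. This later locates the
  -- tube created by a rotation.
  maximal : ∀ {C T T′} (t : Shape C T) (t′ : Shape C T′) → (∀ {X} → X ∈ᴸ T′ → X ∈ᴸ T) → ∀ {X} → X ∈ᴸ T → X ∈ᴸ T′
  maximal {C} t@(shape r _ _ inC below children) t′@(shape _ _ top′ _ _ children′) T′⊆T {X} X∈T
    with X ≟ˢ C | root-unique t t′ T′⊆T
  ... | yes refl | _ = top′
  ... | no X≢C | refl with inC X∈T
  ... | X⊆C , c , c∈X with X⊆C c∈X | ((c ≢ r) ∋ λ { refl → proj₁ (below X∈T X≢C) c∈X })
  ... | c∈C | c≢r with children c∈C c≢r | children′ c∈C c≢r
  ... | D , U , comp , tubes , s | D′ , U′ , comp′ , tubes′ , s′ with component-unique comp comp′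
  ... | refl = proj₁ (proj₁ (tubes′ X) (maximal s s′
        (λ Y∈ → let (Y∈T , Y⊆D) = proj₁ (tubes′ _) Y∈ in proj₂ (tubes _) (T′⊆T Y∈T) Y⊆D)
        (proj₂ (tubes X) X∈T (proj₂ (below X∈T X≢C) c∈X comp))))

-- Root paths under a rotation

module Rotations {n : ℕ} (G : Graph n) where
  open Search G
  open Paths G

  record Exchange (T T′ : List (Subset n)) (A B : Subset n) : Set where
    field
      A∈   : A ∈ᴸ T
      A∉   : A ∉ᴸ T′
      B∈   : B ∈ᴸ T′
      B∉   : B ∉ᴸ T
      lost : ∀ {X} → X ∈ᴸ T → X ∈ᴸ T′ ⊎ X ≡ A
      won  : ∀ {X} → X ∈ᴸ T′ → X ∈ᴸ T ⊎ X ≡ B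

  rotation⇒exchange : ∀ {T T′} → Rotation G T T′ → ∃₂ λ A B → Exchange T T′ A B
  rotation⇒exchange {T} {T′} (A , B , A∈ , A∉ , B∈ , B∉ , onlyA , onlyB) = A , B , record
    { A∈ = A∈ ; A∉ = A∉ ; B∈ = B∈ ; B∉ = B∉ ; lost = lost ; won = won }
    where
    lost : ∀ {X} → X ∈ᴸ T → X ∈ᴸ T′ ⊎ X ≡ A
    lost {X} X∈ with X ∈ᴸ? T′
    ... | yes p = inj₁ p
    ... | no np = inj₂ (onlyA X X∈ np)
    won : ∀ {X} → X ∈ᴸ T′ → X ∈ᴸ T ⊎ X ≡ B
    won {X} X∈ with X ∈ᴸ? T
    ... | yes p = inj₁ p
    ... | no np = inj₂ (onlyB X X∈ np)

  exchange-sym : ∀ {T T′ A B} → Exchange T T′ A B → Exchange T′ T B A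
  exchange-sym e = record { A∈ = B∈ ; A∉ = B∉ ; B∈ = A∈ ; B∉ = A∉ ; lost = won ; won = lost }
    where open Exchange e

  component-shrink : ∀ {S c D v} → Component S c D → v ∉ D → c ∈ D → Component (S minus v) c D
  component-shrink {S} {c} {D} {v} comp v∉D c∈D y =
    (λ y∈D → walk-mono (λ {x} x∈D → ∈-minus⁺ (component-⊆ comp x∈D) (λ { refl → v∉D x∈D }))
               (component-connected comp c y c∈D y∈D)) ,
    (λ w → proj₂ (comp y) (walk-mono (λ x∈ → proj₁ (∈-minus⁻ x∈)) w))

  -- Look at the last visit to u or v on the walk: from there on, the other vertex is avoided.
  last-of-two : ∀ {C u v x c} → u ≢ v → c ≢ u → c ≢ v → WalkIn G C x c →
    WalkIn G (C minus v) u c ⊎ WalkIn G (C minus u) v c ⊎ WalkIn G ((C minus u) minus v) x c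
  last-of-two u≢v c≢u c≢v (here c∈C) = inj₂ (inj₂ (here (∈-minus⁺ (∈-minus⁺ c∈C c≢u) c≢v)))
  last-of-two {u = u} {v} {x} u≢v c≢u c≢v (step x∈C e w) with last-of-two {u = u} {v} u≢v c≢u c≢v w
  ... | inj₁ p = inj₁ p
  ... | inj₂ (inj₁ p) = inj₂ (inj₁ p)
  ... | inj₂ (inj₂ p) with u Fin.≟ x | v Fin.≟ x
  ... | yes refl | _ = inj₁ (step (∈-minus⁺ x∈C u≢v) e
        (walk-mono (λ y∈ → ∈-minus⁺ (proj₁ (∈-minus⁻ (proj₁ (∈-minus⁻ y∈)))) (proj₂ (∈-minus⁻ y∈))) p))
  ... | no u≢x | yes refl = inj₂ (inj₁ (step (∈-minus⁺ x∈C (≢-sym u≢x)) e (walk-mono (λ y∈ → proj₁ (∈-minus⁻ y∈)) p)))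
  ... | no u≢x | no v≢x = inj₂ (inj₂ (step (∈-minus⁺ (∈-minus⁺ x∈C (≢-sym u≢x)) (≢-sym v≢x)) e p))

  module _ {C T T′ A B} (t : Shape C T) (t′ : Shape C T′) (ex : Exchange T T′ A B) (u≢v : root t ≢ root t′) where
    open Exchange ex
    -- The vertex `root t′` lies in no proper tube of T′, so every proper tube of T containing it is
    -- lost, hence equal to A. A child and a grandchild containing it would be two different such
    -- tubes, so it is already the root of the child.
    pivot : ∀ {c} (ch : Child t c) → root t′ ∈ Child.D ch → Child.D ch ≡ A × root (Child.sub ch) ≡ root t′
    pivot ch v∈D with lost (child-top∈ ch)
    ... | inj₁ D∈T′ = contradiction v∈D (root∉ t′ D∈T′ (child≢ ch))
    ... | inj₂ D≡A with root (Child.sub ch) Fin.≟ root t′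
    ... | yes s≡v = D≡A , s≡v
    ... | no s≢v with child (Child.sub ch) v∈D (≢-sym s≢v)
    ... | g with lost (Child.inner ch (child-top∈ g))
    ... | inj₁ E∈T′ = contradiction (child∈ g v∈D (≢-sym s≢v))
            (root∉ t′ E∈T′ (λ E≡C → root∉child ch (child-⊆ g (subst (root t ∈_) (≡-sym E≡C) (root∈ t)))))
    ... | inj₂ E≡A = contradiction (trans E≡A (≡-sym D≡A)) (child≢ g)

    A≡child : ∀ {c} (ch : Child t c) → root t′ ∈ Child.D ch → Child.D ch ≡ A
    A≡child ch v∈D = proj₁ (pivot ch v∈D)

    v∈A : root t′ ∈ A
    v∈A = subst (root t′ ∈_) (A≡child ch v∈) v∈
      where
      ch = child t (root∈ t′) (≢-sym u≢v)
      v∈ = child∈ ch (root∈ t′) (≢-sym u≢v)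

    -- The part of the root path of c below both pivots. It lives on the component of c after
    -- deleting both roots, which is the same set for t and t′.
    record Tail (c : Fin n) : Set where
      field
        {D}   : Subset n
        {U}   : List (Subset n)
        comp  : Component ((C minus root t) minus root t′) c D
        tubes : ∀ X → (X ∈ᴸ U → X ∈ᴸ T × X ⊆ D) × (X ∈ᴸ T → X ⊆ D → X ∈ᴸ U)
        sub   : Shape D U
        form  : path t c ≡ root t ∷ root t′ ∷ path sub c ⊎ (path t c ≡ root t ∷ path sub c × ¬ WalkIn G (C minus root t) (root t′) c)

    tail : ∀ {c} → c ∈ C → c ≢ root t → c ≢ root t′ → Tail c
    tail {c} c∈C c≢u c≢v = go (path-child t c∈C c≢u)
      where
      go : ∃[ ch ] path t c ≡ root t ∷ path (Child.sub {t = t} {c} ch) c → Tail c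
      go (ch , eq) = split (root t′ ∈? Child.D ch)
        where
        c∈D = child∈ ch c∈C c≢u

        deep : root (Child.sub ch) ≡ root t′ →
          ∃[ g ] path (Child.sub ch) c ≡ root (Child.sub ch) ∷ path (Child.sub {t = Child.sub ch} {c} g) c → Tail c
        deep s≡v (g , eq′) = record
          { comp = component-nested (Child.comp ch) (λ x∈ → proj₁ (∈-minus⁻ x∈))
              (λ x∈D x∈S → ∈-minus⁺ x∈D (λ x≡s → proj₂ (∈-minus⁻ x∈S) (trans x≡s s≡v)))
              (λ x∈ → ∈-minus⁺ (component-⊆ (Child.comp ch) (proj₁ (∈-minus⁻ x∈)))
                               (λ x≡v → proj₂ (∈-minus⁻ x∈) (trans x≡v (≡-sym s≡v)))) c∈D (Child.comp g)
          ; tubes = λ X → (λ X∈ → let (X∈U , X⊆) = proj₁ (Child.tubes g X) X∈ in Child.inner ch X∈U , X⊆) ,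
                          (λ X∈T X⊆ → proj₂ (Child.tubes g X) (proj₂ (Child.tubes ch X) X∈T (λ x∈ → child-⊆ g (X⊆ x∈))) X⊆)
          ; sub = Child.sub g
          ; form = inj₁ (trans eq (cong (root t ∷_) (trans eq′ (cong (_∷ path (Child.sub g) c) s≡v)))) }

        split : Dec (root t′ ∈ Child.D ch) → Tail c
        split (no v∉D) = record { comp = component-shrink (Child.comp ch) v∉D c∈D ; tubes = Child.tubes ch
          ; sub = Child.sub ch ; form = inj₂ (eq , λ w → v∉D (proj₂ (Child.comp ch _) (walk-sym w))) }
        split (yes v∈D) = let s≡v = proj₂ (pivot ch v∈D) in
          deep s≡v (path-child (Child.sub ch) c∈D (λ c≡s → c≢v (trans c≡s s≡v)))

  path-flip-top : ∀ {C T T′ A B} → ConnectedOn G C → (t : Shape C T) (t′ : Shape C T′) → Exchange T T′ A B →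
    root t ≢ root t′ → ∀ {c} → c ∈ C → Swapped Separates (root t) (root t′) c (path t c) (path t′ c)
  path-flip-top {C} {T} {T′} {A} {B} conn t t′ ex u≢v {c} c∈C = cases (root t Fin.≟ c) (root t′ Fin.≟ c)
    where
    open Exchange ex
    u = root t
    v = root t′

    isolated : ∀ {x y} → ¬ WalkIn G (C minus x) y x
    isolated w = proj₂ (∈-minus⁻ (walk-end w)) refl

    end : ∀ {T T′ A B} (t : Shape C T) (t′ : Shape C T′) → Exchange T T′ A B → root t ≢ root t′ → root t ≡ c →
      path t′ c ≡ root t′ ∷ root t ∷ []
    end t t′ ex u≢v u≡c = go (path-child t′ c∈C (λ c≡v → u≢v (trans u≡c c≡v)))
      where
      go : ∃[ ch ] path t′ c ≡ root t′ ∷ path (Child.sub {t = t′} {c} ch) c → path t′ c ≡ root t′ ∷ root t ∷ []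
      go (ch , eq) = trans eq (cong (root t′ ∷_) (trans (path-root (Child.sub ch) (trans s≡u u≡c)) (cong (_∷ []) s≡u)))
        where s≡u = proj₂ (pivot t′ t (exchange-sym ex) (≢-sym u≢v) ch
                      (subst (_∈ Child.D ch) (≡-sym u≡c) (child∈ ch c∈C (λ c≡v → u≢v (trans u≡c c≡v)))))

    apart : u ≢ c → v ≢ c → Swapped Separates u v c (path t c) (path t′ c)
    apart u≢c v≢c = combine (Tail.form τ) (Tail.form τ′)
      where
      τ = tail t t′ ex u≢v c∈C (≢-sym u≢c) (≢-sym v≢c)
      τ′ = tail t′ t (exchange-sym ex) (≢-sym u≢v) c∈C (≢-sym v≢c) (≢-sym u≢c)

      D≡ : Tail.D τ ≡ Tail.D τ′
      D≡ = component-unique (Tail.comp τ)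
        (subst (λ S → Component S c (Tail.D τ′)) (p─x─y≡p─y─x C v u) (Tail.comp τ′))

      -- A contains v and B contains u, so neither fits into a component of C without u and v; the
      -- tubes under the tail survive the rotation.
      avoid : ∀ {X} → X ⊆ Tail.D τ → X ≢ A × X ≢ B
      avoid X⊆D = (λ { refl → proj₂ (∈-minus⁻ (component-⊆ (Tail.comp τ) (X⊆D (v∈A t t′ ex u≢v)))) refl }) ,
                  (λ { refl → proj₂ (∈-minus⁻ (proj₁ (∈-minus⁻ (component-⊆ (Tail.comp τ)
                      (X⊆D (v∈A t′ t (exchange-sym ex) (≢-sym u≢v))))))) refl })

      w≡ : path (Tail.sub τ) c ≡ path (Tail.sub τ′) c
      w≡ = path-cong (Tail.sub τ) (Tail.sub τ′) D≡
        (λ X∈ → let (X∈T , X⊆D) = proj₁ (Tail.tubes τ _) X∈ in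
          proj₂ (Tail.tubes τ′ _) ([ id , (λ X≡A → contradiction X≡A (proj₁ (avoid X⊆D))) ]′ (lost X∈T)) (subst (_ ⊆_) D≡ X⊆D))
        (λ X∈ → let (X∈T′ , X⊆D′) = proj₁ (Tail.tubes τ′ _) X∈ ; X⊆D = subst (_ ⊆_) (≡-sym D≡) X⊆D′ in
          proj₂ (Tail.tubes τ _) ([ id , (λ X≡B → contradiction X≡B (proj₂ (avoid X⊆D))) ]′ (won X∈T′)) X⊆D)
        (component-self (Tail.comp τ) (∈-minus⁺ (∈-minus⁺ c∈C (≢-sym u≢c)) (≢-sym v≢c)))

      combine : path t c ≡ u ∷ v ∷ path (Tail.sub τ) c ⊎ (path t c ≡ u ∷ path (Tail.sub τ) c × ¬ WalkIn G (C minus u) v c) →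
                path t′ c ≡ v ∷ u ∷ path (Tail.sub τ′) c ⊎ (path t′ c ≡ v ∷ path (Tail.sub τ′) c × ¬ WalkIn G (C minus v) u c) →
                Swapped Separates u v c (path t c) (path t′ c)
      combine (inj₁ e) (inj₁ e′) rewrite e | e′ | w≡ = swap
      combine (inj₁ e) (inj₂ (e′ , sep)) rewrite e | e′ | w≡ = drop (C , conn , root∈ t , c∈C , sep)
      combine (inj₂ (e , sep)) (inj₁ e′) rewrite e | e′ | w≡ = add (C , conn , root∈ t′ , c∈C , sep)
      -- The two separations exclude each other: on a walk from u to c in the connected set C, the
      -- last of u and v reaches c while avoiding the other.
      combine (inj₂ (e , sep)) (inj₂ (e′ , sep′))
        with last-of-two {u = u} {v} u≢v (≢-sym u≢c) (≢-sym v≢c) (conn u c (root∈ t) c∈C)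
      ... | inj₁ w = contradiction w sep′
      ... | inj₂ (inj₁ w) = contradiction w sep
      ... | inj₂ (inj₂ w) = contradiction refl (proj₂ (∈-minus⁻ (proj₁ (∈-minus⁻ (walk-start w)))))

    cases : Dec (root t ≡ c) → Dec (root t′ ≡ c) → Swapped Separates u v c (path t c) (path t′ c)
    cases (yes u≡c) _ = subst₂ (Swapped Separates u v c) (≡-sym (path-root t u≡c)) (≡-sym (end t t′ ex u≢v u≡c))
      (add (C , conn , root∈ t′ , c∈C , subst (λ x → ¬ WalkIn G (C minus x) v c) (≡-sym u≡c) isolated))
    cases (no _) (yes v≡c) = subst₂ (Swapped Separates u v c)
      (≡-sym (end t′ t (exchange-sym ex) (≢-sym u≢v) v≡c)) (≡-sym (path-root t′ v≡c))
      (drop (C , conn , root∈ t , c∈C , subst (λ x → ¬ WalkIn G (C minus x) u c) (≡-sym v≡c) isolated))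
    cases (no u≢c) (no v≢c) = apart u≢c v≢c

  -- Descend while the roots agree: both exchanged tubes lie in one child component D, and paths
  -- into other children stay as they are. The pair u, v is found once and serves every c.
  path-flip : ∀ {C T T′ A B} → ConnectedOn G C → (t : Shape C T) (t′ : Shape C T′) → Exchange T T′ A B →
    ∃₂ λ u v → u ≢ v × (∀ {c} → c ∈ C → Swapped Separates u v c (path t c) (path t′ c))
  path-flip {C} {T} {T′} {A} {B} conn t@(shape r _ _ _ _ children) t′ ex with root t Fin.≟ root t′
  ... | no u≢v = root t , root t′ , u≢v , path-flip-top conn t t′ ex u≢v
  ... | yes refl with tube-nonempty t (Exchange.A∈ ex)
  ... | a , a∈A with tube-⊆ t (Exchange.A∈ ex) a∈A | (a ≢ r) ∋ (λ { refl → root∉ t (Exchange.A∈ ex) A≢C a∈A })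
    where
    A≢C : A ≢ C
    A≢C A≡C = Exchange.A∉ ex (subst (_∈ᴸ T′) (≡-sym A≡C) (top∈ t′))
  ... | a∈C | a≢r with children a∈C a≢r | child t′ a∈C a≢r
  ... | D , U , comp , tubes , s | ch′ with component-unique comp (Child.comp ch′)
  ... | refl = u , v , u≢v , swapped
    where
    open Exchange ex
    A≢C : A ≢ C
    A≢C A≡C = A∉ (subst (_∈ᴸ T′) (≡-sym A≡C) (top∈ t′))

    A⊆D : A ⊆ D
    A⊆D = tube-within t A∈ A≢C a∈A comp

    -- Otherwise all tubes of T′ inside D would be tubes of T, and maximality would put A into T′.
    B⊆D : B ⊆ D
    B⊆D with B ⊆? D
    ... | yes p = p
    ... | no B⊈D = contradiction (Child.inner ch′ (maximal s (Child.sub ch′) (λ X∈ → let (X∈T′ , X⊆D) = proj₁ (Child.tubes ch′ _) X∈ in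
             proj₂ (tubes _) ([ id , (λ { refl → ⊥-elim (B⊈D X⊆D) }) ]′ (won X∈T′)) X⊆D) (proj₂ (tubes A) A∈ A⊆D))) A∉

    inner : Exchange U (Child.U ch′) A B
    inner = record
      { A∈ = proj₂ (tubes A) A∈ A⊆D
      ; A∉ = λ A∈U′ → A∉ (Child.inner ch′ A∈U′)
      ; B∈ = proj₂ (Child.tubes ch′ B) B∈ B⊆D
      ; B∉ = λ B∈U → B∉ (proj₁ (proj₁ (tubes B) B∈U))
      ; lost = λ X∈ → let (X∈T , X⊆D) = proj₁ (tubes _) X∈ in Sum.map₁ (λ X∈T′ → proj₂ (Child.tubes ch′ _) X∈T′ X⊆D) (lost X∈T)
      ; won = λ X∈ → let (X∈T′ , X⊆D) = proj₁ (Child.tubes ch′ _) X∈ in Sum.map₁ (λ X∈T → proj₂ (tubes _) X∈T X⊆D) (won X∈T′) }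

    rec = path-flip (component-connected comp) s (Child.sub ch′) inner
    u = proj₁ rec
    v = proj₁ (proj₂ rec)
    u≢v = proj₁ (proj₂ (proj₂ rec))

    meets : ∀ {c E d} → Component (C minus r) c E → d ∈ E → d ∈ D → c ∈ D
    meets compE d∈E d∈D = proj₂ (comp _) (walk-trans (proj₁ (comp _) d∈D) (walk-sym (proj₁ (compE _) d∈E)))

    module Below {c} (c≢r : c ≢ r) (c∈C : c ∈ C) (e : Child t c) (e′ : Child t′ c) where

      agree : c ∉ D → path (Child.sub e) c ≡ path (Child.sub e′) c
      agree c∉D = path-cong (Child.sub e) (Child.sub e′) D≡
            (λ X∈ → let (X∈T , X⊆) = proj₁ (Child.tubes e _) X∈ in
              proj₂ (Child.tubes e′ _) ([ id , (λ { refl → ⊥-elim (A⊈ X⊆) }) ]′ (lost X∈T)) (subst (_ ⊆_) D≡ X⊆))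
            (λ X∈ → let (X∈T′ , X⊆′) = proj₁ (Child.tubes e′ _) X∈ ; X⊆ = subst (_ ⊆_) (≡-sym D≡) X⊆′ in
              proj₂ (Child.tubes e _) ([ id , (λ { refl → ⊥-elim (B⊈ X⊆) }) ]′ (won X∈T′)) X⊆)
            (child∈ e c∈C c≢r)
        where
        D≡ : Child.D e ≡ Child.D e′
        D≡ = component-unique (Child.comp e) (Child.comp e′)
        A⊈ : ¬ A ⊆ Child.D e
        A⊈ A⊆ = c∉D (meets (Child.comp e) (A⊆ a∈A) (A⊆D a∈A))
        B⊈ : ¬ B ⊆ Child.D e
        B⊈ B⊆ = let (b , b∈B) = tube-nonempty t′ B∈ in c∉D (meets (Child.comp e) (B⊆ b∈B) (B⊆D b∈B))

      at : c ∈ D → path s c ≡ path (Child.sub e) c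
      at c∈D = path-cong s (Child.sub e) D≡
            (λ X∈ → let (X∈T , X⊆) = proj₁ (tubes _) X∈ in proj₂ (Child.tubes e _) X∈T (subst (_ ⊆_) D≡ X⊆))
            (λ X∈ → let (X∈T , X⊆) = proj₁ (Child.tubes e _) X∈ in proj₂ (tubes _) X∈T (subst (_ ⊆_) (≡-sym D≡) X⊆)) c∈D
        where
        D≡ : D ≡ Child.D e
        D≡ = component-unique (component-rebase comp c∈D) (Child.comp e)

      at′ : c ∈ D → path (Child.sub ch′) c ≡ path (Child.sub e′) c
      at′ c∈D = path-cong (Child.sub ch′) (Child.sub e′) D≡
            (λ X∈ → let (X∈T , X⊆) = proj₁ (Child.tubes ch′ _) X∈ in proj₂ (Child.tubes e′ _) X∈T (subst (_ ⊆_) D≡ X⊆))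
            (λ X∈ → let (X∈T , X⊆) = proj₁ (Child.tubes e′ _) X∈ in proj₂ (Child.tubes ch′ _) X∈T (subst (_ ⊆_) (≡-sym D≡) X⊆)) c∈D
        where
        D≡ : D ≡ Child.D e′
        D≡ = component-unique (component-rebase comp c∈D) (Child.comp e′)

    swapped : ∀ {c} → c ∈ C → Swapped Separates u v c (path t c) (path t′ c)
    swapped {c} c∈C = cases (r Fin.≟ c) (c ∈? D)
      where
      cases : Dec (r ≡ c) → Dec (c ∈ D) → Swapped Separates u v c (path t c) (path t′ c)
      cases (yes r≡c) _ = subst₂ (Swapped Separates u v c) (≡-sym (path-root t r≡c)) (≡-sym (path-root t′ r≡c)) same
      cases (no r≢c) (yes c∈D) = let (e , eq) = path-child t c∈C (≢-sym r≢c) ; (e′ , eq′) = path-child t′ c∈C (≢-sym r≢c)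
                                     open Below (≢-sym r≢c) c∈C e e′ in
        subst₂ (Swapped Separates u v c) (≡-sym (trans eq (cong (r ∷_) (≡-sym (at c∈D)))))
          (≡-sym (trans eq′ (cong (r ∷_) (≡-sym (at′ c∈D))))) (keep (proj₂ (proj₂ (proj₂ rec)) c∈D))
      cases (no r≢c) (no c∉D) = let (e , eq) = path-child t c∈C (≢-sym r≢c) ; (e′ , eq′) = path-child t′ c∈C (≢-sym r≢c)
                                    open Below (≢-sym r≢c) c∈C e e′ in
        subst (Swapped Separates u v c (path t c)) (trans eq (trans (cong (r ∷_) (agree c∉D)) (≡-sym eq′))) same

-- The potential

Swapped-map : ∀ {a b ℓ ℓ′} {A : Set a} {B : Set b} {Sep : A → A → A → Set ℓ} {Sep′ : B → B → B → Set ℓ′} (f : A → B) →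
  (∀ {u v c} → Sep u v c → Sep′ (f u) (f v) (f c)) →
  ∀ {u v c w w′} → Swapped Sep u v c w w′ → Swapped Sep′ (f u) (f v) (f c) (map f w) (map f w′)
Swapped-map f h same     = same
Swapped-map f h (keep p) = keep (Swapped-map f h p)
Swapped-map f h swap     = swap
Swapped-map f h (drop s) = drop (h s)
Swapped-map f h (add s)  = add (h s)

cost : Maybe Bool → Maybe Bool → ℕ
cost (just false) (just true)  = 1
cost (just true)  (just false) = 1
cost _            _            = 0

update : Maybe Bool → Maybe Bool → Maybe Bool
update s nothing  = s
update _ (just b) = just b

-- The state s is the last colour seen.
turns : Maybe Bool → List (Maybe Bool) → ℕ
turns s []      = 0
turns s (x ∷ w) = cost s x + turns (update s x) w

cost≤1 : ∀ s x → cost s x ≤ 1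
cost≤1 nothing      x            = z≤n
cost≤1 (just false) nothing      = z≤n
cost≤1 (just true)  nothing      = z≤n
cost≤1 (just false) (just false) = z≤n
cost≤1 (just false) (just true)  = s≤s z≤n
cost≤1 (just true)  (just false) = s≤s z≤n
cost≤1 (just true)  (just true)  = z≤n

cost-nothing : ∀ s → cost s nothing ≡ 0
cost-nothing nothing      = refl
cost-nothing (just false) = refl
cost-nothing (just true)  = refl

cost-refl : ∀ b → cost (just b) (just b) ≡ 0
cost-refl false = refl
cost-refl true  = refl

-- The starting state matters only up to the first coloured entry, where it decides at most one
-- change.
turns-state : ∀ s s′ w → turns s w ≤ 1 + turns s′ w
turns-state s s′ []             = z≤n
turns-state s s′ (nothing ∷ w) rewrite cost-nothing s | cost-nothing s′ = turns-state s s′ w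
turns-state s s′ (just b ∷ w)   =
  ℕₚ.+-mono-≤ (cost≤1 s (just b)) (ℕₚ.m≤n+m (turns (just b) w) (cost s′ (just b)))

turns-∷-≤ : ∀ s x w → turns s (x ∷ w) ≤ 1 + turns (update s x) w
turns-∷-≤ s x w = ℕₚ.+-monoˡ-≤ _ (cost≤1 s x)

turns-∷-≥ : ∀ s x w → turns (update s x) w ≤ turns s (x ∷ w)
turns-∷-≥ s x w = ℕₚ.m≤n+m _ (cost s x)

turns-∷∷ : ∀ s s′ x y w → turns s (x ∷ y ∷ w) ≤ 3 + turns s′ w
turns-∷∷ s s′ x y w = ℕₚ.≤-trans (turns-∷-≤ s x (y ∷ w))
  (s≤s (ℕₚ.≤-trans (turns-∷-≤ (update s x) y w) (s≤s (turns-state _ s′ w))))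

Near : ℕ → ℕ → Set
Near a b = a ≤ 3 + b × b ≤ 3 + a

Between : ℕ → ℕ → ℕ → Set
Between v u c = (u ≤ v × v ≤ c) ⊎ (c ≤ v × v ≤ u)

module _ (col : ℕ → Maybe Bool) {ℓ} {Sep : ℕ → ℕ → ℕ → Set ℓ} {u v c : ℕ} where

  private
    tw : Maybe Bool → List ℕ → ℕ
    tw s w = turns s (map col w)

  -- The 3 arises as one possible change at each of the two entries and one more from the state in
  -- which they leave the rest of the word.
  turns-near : ∀ s {w w′} → Swapped Sep u v c w w′ → Near (tw s w) (tw s w′)
  turns-near s {w} same = ℕₚ.m≤n+m _ 3 , ℕₚ.m≤n+m _ 3
  turns-near s (keep {x} {w} {w′} p) = shift (turns-near (update s (col x)) p) , shift (Data.Product.swap (turns-near (update s (col x)) p))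
    where
    k = cost s (col x)
    shift : ∀ {a b} → Near a b → k + a ≤ 3 + (k + b)
    shift {a} {b} (p , _) = ℕₚ.≤-trans (ℕₚ.+-monoʳ-≤ k p) (ℕₚ.≤-reflexive (trans (≡-sym (ℕₚ.+-assoc k 3 b))
      (trans (cong (_+ b) (ℕₚ.+-comm k 3)) (ℕₚ.+-assoc 3 k b))))
  turns-near s (swap {w}) = swapped u v , swapped v u
    where
    swapped : ∀ x y → tw s (x ∷ y ∷ w) ≤ 3 + tw s (y ∷ x ∷ w)
    swapped x y = ℕₚ.≤-trans (turns-∷∷ s (update (update s (col y)) (col x)) (col x) (col y) (map col w))
      (ℕₚ.+-monoʳ-≤ 3 (ℕₚ.≤-trans (turns-∷-≥ (update s (col y)) (col x) (map col w)) (turns-∷-≥ s (col y) (col x ∷ map col w))))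
  turns-near s (drop {w} _) =
    ℕₚ.≤-trans (turns-∷∷ s (update s (col v)) (col u) (col v) (map col w)) (ℕₚ.+-monoʳ-≤ 3 (turns-∷-≥ s (col v) (map col w))) ,
    ℕₚ.≤-trans (turns-state s (update s (col u)) (col v ∷ map col w))
      (ℕₚ.≤-trans (s≤s (turns-∷-≥ s (col u) (col v ∷ map col w))) (ℕₚ.+-monoˡ-≤ (tw s (u ∷ v ∷ w)) {1} {3} (s≤s z≤n)))
  turns-near s (add {w} _) =
    ℕₚ.≤-trans (turns-state s (update s (col v)) (col u ∷ map col w))
      (ℕₚ.≤-trans (s≤s (turns-∷-≥ s (col v) (col u ∷ map col w))) (ℕₚ.+-monoˡ-≤ (tw s (v ∷ u ∷ w)) {1} {3} (s≤s z≤n))) ,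
    ℕₚ.≤-trans (turns-∷∷ s (update s (col u)) (col v) (col u) (map col w)) (ℕₚ.+-monoʳ-≤ 3 (turns-∷-≥ s (col u) (map col w)))

  -- Swapping u and v is invisible if they never get different colours. The separation hypotheses
  -- ensure that a vertex dropped or added is either uncoloured or stands right before one of its
  -- own colour.
  turns-same : (∀ {a b} → col u ≡ just a → col v ≡ just b → a ≡ b) →
    (Sep v u c → col v ≡ nothing → col u ≡ nothing) → (Sep u v c → col u ≡ nothing → col v ≡ nothing) →
    ∀ s {w w′} → Swapped Sep u v c w w′ → tw s w ≡ tw s w′
  turns-same mono sepv sepu s same = refl
  turns-same mono sepv sepu s (keep {x} p) = cong (cost s (col x) +_) (turns-same mono sepv sepu (update s (col x)) p)
  turns-same mono sepv sepu s (swap {w}) with col u | col v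
  ... | nothing | nothing = refl
  ... | nothing | just b rewrite cost-nothing s | cost-nothing (just b) = refl
  ... | just a | nothing rewrite cost-nothing s | cost-nothing (just a) = refl
  ... | just a | just b with mono refl refl
  ... | refl = refl
  turns-same mono sepv sepu s (drop {w} sep) with col u | col v | sepv sep
  ... | nothing | _ | _ rewrite cost-nothing s = refl
  ... | just a | nothing | h = contradiction (h refl) λ ()
  ... | just a | just b | _ with mono refl refl
  ... | refl rewrite cost-refl a = refl
  turns-same mono sepv sepu s (add {w} sep) with col u | col v | sepu sep
  ... | _ | nothing | _ rewrite cost-nothing s = refl
  ... | nothing | just b | h = contradiction (h refl) λ ()
  ... | just a | just b | _ with mono refl refl
  ... | refl rewrite cost-refl a = refl

-- Dyadic intervals and the effect of one rotation

data Coloured (lo h x : ℕ) : Maybe Bool → Set where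
  left  : lo ≤ x → x < lo + h → Coloured lo h x (just false)
  right : lo + h ≤ x → x < lo + h + h → Coloured lo h x (just true)
  out   : ¬ (lo ≤ x × x < lo + h + h) → Coloured lo h x nothing

colouring : ∀ lo h x → ∃ (Coloured lo h x)
colouring lo h x with x <? lo | x <? lo + h | x <? lo + h + h
... | yes x<lo | _ | _ = nothing , out (λ (lo≤x , _) → ℕₚ.<⇒≱ x<lo lo≤x)
... | no x≮lo | yes x<m | _ = just false , left (ℕₚ.≮⇒≥ x≮lo) x<m
... | no x≮lo | no x≮m | yes x<hi = just true , right (ℕₚ.≮⇒≥ x≮m) x<hi
... | no x≮lo | no x≮m | no x≮hi = nothing , out (λ (_ , x<hi) → x≮hi x<hi)

colour : ℕ → ℕ → ℕ → Maybe Bool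
colour lo h x = proj₁ (colouring lo h x)

coloured : ∀ lo h x → Coloured lo h x (colour lo h x)
coloured lo h x = proj₂ (colouring lo h x)

coloured-in : ∀ {lo h x a} → Coloured lo h x (just a) → lo ≤ x × x < lo + h + h
coloured-in {lo} {h} (left p q)  = p , ℕₚ.<-≤-trans q (ℕₚ.m≤m+n (lo + h) h)
coloured-in {lo} {h} (right p q) = ℕₚ.≤-trans (ℕₚ.m≤m+n lo h) p , q

-- W c stands for the root path of c. Each dyadic interval of length at least two inside [lo, lo +
-- 2^j) contributes the colour changes on the path of its own midpoint.
Φ : ℕ → ℕ → (ℕ → List ℕ) → ℕ
Φ zero    lo W = 0
Φ (suc j) lo W = turns nothing (map (colour lo (2 ^ j)) (W (lo + 2 ^ j))) + (Φ j lo W + Φ j (lo + 2 ^ j) W)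

In : ℕ → ℕ → ℕ → Set
In lo j x = lo ≤ x × x < lo + 2 ^ j

end≡ : ∀ lo j → lo + 2 ^ suc j ≡ lo + 2 ^ j + 2 ^ j
end≡ lo j = trans (cong (λ z → lo + (2 ^ j + z)) (ℕₚ.+-identityʳ (2 ^ j))) (≡-sym (ℕₚ.+-assoc lo (2 ^ j) (2 ^ j)))

In-suc : ∀ {lo} j {x} → lo ≤ x × x < lo + 2 ^ j + 2 ^ j → In lo (suc j) x
In-suc {lo} j {x} (p , q) = p , subst (x <_) (≡-sym (end≡ lo j)) q

In-left : ∀ {lo} j {x} → In lo j x → In lo (suc j) x
In-left {lo} j (p , q) = In-suc j (p , ℕₚ.<-≤-trans q (ℕₚ.m≤m+n (lo + 2 ^ j) (2 ^ j)))

In-right : ∀ {lo} j {x} → In (lo + 2 ^ j) j x → In lo (suc j) x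
In-right {lo} j (p , q) = In-suc j (ℕₚ.≤-trans (ℕₚ.m≤m+n lo (2 ^ j)) p , q)

coloured-left : ∀ {lo h x a} → x < lo + h → Coloured lo h x (just a) → a ≡ false
coloured-left x<m (left _ _)    = refl
coloured-left x<m (right m≤x _) = contradiction m≤x (ℕₚ.<⇒≱ x<m)

coloured-right : ∀ {lo h x a} → lo + h ≤ x → Coloured lo h x (just a) → a ≡ true
coloured-right m≤x (left _ x<m) = contradiction m≤x (ℕₚ.<⇒≱ x<m)
coloured-right m≤x (right _ _)  = refl

module _ {u v : ℕ} {W W′ : ℕ → List ℕ} (H : ∀ c → Swapped Between u v c (W c) (W′ c)) where

  level-same : ∀ lo j →
    (∀ {a b} → colour lo (2 ^ j) u ≡ just a → colour lo (2 ^ j) v ≡ just b → a ≡ b) →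
    turns nothing (map (colour lo (2 ^ j)) (W (lo + 2 ^ j))) ≡ turns nothing (map (colour lo (2 ^ j)) (W′ (lo + 2 ^ j)))
  level-same lo j mono = turns-same (colour lo h) {Sep = Between} {u} {v} {m} mono (convex {v} {u}) (convex {u} {v}) nothing (H m)
    where
    h = 2 ^ j
    m = lo + h
    inner : lo ≤ m × m < m + h
    inner = ℕₚ.m≤m+n lo h , subst (_< m + h) (ℕₚ.+-identityʳ m) (ℕₚ.+-monoʳ-< m (ℕₚ.m^n>0 2 j))
    -- The midpoint m belongs to the interval; if y does too, then so does any x between y and m.
    convex : ∀ {x y} → Between x y m → colour lo h x ≡ nothing → colour lo h y ≡ nothing
    convex {x} {y} b eq with colour lo h x | coloured lo h x | colour lo h y | coloured lo h y
    ... | nothing | out x∉ | nothing | _ = refl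
    ... | nothing | out x∉ | just a | cy with coloured-in cy | b
    ... | y≥ , y< | inj₁ (y≤x , x≤m) = contradiction (ℕₚ.≤-trans y≥ y≤x , ℕₚ.≤-<-trans x≤m (proj₂ inner)) x∉
    ... | y≥ , y< | inj₂ (m≤x , x≤y) = contradiction (ℕₚ.≤-trans (proj₁ inner) m≤x , ℕₚ.≤-<-trans x≤y y<) x∉

  -- No dyadic subinterval contains both u and v either, so at no level can they receive two
  -- different colours.
  Φ-same : ∀ j lo → ¬ (In lo j u × In lo j v) → Φ j lo W ≡ Φ j lo W′
  Φ-same zero lo _ = refl
  Φ-same (suc j) lo ni = cong₂ _+_ (level-same lo j mono)
    (cong₂ _+_ (Φ-same j lo (λ (p , q) → ni (In-left j p , In-left j q)))
               (Φ-same j (lo + 2 ^ j) (λ (p , q) → ni (In-right j p , In-right j q))))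
    where
    mono : ∀ {a b} → colour lo (2 ^ j) u ≡ just a → colour lo (2 ^ j) v ≡ just b → a ≡ b
    mono eq eq′ with colour lo (2 ^ j) u | coloured lo (2 ^ j) u | colour lo (2 ^ j) v | coloured lo (2 ^ j) v
    mono refl refl | just a | cu | just b | cv =
      contradiction (In-suc j (coloured-in cu) , In-suc j (coloured-in cv)) ni

  private
    near-left : ∀ {a a′ b b′ c c′} → a ≡ a′ → Near b b′ → c ≡ c′ → Near (a + (b + c)) (a′ + (b′ + c′))
    near-left {a} {_} {b} {b′} {c} refl (p , q) refl = go p , go q
      where
      go : ∀ {b b′} → b ≤ 3 + b′ → a + (b + c) ≤ 3 + (a + (b′ + c))
      go {b} {b′} p = ℕₚ.≤-trans (ℕₚ.+-monoʳ-≤ a (ℕₚ.+-monoˡ-≤ c p)) (ℕₚ.≤-reflexive (solve 3 (λ a b c → a :+ ((con 3 :+ b) :+ c) := con 3 :+ (a :+ (b :+ c))) refl a b′ c))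
    near-top : ∀ {a a′ b b′ c c′} → Near a a′ → b ≡ b′ → c ≡ c′ → Near (a + (b + c)) (a′ + (b′ + c′))
    near-top {b = b} {c = c} (p , q) refl refl = ℕₚ.+-monoˡ-≤ (b + c) p , ℕₚ.+-monoˡ-≤ (b + c) q
    near-right : ∀ {a a′ b b′ c c′} → a ≡ a′ → b ≡ b′ → Near c c′ → Near (a + (b + c)) (a′ + (b′ + c′))
    near-right {a} {_} {b} {_} {c} {c′} refl refl n = subst₂ Near (cong (a +_) (ℕₚ.+-comm c b)) (cong (a +_) (ℕₚ.+-comm c′ b))
      (near-left {a} {a} {c} {c′} {b} refl n refl)

  -- Larger intervals see u and v in the same half and go on with that half. At the interval that
  -- splits them the count may move, and below it no interval contains both.
  Φ-near : ∀ j lo → Near (Φ j lo W) (Φ j lo W′)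
  Φ-near zero lo = z≤n , z≤n
  Φ-near (suc j) lo = go (coloured lo h u) (coloured lo h v)
    where
    h = 2 ^ j
    m = lo + h
    is : ∀ {x a} → colour lo h x ≡ just a → Coloured lo h x (just a)
    is {x} eq = subst (Coloured lo h x) eq (coloured lo h x)
    equal : ¬ (In lo (suc j) u × In lo (suc j) v) → Near (Φ (suc j) lo W) (Φ (suc j) lo W′)
    equal ni = subst (Near (Φ (suc j) lo W)) (Φ-same (suc j) lo ni) (ℕₚ.m≤n+m _ 3 , ℕₚ.m≤n+m _ 3)
    go : ∀ {a b} → Coloured lo h u a → Coloured lo h v b → Near (Φ (suc j) lo W) (Φ (suc j) lo W′)
    go (left _ u<m) (right m≤v _) = near-top (turns-near (colour lo h) nothing (H m))
      (Φ-same j lo (λ (_ , (_ , v<m)) → ℕₚ.<⇒≱ v<m m≤v)) (Φ-same j m (λ ((m≤u , _) , _) → ℕₚ.<⇒≱ u<m m≤u))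
    go (right m≤u _) (left _ v<m) = near-top (turns-near (colour lo h) nothing (H m))
      (Φ-same j lo (λ ((_ , u<m) , _) → ℕₚ.<⇒≱ u<m m≤u)) (Φ-same j m (λ (_ , (m≤v , _)) → ℕₚ.<⇒≱ v<m m≤v))
    go (left _ u<m) (left _ v<m) = near-left
      (level-same lo j λ eq eq′ → trans (coloured-left u<m (is eq)) (≡-sym (coloured-left v<m (is eq′))))
      (Φ-near j lo) (Φ-same j m (λ ((m≤u , _) , _) → ℕₚ.<⇒≱ u<m m≤u))
    go (right m≤u _) (right m≤v _) = near-right
      (level-same lo j λ eq eq′ → trans (coloured-right m≤u (is eq)) (≡-sym (coloured-right m≤v (is eq′))))
      (Φ-same j lo (λ ((_ , u<m) , _) → ℕₚ.<⇒≱ u<m m≤u)) (Φ-near j m)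
    go (out u∉) _ = equal (λ ((p , q) , _) → u∉ (p , subst (u <_) (end≡ lo j) q))
    go _ (out v∉) = equal (λ (_ , (p , q)) → v∉ (p , subst (v <_) (end≡ lo j) q))

-- Large potential for bit-reversal order, zero for descending order

interleave : List ℕ → List ℕ → List ℕ
interleave []       ys = ys
interleave (x ∷ xs) ys = x ∷ interleave ys xs

-- The odd numbers of [lo, lo + 2^(j+1)), for even lo, in bit-reversal order: halving the interval
-- repeatedly, the two halves always alternate.
bitReversed : ℕ → ℕ → List ℕ
bitReversed zero    lo = suc lo ∷ []
bitReversed (suc j) lo = interleave (bitReversed j lo) (bitReversed j (lo + 2 ^ suc j))

All-interleave : ∀ {p} {P : ℕ → Set p} {xs ys} → All P xs → All P ys → All P (interleave xs ys)
All-interleave []         qs = qs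
All-interleave (px ∷ pxs) qs = px ∷ All-interleave qs pxs

length-interleave : ∀ xs ys → length (interleave xs ys) ≡ length xs + length ys
length-interleave []       ys = refl
length-interleave (x ∷ xs) ys = cong suc (trans (length-interleave ys xs) (ℕₚ.+-comm (length ys) (length xs)))

double : ∀ m → 2 * m ≡ m + m
double m = cong (m +_) (ℕₚ.+-identityʳ m)

length-bitReversed : ∀ j lo → length (bitReversed j lo) ≡ 2 ^ j
length-bitReversed zero    lo = refl
length-bitReversed (suc j) lo = trans (length-interleave (bitReversed j lo) _)
  (trans (cong₂ _+_ (length-bitReversed j lo) (length-bitReversed j _)) (≡-sym (double (2 ^ j))))

bitReversed-In : ∀ j lo → All (In lo (suc j)) (bitReversed j lo)
bitReversed-In zero    lo = (ℕₚ.n≤1+n lo , ℕₚ.≤-reflexive (ℕₚ.+-comm 2 lo)) ∷ []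
bitReversed-In (suc j) lo = All-interleave (All.map (In-left (suc j)) (bitReversed-In j lo))
  (All.map (In-right (suc j)) (bitReversed-In j _))

In? : ∀ lo j → Decidable (In lo j)
In? lo j x = (lo ≤? x) ×-dec (x <? lo + 2 ^ j)

-- Both statements are proved together because `interleave` exchanges its arguments at each step.
filter-interleave : ∀ {p} {P : ℕ → Set p} (P? : Decidable P) xs ys →
  (All P xs → All (¬_ ∘ P) ys → filter P? (interleave xs ys) ≡ xs) ×
  (All P ys → All (¬_ ∘ P) xs → filter P? (interleave xs ys) ≡ ys)
filter-interleave P? [] ys = (λ _ → Listₚ.filter-none P?) , (λ p _ → Listₚ.filter-all P? p)
filter-interleave P? (x ∷ xs) ys =
  (λ { (px ∷ pxs) q → trans (Listₚ.filter-accept P? px) (cong (x ∷_) (proj₂ (filter-interleave P? ys xs) pxs q)) }) ,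
  (λ { p (q ∷ qs) → trans (Listₚ.filter-reject P? q) (proj₁ (filter-interleave P? ys xs) p qs) })

filter-filter : ∀ {p q} {P : ℕ → Set p} {Q : ℕ → Set q} (P? : Decidable P) (Q? : Decidable Q) → (∀ {x} → P x → Q x) →
  ∀ xs → filter P? (filter Q? xs) ≡ filter P? xs
filter-filter P? Q? h [] = refl
filter-filter P? Q? h (x ∷ xs) with Q? x
... | no ¬q = trans (filter-filter P? Q? h xs) (≡-sym (Listₚ.filter-reject P? (λ p → ¬q (h p))))
... | yes q with P? x
... | yes p = cong (x ∷_) (filter-filter P? Q? h xs)
... | no ¬p = filter-filter P? Q? h xs

-- Self-similarity: restricted to a half, the order is the bit-reversal order of that half. Hence
-- one list alternates for all dyadic intervals simultaneously.
filter-left : ∀ j lo → filter (In? lo (suc j)) (bitReversed (suc j) lo) ≡ bitReversed j lo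
filter-left j lo = proj₁ (filter-interleave (In? lo (suc j)) (bitReversed j lo) (bitReversed j (lo + 2 ^ suc j)))
  (bitReversed-In j lo) (All.map (λ (m≤x , _) (_ , x<m) → ℕₚ.<⇒≱ x<m m≤x) (bitReversed-In j (lo + 2 ^ suc j)))

filter-right : ∀ j lo → filter (In? (lo + 2 ^ suc j) (suc j)) (bitReversed (suc j) lo) ≡ bitReversed j (lo + 2 ^ suc j)
filter-right j lo = proj₂ (filter-interleave (In? (lo + 2 ^ suc j) (suc j)) (bitReversed j lo) (bitReversed j (lo + 2 ^ suc j)))
  (bitReversed-In j (lo + 2 ^ suc j)) (All.map (λ (_ , x<m) (m≤x , _) → ℕₚ.<⇒≱ x<m m≤x) (bitReversed-In j lo))

turns-filter : ∀ {p} {P : ℕ → Set p} (P? : Decidable P) (col : ℕ → Maybe Bool) → (∀ {x} → ¬ P x → col x ≡ nothing) →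
  ∀ s xs → turns s (map col (filter P? xs)) ≡ turns s (map col xs)
turns-filter P? col h s [] = refl
turns-filter P? col h s (x ∷ xs) with P? x
... | yes _ = cong (cost s (col x) +_) (turns-filter P? col h _ xs)
... | no ¬p rewrite h ¬p | cost-nothing s = turns-filter P? col h s xs

turns-++ : ∀ s (xs ys : List (Maybe Bool)) → turns s xs ≤ turns s (xs ++ ys)
turns-++ s []       ys = z≤n
turns-++ s (x ∷ xs) ys = ℕₚ.+-monoʳ-≤ (cost s x) (turns-++ (update s x) xs ys)

-- Starting in state `just true` makes the first left entry count as a change, so the count is
-- exact; `turns-bitReversed` pays the one change back.
turns-interleave : (col : ℕ → Maybe Bool) → ∀ {xs ys} → All (λ x → col x ≡ just false) xs → All (λ x → col x ≡ just true) ys →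
  length xs ≡ length ys → turns (just true) (map col (interleave xs ys)) ≡ length xs + length ys
turns-interleave col [] [] eq = refl
turns-interleave col {x ∷ xs} {y ∷ ys} (p ∷ ps) (q ∷ qs) eq rewrite p | q =
  cong suc (trans (cong suc (turns-interleave col ps qs (ℕₚ.suc-injective eq))) (≡-sym (ℕₚ.+-suc (length xs) (length ys))))

colour-left : ∀ {lo h x} → lo ≤ x → x < lo + h → colour lo h x ≡ just false
colour-left {lo} {h} {x} p q with colour lo h x | coloured lo h x
... | _ | left _ _    = refl
... | _ | right m≤x _ = contradiction m≤x (ℕₚ.<⇒≱ q)
... | _ | out x∉      = contradiction (p , ℕₚ.<-≤-trans q (ℕₚ.m≤m+n (lo + h) h)) x∉

colour-right : ∀ {lo h x} → lo + h ≤ x → x < lo + h + h → colour lo h x ≡ just true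
colour-right {lo} {h} {x} p q with colour lo h x | coloured lo h x
... | _ | left _ x<m = contradiction p (ℕₚ.<⇒≱ x<m)
... | _ | right _ _  = refl
... | _ | out x∉     = contradiction (ℕₚ.≤-trans (ℕₚ.m≤m+n lo h) p , q) x∉

colour-out : ∀ {lo} j {x} → ¬ In lo (suc j) x → colour lo (2 ^ j) x ≡ nothing
colour-out {lo} j {x} x∉ with colour lo (2 ^ j) x | coloured lo (2 ^ j) x
... | nothing | _ = refl
... | just _  | c = contradiction (In-suc j (coloured-in c)) x∉

turns-bitReversed : ∀ j lo → 2 ^ j + 2 ^ j ≤ 1 + turns nothing (map (colour lo (2 ^ suc j)) (bitReversed (suc j) lo))
turns-bitReversed j lo = subst (_≤ 1 + turns nothing (map (colour lo (2 ^ suc j)) (bitReversed (suc j) lo))) (trans (turns-interleave (colour lo (2 ^ suc j)) ls rs (trans (length-bitReversed j lo) (≡-sym (length-bitReversed j _))))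
    (cong₂ _+_ (length-bitReversed j lo) (length-bitReversed j _)))
  (turns-state (just true) nothing (map (colour lo (2 ^ suc j)) (bitReversed (suc j) lo)))
  where
  ls : All (λ x → colour lo (2 ^ suc j) x ≡ just false) (bitReversed j lo)
  ls = All.map (λ (p , q) → colour-left {lo} {2 ^ suc j} p q) (bitReversed-In j lo)
  rs : All (λ x → colour lo (2 ^ suc j) x ≡ just true) (bitReversed j (lo + 2 ^ suc j))
  rs = All.map (λ (p , q) → colour-right {lo} {2 ^ suc j} p q) (bitReversed-In j (lo + 2 ^ suc j))

module _ {M : ℕ} {σ : List ℕ} {W : ℕ → List ℕ} (HW : ∀ k → 2 * k < M → ∃[ w ] W (2 * k) ≡ σ ++ w) where

  -- The bound a(j) = (j - 1) 2^j + 1 solves a(0) = 0 and a(j + 1) = 2 a(j) + 2^(j + 1) - 1, the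
  -- last two terms being the changes in the top interval; 2^j is moved to the right to avoid
  -- subtraction. Intervals of length at least 4 have even midpoints here, where `HW` applies, and
  -- those of length 2 are estimated by zero.
  Φ-bitReversed : ∀ j k → 2 * k + 2 ^ suc j ≤ M → filter (In? (2 * k) (suc j)) σ ≡ bitReversed j (2 * k) →
    1 + j * 2 ^ j ≤ Φ (suc j) (2 * k) W + 2 ^ j
  Φ-bitReversed zero k _ _ = ℕₚ.m≤n+m 1 (Φ 1 (2 * k) W)
  Φ-bitReversed (suc j) k ≤M eq = ℕₚ.≤-pred (ℕₚ.≤-trans (ℕₚ.≤-reflexive lhs)
      (ℕₚ.≤-trans (ℕₚ.+-mono-≤ top (ℕₚ.+-mono-≤ ihˡ ihʳ)) (ℕₚ.≤-reflexive rhs)))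
    where
    ℓ = 2 * k
    m≡ : ℓ + 2 ^ suc j ≡ 2 * (k + 2 ^ j)
    m≡ = ≡-sym (ℕₚ.*-distribˡ-+ 2 k (2 ^ j))
    m+≡ : ℓ + 2 ^ suc (suc j) ≡ ℓ + 2 ^ suc j + 2 ^ suc j
    m+≡ = end≡ ℓ (suc j)
    m<M : 2 * (k + 2 ^ j) < M
    m<M = ℕₚ.<-≤-trans (subst₂ _<_ (trans (ℕₚ.+-identityʳ _) m≡) (≡-sym m+≡) (ℕₚ.+-monoʳ-< (ℓ + 2 ^ suc j) (ℕₚ.m^n>0 2 (suc j)))) ≤M
    T = turns nothing (map (colour ℓ (2 ^ suc j)) (W (ℓ + 2 ^ suc j)))
    A = Φ (suc j) ℓ W
    B = Φ (suc j) (ℓ + 2 ^ suc j) W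
    top : 2 ^ j + 2 ^ j ≤ 1 + T
    top = ℕₚ.≤-trans (turns-bitReversed j ℓ) (s≤s (ℕₚ.≤-trans
      (ℕₚ.≤-reflexive (trans (cong (turns nothing ∘ map (colour ℓ (2 ^ suc j))) (≡-sym eq))
         (turns-filter (In? ℓ (suc (suc j))) (colour ℓ (2 ^ suc j)) (colour-out (suc j)) nothing σ)))
      (subst (λ w → turns nothing (map (colour ℓ (2 ^ suc j)) σ) ≤ turns nothing (map (colour ℓ (2 ^ suc j)) w))
         (≡-sym (trans (cong W m≡) (proj₂ (HW (k + 2 ^ j) m<M))))
         (subst (λ w → turns nothing (map (colour ℓ (2 ^ suc j)) σ) ≤ turns nothing w) (≡-sym (Listₚ.map-++ _ σ _))
           (turns-++ nothing (map (colour ℓ (2 ^ suc j)) σ) _)))))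
    ihˡ : 1 + j * 2 ^ j ≤ A + 2 ^ j
    ihˡ = Φ-bitReversed j k (ℕₚ.≤-trans (subst (ℓ + 2 ^ suc j ≤_) (≡-sym m+≡) (ℕₚ.m≤m+n _ _)) ≤M)
      (trans (≡-sym (filter-filter (In? ℓ (suc j)) (In? ℓ (suc (suc j))) (In-left (suc j)) σ))
        (trans (cong (filter (In? ℓ (suc j))) eq) (filter-left j ℓ)))
    ihʳ : 1 + j * 2 ^ j ≤ B + 2 ^ j
    ihʳ = subst (λ z → 1 + j * 2 ^ j ≤ Φ (suc j) z W + 2 ^ j) (≡-sym m≡)
      (Φ-bitReversed j (k + 2 ^ j) (subst (λ z → z + 2 ^ suc j ≤ M) m≡ (subst (_≤ M) m+≡ ≤M))
        (subst (λ z → filter (In? z (suc j)) σ ≡ bitReversed j z) m≡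
          (trans (≡-sym (filter-filter (In? (ℓ + 2 ^ suc j) (suc j)) (In? ℓ (suc (suc j))) (In-right (suc j)) σ))
            (trans (cong (filter (In? (ℓ + 2 ^ suc j) (suc j))) eq) (filter-right j ℓ)))))
    lhs : suc (1 + suc j * 2 ^ suc j) ≡ 2 ^ j + 2 ^ j + (1 + j * 2 ^ j + (1 + j * 2 ^ j))
    lhs = solve 2 (λ j p → con 1 :+ (con 1 :+ (con 1 :+ j) :* (con 2 :* p)) :=
      p :+ p :+ (con 1 :+ j :* p :+ (con 1 :+ j :* p))) refl j (2 ^ j)
    rhs : 1 + T + (A + 2 ^ j + (B + 2 ^ j)) ≡ suc (T + (A + B) + 2 ^ suc j)
    rhs = solve 4 (λ t a b p → con 1 :+ t :+ (a :+ p :+ (b :+ p)) := con 1 :+ (t :+ (a :+ b) :+ con 2 :* p)) refl T A B (2 ^ j)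

-- The root path of a midpoint meets no vertex below it, so all its coloured entries are in the
-- right half and the state never becomes `just false`.
Φ-descending : ∀ W M → (∀ c → c < M → All (c ≤_) (W c)) → ∀ j lo → lo + 2 ^ j ≤ M → Φ j lo W ≡ 0
Φ-descending W M H zero lo _ = refl
Φ-descending W M H (suc j) lo ≤M = cong₂ _+_ (flat nothing (λ ()) (H (lo + 2 ^ j) m<M))
  (cong₂ _+_ (Φ-descending W M H j lo (ℕₚ.<⇒≤ m<M)) (Φ-descending W M H j (lo + 2 ^ j) (subst (_≤ M) (end≡ lo j) ≤M)))
  where
  m<M : lo + 2 ^ j < M
  m<M = ℕₚ.<-≤-trans (subst₂ _<_ (ℕₚ.+-identityʳ _) (≡-sym (end≡ lo j)) (ℕₚ.+-monoʳ-< (lo + 2 ^ j) (ℕₚ.m^n>0 2 j))) ≤M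
  flat : ∀ s → s ≢ just false → ∀ {w} → All (lo + 2 ^ j ≤_) w → turns s (map (colour lo (2 ^ j)) w) ≡ 0
  flat s _ [] = refl
  flat s s≢ {x ∷ w} (m≤x ∷ ps) with colour lo (2 ^ j) x | coloured lo (2 ^ j) x
  ... | nothing | _ rewrite cost-nothing s = flat s s≢ ps
  ... | _ | left _ x<m = contradiction m≤x (ℕₚ.<⇒≱ x<m)
  ... | _ | right _ _ with s
  ... | nothing = flat (just true) (λ ()) ps
  ... | just true = flat (just true) (λ ()) ps
  ... | just false = contradiction refl s≢

-- The strip

-- The root path of c in a search tree that is itself a path with the listed vertices from the root
-- downwards.
until : ∀ {n} → Fin n → List (Fin n) → List (Fin n)
until c [] = []
until c (x ∷ xs) with x Fin.≟ c
... | yes _ = x ∷ []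
... | no _  = x ∷ until c xs

until-head : ∀ {n} {x c : Fin n} xs → x ≡ c → until c (x ∷ xs) ≡ x ∷ []
until-head {x = x} {c} xs eq with x Fin.≟ c
... | yes _ = refl
... | no ne = contradiction eq ne

until-tail : ∀ {n} {x c : Fin n} xs → x ≢ c → until c (x ∷ xs) ≡ x ∷ until c xs
until-tail {x = x} {c} xs ne with x Fin.≟ c
... | yes eq = contradiction eq ne
... | no _ = refl

-- Vertices that can be removed one after the other while keeping the remaining graph connected.
data Elimination {A : Set} (R : A → A → Set) : List A → Set where
  [_] : ∀ x → Elimination R (x ∷ [])
  _∷_ : ∀ {x xs} → Any (R x) xs → Elimination R xs → Elimination R (x ∷ xs)

module Chains {n : ℕ} (G : Graph n) where
  open Search G
  open Paths G

  Removable : List (Fin n) → Set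
  Removable = Elimination (λ x y → adj G x y ≡ true)

  vertices : List (Fin n) → Subset n
  vertices []       = ∅
  vertices (x ∷ xs) = ⁅ x ⁆ ∪ vertices xs

  ∈-vertices⁺ : ∀ {x} xs → x ∈ᴸ xs → x ∈ vertices xs
  ∈-vertices⁺ (_ ∷ _) (here refl) = x∈p∪q⁺ (inj₁ (x∈⁅x⁆ _))
  ∈-vertices⁺ (_ ∷ xs) (there p) = x∈p∪q⁺ (inj₂ (∈-vertices⁺ xs p))

  ∈-vertices⁻ : ∀ {x} xs → x ∈ vertices xs → x ∈ᴸ xs
  ∈-vertices⁻ [] p = contradiction p ∉⊥
  ∈-vertices⁻ (y ∷ xs) p with x∈p∪q⁻ ⁅ y ⁆ (vertices xs) p
  ... | inj₁ q = here (x∈⁅y⁆⇒x≡y y q)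
  ... | inj₂ q = there (∈-vertices⁻ xs q)

  tail-⊆ : ∀ x xs → vertices xs ⊆ vertices (x ∷ xs)
  tail-⊆ x xs = q⊆p∪q ⁅ x ⁆ (vertices xs)

  elimination-connected : ∀ {xs} → Removable xs → ConnectedOn G (vertices xs)
  elimination-connected [ x ] y z y∈ z∈ with ∈-vertices⁻ (x ∷ []) y∈ | ∈-vertices⁻ (x ∷ []) z∈
  ... | here refl | here refl = here y∈
  elimination-connected (_∷_ {x} {xs} a e) y z y∈ z∈ = joinW (∈-vertices⁻ (x ∷ xs) y∈) (∈-vertices⁻ (x ∷ xs) z∈)
    where
    rest : ∀ {y z} → y ∈ᴸ xs → z ∈ᴸ xs → WalkIn G (vertices (x ∷ xs)) y z
    rest p q = walk-mono (tail-⊆ x xs) (elimination-connected e _ _ (∈-vertices⁺ xs p) (∈-vertices⁺ xs q))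
    fromHead : ∀ {z} → z ∈ᴸ xs → WalkIn G (vertices (x ∷ xs)) x z
    fromHead q = let (_ , w∈ , xw) = find a in step (∈-vertices⁺ (x ∷ xs) (here refl)) xw (rest w∈ q)
    joinW : ∀ {y z} → y ∈ᴸ x ∷ xs → z ∈ᴸ x ∷ xs → WalkIn G (vertices (x ∷ xs)) y z
    joinW (here refl) (here refl) = here (∈-vertices⁺ (x ∷ xs) (here refl))
    joinW (here refl) (there q)   = fromHead q
    joinW (there p)   (here refl) = walk-sym (fromHead p)
    joinW (there p)   (there q)   = rest p q

  chain : List (Fin n) → List (Subset n)
  chain []           = []
  chain (x ∷ [])     = vertices (x ∷ []) ∷ []
  -- The trailing `++ []` matches `Forest`, which appends the tubes of the empty rest of a one-tree
  -- family.
  chain (x ∷ y ∷ xs) = vertices (x ∷ y ∷ xs) ∷ (chain (y ∷ xs) ++ [])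

  minus-head : ∀ {x} xs {y} → All (x ≢_) xs → y ∈ vertices (x ∷ xs) minus x ⇔ y ∈ vertices xs
  minus-head {x} xs {y} x∉ = mk⇔ there⁻ (λ p → ∈-minus⁺ (tail-⊆ x xs p) λ { refl → All.lookup x∉ (∈-vertices⁻ xs p) refl })
    where
    there⁻ : y ∈ vertices (x ∷ xs) minus x → y ∈ vertices xs
    there⁻ p with ∈-minus⁻ p
    ... | q , y≢x with ∈-vertices⁻ (x ∷ xs) q
    ... | here y≡x = contradiction y≡x y≢x
    ... | there r  = ∈-vertices⁺ xs r

  -- After each removal the remaining vertices are connected and form the only component, so the
  -- search tree never branches.
  chain-tree : ∀ {xs} → Removable xs → Unique xs → Tree G (vertices xs) (chain xs)
  chain-tree [ x ] (x∉ ∷ _) = node {r = x} (∈-vertices⁺ (x ∷ []) (here refl))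
    ([] , [] , [] , λ y → mk⇔ (λ p → contradiction (to (minus-head [] x∉) p) ∉⊥) λ ()) []
  chain-tree (_∷_ {x} {y ∷ xs} a e) (x∉ ∷ un) = node {r = x} (∈-vertices⁺ (x ∷ y ∷ xs) (here refl))
    ((y , ∈-vertices⁺ (y ∷ xs) (here refl)) ∷ [] , elimination-connected e ∷ [] , [] ∷ [] ,
     λ z → mk⇔ (λ p → here (to (minus-head (y ∷ xs) x∉) p)) λ { (here p) → from (minus-head (y ∷ xs) x∉) p })
    (chain-tree e un ∷ [])

  path-chain : ∀ {xs} (e : Removable xs) (un : Unique xs) {c} → c ∈ᴸ xs →
    path (tree-shape (chain-tree e un)) c ≡ until c xs
  path-chain e@([ x ]) un@(x∉ ∷ _) {c} (here refl) =
    trans (path-root (tree-shape (chain-tree e un)) refl) (≡-sym (until-head [] refl))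
  path-chain e′@(_∷_ {x} {xs@(y ∷ ys)} a e) un′@(x∉ ∷ un) {c} c∈ = cases (x Fin.≟ c) c∈
    where
    t = tree-shape (chain-tree e′ un′)
    cases : Dec (x ≡ c) → c ∈ᴸ x ∷ xs → path t c ≡ until c (x ∷ xs)
    cases (yes x≡c) _ = trans (path-root t x≡c) (≡-sym (until-head xs x≡c))
    cases (no x≢c) (here c≡x) = contradiction (≡-sym c≡x) x≢c
    cases (no x≢c) (there c∈xs) = go (path-child t (∈-vertices⁺ (x ∷ xs) (there c∈xs)) (≢-sym x≢c))
      where
      go : ∃[ ch ] path t c ≡ x ∷ path (Child.sub {t = t} {c} ch) c → path t c ≡ until c (x ∷ xs)
      go (ch , eq) = trans eq (trans (cong (x ∷_) (trans
          (path-cong (Child.sub ch) (tree-shape (chain-tree e un)) D≡ there⁻ there⁺ (child∈ ch (∈-vertices⁺ (x ∷ xs) (there c∈xs)) (≢-sym x≢c)))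
          (path-chain e un c∈xs))) (≡-sym (until-tail xs x≢c)))
        where
        whole : Component (vertices (x ∷ xs) minus x) c (vertices xs)
        whole z = (λ z∈ → walk-mono (λ p → from (minus-head xs x∉) p) (elimination-connected e c z (∈-vertices⁺ xs c∈xs) z∈)) ,
                  (λ w → to (minus-head xs x∉) (walk-end w))
        D≡ : Child.D ch ≡ vertices xs
        D≡ = component-unique (Child.comp ch) whole
        there⁻ : ∀ {X} → X ∈ᴸ Child.U ch → X ∈ᴸ chain xs
        there⁻ {X} X∈ with proj₁ (Child.tubes ch X) X∈
        ... | there q , _ = [ id , (λ ()) ]′ (∈-++⁻ (chain xs) q)
        ... | here refl , X⊆D = ⊥-elim (root∉child ch (X⊆D (∈-vertices⁺ (x ∷ xs) (here refl))))
        there⁺ : ∀ {X} → X ∈ᴸ chain xs → X ∈ᴸ Child.U ch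
        there⁺ {X} X∈ = proj₂ (Child.tubes ch X) (there (∈-++⁺ˡ X∈))
          (subst (X ⊆_) (≡-sym D≡) (proj₁ (tree-tubes (chain-tree e un) X∈)))

data Even : ℕ → Set where
  zero : Even 0
  2+_  : ∀ {m} → Even m → Even (2 + m)

even-or-pred : ∀ m → Even m ⊎ ∃[ k ] (m ≡ suc k × Even k)
even-or-pred zero = inj₁ zero
even-or-pred (suc m) with even-or-pred m
... | inj₁ e = inj₂ (m , refl , e)
... | inj₂ (k , refl , e) = inj₁ (2+ e)

¬even-suc : ∀ {m} → Even m → ¬ Even (suc m)
¬even-suc zero ()
¬even-suc (2+ e) (2+ e′) = ¬even-suc e e′

even-2* : ∀ k → Even (2 * k)
even-2* zero    = zero
even-2* (suc k) = subst Even (≡-sym (ℕₚ.*-suc 2 k)) (2+ even-2* k)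

-- The triangulated strip: consecutive numbers are adjacent, and so are consecutive even numbers.
adjacent : ℕ → ℕ → Bool
adjacent 0 0 = false
adjacent 0 1 = true
adjacent 0 (suc (suc y)) = y ≡ᵇ 0
adjacent 1 0 = true
adjacent 1 1 = false
adjacent 1 (suc (suc y)) = y ≡ᵇ 0
adjacent (suc (suc x)) 0 = x ≡ᵇ 0
adjacent (suc (suc x)) 1 = x ≡ᵇ 0
adjacent (suc (suc x)) (suc (suc y)) = adjacent x y

data Adjacent : ℕ → ℕ → Set where
  next  : ∀ {x} → Adjacent x (1 + x)
  next₂ : ∀ {x} → Even x → Adjacent x (2 + x)

private
  shift₂ : ∀ {x y} → Adjacent x y → Adjacent (2 + x) (2 + y)
  shift₂ next      = next
  shift₂ (next₂ e) = next₂ (2+ e)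

adjacent⇒ : ∀ x y → adjacent x y ≡ true → Adjacent x y ⊎ Adjacent y x
adjacent⇒ 0 1 _ = inj₁ next
adjacent⇒ 0 2 _ = inj₁ (next₂ zero)
adjacent⇒ 1 0 _ = inj₂ next
adjacent⇒ 1 2 _ = inj₁ next
adjacent⇒ 2 0 _ = inj₂ (next₂ zero)
adjacent⇒ 2 1 _ = inj₂ next
adjacent⇒ (suc (suc x)) (suc (suc y)) e = Sum.map shift₂ shift₂ (adjacent⇒ x y e)

adjacent-next : ∀ x → adjacent x (1 + x) ≡ true
adjacent-next 0 = refl
adjacent-next 1 = refl
adjacent-next (suc (suc x)) = adjacent-next x

adjacent-next₂ : ∀ {x} → Even x → adjacent x (2 + x) ≡ true
adjacent-next₂ zero = refl
adjacent-next₂ {suc (suc x)} (2+ e) = adjacent-next₂ e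

adjacent-sym : ∀ x y → adjacent x y ≡ adjacent y x
adjacent-sym 0 0 = refl
adjacent-sym 0 1 = refl
adjacent-sym 0 (suc (suc y)) = refl
adjacent-sym 1 0 = refl
adjacent-sym 1 1 = refl
adjacent-sym 1 (suc (suc y)) = refl
adjacent-sym (suc (suc x)) 0 = refl
adjacent-sym (suc (suc x)) 1 = refl
adjacent-sym (suc (suc x)) (suc (suc y)) = adjacent-sym x y

adjacent-irrefl : ∀ x → adjacent x x ≡ false
adjacent-irrefl 0 = refl
adjacent-irrefl 1 = refl
adjacent-irrefl (suc (suc x)) = adjacent-irrefl x

strip : ∀ n → Graph n
strip n = record
  { adj    = λ u v → adjacent (toℕ u) (toℕ v)
  ; sym    = λ u v → adjacent-sym (toℕ u) (toℕ v)
  ; irrefl = λ v → adjacent-irrefl (toℕ v) }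

module Strip (n : ℕ) where
  G = strip n
  open Search G
  open Paths G

  fin : ∀ {m} → m < n → ∃[ x ] toℕ {n} x ≡ m
  fin m<n = Fin.fromℕ< m<n , Finₚ.toℕ-fromℕ< m<n

  -- The only edges that skip a number join x to x + 2 with x even, and the number skipped is odd;
  -- no walk can jump over an even z.
  walk-meets-even : ∀ {C x y z} → Even z → toℕ x ≤ z → z ≤ toℕ y → WalkIn G C x y → ∃[ w ] (w ∈ C × toℕ w ≡ z)
  walk-meets-even {x = x} e x≤z z≤x (here x∈C) = x , x∈C , ℕₚ.≤-antisym x≤z z≤x
  walk-meets-even {x = x} {z = z} e x≤z z≤y (step {z = x′} x∈C xx′ w) with toℕ x ℕₚ.≟ z | toℕ x′ ≤? z
  ... | yes eq | _ = x , x∈C , eq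
  ... | no _ | yes x′≤z = walk-meets-even e x′≤z z≤y w
  ... | no x≢z | no x′≰z = ⊥-elim (jump (adjacent⇒ _ _ xx′) (ℕₚ.≤∧≢⇒< x≤z x≢z) (ℕₚ.≰⇒> x′≰z))
    where
    jump : ∀ {a b} → Adjacent a b ⊎ Adjacent b a → a < z → z < b → ⊥
    jump (inj₁ next) a<z z<b = ℕₚ.<⇒≱ z<b a<z
    jump {a} (inj₁ (next₂ e′)) a<z z<b = ¬even-suc e′ (subst Even (ℕₚ.≤-antisym (ℕₚ.≤-pred z<b) a<z) e)
    jump {a} {b} (inj₂ next) a<z z<b = ℕₚ.<-asym (ℕₚ.<-trans a<z z<b) (ℕₚ.n<1+n b)
    jump {a} {b} (inj₂ (next₂ _)) a<z z<b = ℕₚ.<-asym (ℕₚ.<-trans a<z z<b) (ℕₚ.<-trans (ℕₚ.n<1+n b) (ℕₚ.n<1+n (suc b)))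

  -- Even vertices suffice as stepping stones: hop by two from an even vertex and by one from an odd
  -- one, until at most a single step is left.
  walk-up : ∀ {C} d {x c} → toℕ x + d ≡ toℕ c → x ∈ C → c ∈ C →
    (∀ w → Even (toℕ w) → toℕ x ≤ toℕ w → toℕ w ≤ toℕ c → w ∈ C) → WalkIn G C x c
  walk-up zero {x} {c} eq x∈ c∈ _ with Finₚ.toℕ-injective (trans (≡-sym (ℕₚ.+-identityʳ (toℕ x))) eq)
  ... | refl = here x∈
  walk-up (suc zero) {x} {c} eq x∈ c∈ _ =
    step x∈ (subst (λ m → adjacent (toℕ x) m ≡ true) (trans (ℕₚ.+-comm 1 (toℕ x)) eq) (adjacent-next (toℕ x))) (here c∈)
  walk-up {C} (suc (suc d)) {x} {c} eq x∈ c∈ H =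
    [ (λ e → hop 2 d eq (adjacent-next₂ e) (2+ e) (walk-up d))
    , (λ (k , x≡ , e) → hop 1 (suc d) eq (adjacent-next (toℕ x)) (subst (Even ∘ suc) (≡-sym x≡) (2+ e)) (walk-up (suc d))) ]′
      (even-or-pred (toℕ x))
    where
    hop : ∀ k d → toℕ x + (k + d) ≡ toℕ c → adjacent (toℕ x) (k + toℕ x) ≡ true → Even (k + toℕ x) →
      (∀ {x c} → toℕ x + d ≡ toℕ c → x ∈ C → c ∈ C →
        (∀ w → Even (toℕ w) → toℕ x ≤ toℕ w → toℕ w ≤ toℕ c → w ∈ C) → WalkIn G C x c) → WalkIn G C x c
    hop k d eq a e rec = step x∈ (subst (λ m → adjacent (toℕ x) m ≡ true) (≡-sym x′≡) a)
      (rec eq′ (H x′ (subst Even (≡-sym x′≡) e) x≤x′ (subst (toℕ x′ ≤_) eq′ (ℕₚ.m≤m+n _ d))) c∈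
          (λ w ev x′≤w → H w ev (ℕₚ.≤-trans x≤x′ x′≤w)))
      where
      eq₂ : k + toℕ x + d ≡ toℕ c
      eq₂ = trans (cong (_+ d) (ℕₚ.+-comm k (toℕ x))) (trans (ℕₚ.+-assoc (toℕ x) k d) eq)
      next∃ = fin {k + toℕ x} (ℕₚ.≤-<-trans (subst (k + toℕ x ≤_) eq₂ (ℕₚ.m≤m+n _ d)) (Finₚ.toℕ<n c))
      x′ = proj₁ next∃
      x′≡ = proj₂ next∃
      eq′ : toℕ x′ + d ≡ toℕ c
      eq′ = trans (cong (_+ d) x′≡) eq₂
      x≤x′ : toℕ x ≤ toℕ x′
      x≤x′ = subst (toℕ x ≤_) (≡-sym x′≡) (ℕₚ.m≤n+m (toℕ x) k)

  between? : ∀ v u c → Dec (Between v u c)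
  between? v u c = ((u ≤? v) ×-dec (v ≤? c)) ⊎-dec ((c ≤? v) ×-dec (v ≤? u))

  between-sym : ∀ {v u c} → Between v u c → Between v c u
  between-sym (inj₁ (p , q)) = inj₂ (p , q)
  between-sym (inj₂ (p , q)) = inj₁ (p , q)

  -- The connected set C contains every even vertex between u and c, and v is none of these, so the
  -- ascending walk through them avoids v.
  walk-avoiding : ∀ {C v u c} → ConnectedOn G C → u ∈ C → c ∈ C → ¬ Between (toℕ v) (toℕ u) (toℕ c) → toℕ u ≤ toℕ c →
    WalkIn G (C minus v) u c
  walk-avoiding {C} {v} {u} {c} conn u∈ c∈ ¬b u≤c = walk-up (toℕ c ∸ toℕ u) (ℕₚ.m+[n∸m]≡n u≤c)
    (∈-minus⁺ u∈ λ { refl → ¬b (inj₁ (ℕₚ.≤-refl , u≤c)) }) (∈-minus⁺ c∈ λ { refl → ¬b (inj₁ (u≤c , ℕₚ.≤-refl)) })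
    λ w e u≤w w≤c → let (w′ , w′∈ , w′≡) = walk-meets-even e u≤w w≤c (conn u c u∈ c∈) in
      ∈-minus⁺ (subst (_∈ C) (Finₚ.toℕ-injective w′≡) w′∈) λ { refl → ¬b (inj₁ (u≤w , w≤c)) }

  separates⇒between : ∀ {v u c} → Separates v u c → Between (toℕ v) (toℕ u) (toℕ c)
  separates⇒between {v} {u} {c} (C , conn , u∈ , c∈ , ¬w) with between? (toℕ v) (toℕ u) (toℕ c)
  ... | yes b = b
  ... | no ¬b with ℕₚ.≤-total (toℕ u) (toℕ c)
  ... | inj₁ u≤c = contradiction (walk-avoiding conn u∈ c∈ ¬b u≤c) ¬w
  ... | inj₂ c≤u = contradiction (walk-sym (walk-avoiding conn c∈ u∈ (¬b ∘ between-sym) c≤u)) ¬w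

  connected : Connected G
  connected x y _ _ with ℕₚ.≤-total (toℕ x) (toℕ y)
  ... | inj₁ x≤y = walk-up (toℕ y ∸ toℕ x) (ℕₚ.m+[n∸m]≡n x≤y) ∈⊤ ∈⊤ (λ _ _ _ _ → ∈⊤)
  ... | inj₂ y≤x = walk-sym (walk-up (toℕ x ∸ toℕ y) (ℕₚ.m+[n∸m]≡n y≤x) ∈⊤ ∈⊤ (λ _ _ _ _ → ∈⊤))

-- The strip has pathwidth two

mod₃ : ℕ → Fin 3
mod₃ 0 = Fin.zero
mod₃ 1 = Fin.suc Fin.zero
mod₃ 2 = Fin.suc (Fin.suc Fin.zero)
mod₃ (suc (suc (suc m))) = mod₃ m

-- In a clique of the intervals [v, v + 2] any two vertices differ by at most 2, so residues modulo
-- 3 tell them apart and the pigeonhole principle allows only three.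
mod₃-injective : ∀ x y → x ≤ y + 2 → y ≤ x + 2 → mod₃ x ≡ mod₃ y → x ≡ y
mod₃-injective 0 0 _ _ _ = refl
mod₃-injective 1 1 _ _ _ = refl
mod₃-injective 2 2 _ _ _ = refl
mod₃-injective 0 (suc (suc (suc y))) _ (s≤s (s≤s ())) _
mod₃-injective 1 (suc (suc (suc (suc y)))) _ (s≤s (s≤s (s≤s ()))) _
mod₃-injective 2 (suc (suc (suc (suc (suc y))))) _ (s≤s (s≤s (s≤s (s≤s ())))) _
mod₃-injective (suc (suc (suc x))) 0 (s≤s (s≤s ())) _ _
mod₃-injective (suc (suc (suc (suc x)))) 1 (s≤s (s≤s (s≤s ()))) _ _
mod₃-injective (suc (suc (suc (suc (suc x))))) 2 (s≤s (s≤s (s≤s (s≤s ())))) _ _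
mod₃-injective (suc (suc (suc x))) (suc (suc (suc y))) (s≤s (s≤s (s≤s p))) (s≤s (s≤s (s≤s q))) eq =
  cong (3 +_) (mod₃-injective x y p q eq)

AllPairs-index : ∀ {a ℓ} {A : Set a} {R : A → A → Set ℓ} {xs : List A} → AllPairs R xs →
  ∀ {i j} → i Fin.< j → R (Data.List.lookup xs i) (Data.List.lookup xs j)
AllPairs-index (px ∷ _) {Fin.zero} {Fin.suc j} _ = All.lookup px (∈-lookup j)
AllPairs-index (_ ∷ ps) {Fin.suc i} {Fin.suc j} (s≤s i<j) = AllPairs-index ps i<j

strip-pathwidth : ∀ n → PathwidthTwo (strip (3 + n))
strip-pathwidth n = (I , super , cliques) , triangle
  where
  I : Intervals (3 + n)
  I = record { lo = toℕ ; hi = λ v → toℕ v + 2 ; lo≤hi = λ v → ℕₚ.m≤m+n (toℕ v) 2 }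

  super : IsSupergraph (strip (3 + n)) I
  super u v e = (λ { refl → contradiction (trans (≡-sym e) (adjacent-irrefl (toℕ u))) λ () }) , close (adjacent⇒ _ _ e)
    where
    near : ∀ {x y} → Adjacent x y → x ≤ y + 2 × y ≤ x + 2
    near {x} next      = ℕₚ.≤-trans (ℕₚ.m≤m+n x 2) (ℕₚ.n≤1+n _) , subst (suc x ≤_) (ℕₚ.+-comm 2 x) (ℕₚ.n≤1+n (suc x))
    near {x} (next₂ _) = ℕₚ.≤-trans (ℕₚ.m≤m+n x 2) (ℕₚ.m≤n+m _ 2) , ℕₚ.≤-reflexive (ℕₚ.+-comm 2 x)
    close : ∀ {x y} → Adjacent x y ⊎ Adjacent y x → x ≤ y + 2 × y ≤ x + 2
    close (inj₁ a) = near a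
    close (inj₂ a) = Data.Product.swap (near a)

  cliques : CliqueNumber≤ I 3
  cliques K (_ , clique) with length K ≤? 3
  ... | yes p = p
  ... | no K≰3 with Finₚ.pigeonhole (ℕₚ.≰⇒> K≰3) (λ i → mod₃ (toℕ (Data.List.lookup K i)))
  ... | i , j , i<j , eq with AllPairs-index clique i<j
  ... | u≢v , p , q = contradiction (Finₚ.toℕ-injective (mod₃-injective _ _ p q eq)) u≢v

  triangle : ¬ Pathwidth≤ (strip (3 + n)) 1
  triangle (I , super , cliques) = contradiction (cliques K ((ne₁ ∷ ne₂ ∷ []) ∷ (ne₃ ∷ []) ∷ [] ∷ [] ,
      (super v₀ v₁ refl ∷ super v₀ v₂ refl ∷ []) ∷ (super v₁ v₂ refl ∷ []) ∷ [] ∷ [])) λ { (s≤s (s≤s ())) }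
    where
    v₀ v₁ v₂ : Fin (3 + n)
    v₀ = Fin.zero
    v₁ = Fin.suc Fin.zero
    v₂ = Fin.suc (Fin.suc Fin.zero)
    K = v₀ ∷ v₁ ∷ v₂ ∷ []
    ne₁ : v₀ ≢ v₁
    ne₁ ()
    ne₂ : v₀ ≢ v₂
    ne₂ ()
    ne₃ : v₁ ≢ v₂
    ne₃ ()

-- Elimination orders of the strip and the lower bound

Elimination-map⁻ : ∀ {A B : Set} {R : B → B → Set} (f : A → B) {xs} → Elimination R (map f xs) →
  Elimination (λ x y → R (f x) (f y)) xs
Elimination-map⁻ f {x ∷ []}     [ _ ]   = [ x ]
Elimination-map⁻ f {x ∷ []}     (() ∷ _)
Elimination-map⁻ f {x ∷ y ∷ xs} (a ∷ e) = Anyₚ.map⁻ a ∷ Elimination-map⁻ f e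

even-+ : ∀ {a b} → Even a → Even b → Even (a + b)
even-+ zero   e′ = e′
even-+ (2+ e) e′ = 2+ even-+ e e′

bitReversed-odd : ∀ j {lo} → Even lo → All (λ x → ¬ Even x) (bitReversed j lo)
bitReversed-odd zero    e = ¬even-suc e ∷ []
bitReversed-odd (suc j) e = All-interleave (bitReversed-odd j e) (bitReversed-odd j (even-+ e (even-2* (2 ^ j))))

Unique-interleave : ∀ {xs ys : List ℕ} → Unique xs → Unique ys → (∀ {x y} → x ∈ᴸ xs → y ∈ᴸ ys → x ≢ y) →
  Unique (interleave xs ys)
Unique-interleave [] uy _ = uy
Unique-interleave (x∉ ∷ ux) uy d = All-interleave (All.tabulate (d (here refl))) x∉ ∷
  Unique-interleave uy ux (λ p q → ≢-sym (d (there q) p))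

bitReversed-unique : ∀ j lo → Unique (bitReversed j lo)
bitReversed-unique zero    lo = [] ∷ []
bitReversed-unique (suc j) lo = Unique-interleave (bitReversed-unique j lo) (bitReversed-unique j (lo + 2 ^ suc j))
  λ { p q refl → ℕₚ.<⇒≱ (proj₂ (All.lookup (bitReversed-In j lo) p)) (proj₁ (All.lookup (bitReversed-In j (lo + 2 ^ suc j)) q)) }

_∉?_ : (x : ℕ) (σ : List ℕ) → Dec (x ∉ᴸ σ)
x ∉? σ = ¬? (Any.any? (x ℕₚ.≟_) σ)

others : List ℕ → ℕ → List ℕ
others σ m = filter (_∉? σ) (downFrom m)

-- Even numbers leave only in descending order after all of σ, so a smaller even neighbour is still
-- present when m is removed and keeps the rest connected.
parent : ∀ {m} → 0 < m → ∃[ p ] (p < m × Even p × adjacent m p ≡ true)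
parent {m} 0<m with even-or-pred m
... | inj₂ (k , refl , e) = k , ℕₚ.≤-refl , e , trans (adjacent-sym (suc k) k) (adjacent-next k)
... | inj₁ (2+_ {k} e) = k , ℕₚ.n≤1+n (suc k) , e , trans (adjacent-sym (2 + k) k) (adjacent-next₂ e)

module _ {σ : List ℕ} (odd : All (λ x → ¬ Even x) σ) where

  even∈others : ∀ {p m} → p < m → Even p → p ∈ᴸ others σ m
  even∈others p<m e = ∈-filter⁺ (_∉? σ) (∈-downFrom⁺ p<m) (λ p∈σ → All.lookup odd p∈σ e)

  others-elimination : ∀ m → Elimination (λ x y → adjacent x y ≡ true) (others σ (suc m))
  others-elimination zero = subst (Elimination _) (≡-sym (Listₚ.filter-accept (_∉? σ) (λ p → All.lookup odd p zero))) [ 0 ]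
  others-elimination (suc m) with suc m ∉? σ
  ... | no ∈σ = subst (Elimination _) (≡-sym (Listₚ.filter-reject (_∉? σ) ∈σ)) (others-elimination m)
  ... | yes ∉σ = let (p , p< , e , a) = parent {suc m} (s≤s z≤n) in
    subst (Elimination _) (≡-sym (Listₚ.filter-accept (_∉? σ) ∉σ)) (lose (even∈others p< e) a ∷ others-elimination m)

  elimination : ∀ {τ m} → All (λ x → x < suc m × ¬ Even x) τ → Elimination (λ x y → adjacent x y ≡ true) (τ ++ others σ (suc m))
  elimination [] = others-elimination _
  elimination {x ∷ τ} ((x< , x-odd) ∷ ps) = let (p , p< , e , a) = parent {x} (ℕₚ.n≢0⇒n>0 λ { refl → x-odd zero }) in
    lose (∈-++⁺ʳ τ (even∈others (ℕₚ.<-trans p< x<) e)) a ∷ elimination ps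

until-++ : ∀ {n} {c : Fin n} xs ys → c ∉ᴸ xs → until c (xs ++ ys) ≡ xs ++ until c ys
until-++ [] ys _ = refl
until-++ (x ∷ xs) ys c∉ = trans (until-tail (xs ++ ys) (λ x≡c → c∉ (here (≡-sym x≡c)))) (cong (x ∷_) (until-++ xs ys (c∉ ∘ there)))

until-decreasing : ∀ {n} {c : Fin n} {xs} → AllPairs (λ x y → toℕ y < toℕ x) xs → c ∈ᴸ xs → All (λ x → toℕ c ≤ toℕ x) (until c xs)
until-decreasing {c = c} {x ∷ xs} (px ∷ ps) c∈ with x Fin.≟ c | c∈
... | yes refl | _         = ℕₚ.≤-refl ∷ []
... | no x≢c   | here c≡x  = contradiction (≡-sym c≡x) x≢c
... | no x≢c   | there c∈′ = ℕₚ.<⇒≤ (All.lookup px c∈′) ∷ until-decreasing ps c∈′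

fins : ∀ {n} {ws : List ℕ} → All (_< n) ws → List (Fin n)
fins = All.reduce (λ p → Fin.fromℕ< p)

map-fins : ∀ {n} {ws} (ps : All (_< n) ws) → map toℕ (fins ps) ≡ ws
map-fins []       = refl
map-fins (p ∷ ps) = cong₂ _∷_ (Finₚ.toℕ-fromℕ< p) (map-fins ps)

Φ-cong : ∀ {W W′ : ℕ → List ℕ} → (∀ c → W c ≡ W′ c) → ∀ j lo → Φ j lo W ≡ Φ j lo W′
Φ-cong eq zero    lo = refl
Φ-cong eq (suc j) lo = cong₂ _+_ (cong (turns nothing ∘ map (colour lo (2 ^ j))) (eq (lo + 2 ^ j)))
  (cong₂ _+_ (Φ-cong eq j lo) (Φ-cong eq j (lo + 2 ^ j)))

module StripBound (n : ℕ) where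
  open Strip (suc n)
  open Search G
  open Paths G
  open Rotations G
  open Chains G

  word : ∀ {T} → Shape ⊤ T → ℕ → List ℕ
  word t c with c <? suc n
  ... | yes c<n = map toℕ (path t (Fin.fromℕ< c<n))
  ... | no _    = []

  Φ-walk : ∀ {k T T′} (t : Shape ⊤ T) (t′ : Shape ⊤ T′) → FlipWalk G k T T′ →
    ∀ j lo → Φ j lo (word t) ≤ 3 * k + Φ j lo (word t′)
  Φ-walk t t′ (done s) j lo = ℕₚ.≤-reflexive (Φ-cong word≡ j lo)
    where
    word≡ : ∀ c → word t c ≡ word t′ c
    word≡ c with c <? suc n
    ... | yes _ = cong (map toℕ) (path-cong t t′ refl (to (s _)) (from (s _)) ∈⊤)
    ... | no _  = refl
  Φ-walk {suc k} t t′ (flip {U = U} u rot w) j lo with rotation⇒exchange rot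
  ... | A , B , ex with path-flip connected t (tree-shape u) ex
  ... | x , y , _ , sw = ℕₚ.≤-trans (proj₁ (Φ-near H j lo))
      (ℕₚ.≤-trans (ℕₚ.+-monoʳ-≤ 3 (Φ-walk (tree-shape u) t′ w j lo))
        (ℕₚ.≤-reflexive (solve 2 (λ k p → con 3 :+ (con 3 :* k :+ p) := con 3 :* (con 1 :+ k) :+ p) refl k (Φ j lo (word t′)))))
    where
    H : ∀ c → Swapped Between (toℕ x) (toℕ y) c (word t c) (word (tree-shape u) c)
    H c with c <? suc n
    ... | no _ = same
    ... | yes c<n = subst (λ m → Swapped Between (toℕ x) (toℕ y) m (map toℕ (path t (Fin.fromℕ< c<n))) (map toℕ (path (tree-shape u) (Fin.fromℕ< c<n)))) (Finₚ.toℕ-fromℕ< c<n)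
                      (Swapped-map toℕ separates⇒between (sw ∈⊤))

  -- The path-shaped search tree that removes σ first and the remaining vertices in descending
  -- order. The lower bound compares σ in bit-reversal order with σ empty.
  module Ordered {σ : List ℕ} (odd : All (λ x → x < suc n × ¬ Even x) σ) (unique : Unique σ) where

    σ<n : All (_< suc n) σ
    σ<n = All.map proj₁ odd

    others<n : All (_< suc n) (others σ (suc n))
    others<n = All.tabulate λ x∈ → ∈-downFrom⁻ (proj₁ (∈-filter⁻ (_∉? σ) x∈))

    order : List (Fin (suc n))
    order = fins σ<n ++ fins others<n

    order≡ : map toℕ order ≡ σ ++ others σ (suc n)
    order≡ = trans (Listₚ.map-++ toℕ (fins σ<n) (fins others<n)) (cong₂ _++_ (map-fins σ<n) (map-fins others<n))

    removable : Removable order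
    removable = Elimination-map⁻ toℕ (subst (Elimination _) (≡-sym order≡) (elimination (All.map proj₂ odd) odd))

    order-unique : Unique order
    order-unique = AllPairs.map (λ ne eq → ne (cong toℕ eq)) (AllPairsₚ.map⁻ (subst Unique (≡-sym order≡)
      (Uniqueₚ.++⁺ unique (Uniqueₚ.filter⁺ (_∉? σ) (Uniqueₚ.downFrom⁺ (suc n)))
        (λ (x∈σ , x∈) → proj₂ (∈-filter⁻ (_∉? σ) {xs = downFrom (suc n)} x∈) x∈σ))))

    order-complete : ∀ c → c ∈ᴸ order
    order-complete c with ∈-map⁻ toℕ (subst (toℕ c ∈ᴸ_) (≡-sym order≡) c∈)
      where
      c∈ : toℕ c ∈ᴸ σ ++ others σ (suc n)
      c∈ with toℕ c ∉? σ
      ... | yes c∉ = ∈-++⁺ʳ σ (∈-filter⁺ (_∉? σ) (∈-downFrom⁺ (Finₚ.toℕ<n c)) c∉)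
      ... | no ¬c∉ = ∈-++⁺ˡ (decidable-stable (Any.any? (toℕ c ℕₚ.≟_) σ) ¬c∉)
    ... | x , x∈ , eq = subst (_∈ᴸ order) (≡-sym (Finₚ.toℕ-injective eq)) x∈

    spanning : vertices order ≡ ⊤
    spanning = ⊆-antisym (λ _ → ∈⊤) (λ {c} _ → ∈-vertices⁺ order (order-complete c))

    tree : SearchTree G (chain order)
    tree = subst (λ C → Tree G C (chain order)) spanning (chain-tree removable order-unique)

    word-chain : ∀ {c} (c<n : c < suc n) → word (tree-shape tree) c ≡ map toℕ (until (Fin.fromℕ< c<n) order)
    word-chain {c} c<n with c <? suc n
    ... | no c≮n = contradiction c<n c≮n
    ... | yes _ = cong (map toℕ) (trans
      (path-cong (tree-shape tree) (tree-shape (chain-tree removable order-unique)) (≡-sym spanning) id id ∈⊤)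
      (path-chain removable order-unique (order-complete _)))

    -- An even c is not in the odd list σ, so all of σ comes before c on its root path.
    word-even : ∀ {c} → c < suc n → Even c → ∃[ w ] word (tree-shape tree) c ≡ σ ++ w
    word-even {c} c<n e = map toℕ (until c′ (fins others<n)) , trans (word-chain c<n) (trans
      (cong (map toℕ) (until-++ (fins σ<n) (fins others<n) c∉))
      (trans (Listₚ.map-++ toℕ (fins σ<n) _) (cong (_++ _) (map-fins σ<n))))
      where
      c′ = Fin.fromℕ< c<n
      c∉ : c′ ∉ᴸ fins σ<n
      c∉ c∈ = proj₂ (All.lookup odd (subst (toℕ c′ ∈ᴸ_) (map-fins σ<n) (∈-map⁺ toℕ c∈)))
        (subst Even (≡-sym (Finₚ.toℕ-fromℕ< c<n)) e)

  module Descending = Ordered [] []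

  word-descending : ∀ c → c < suc n → All (c ≤_) (word (tree-shape Descending.tree) c)
  word-descending c c<n = subst (All (c ≤_)) (≡-sym (Descending.word-chain c<n))
    (Allₚ.map⁺ (All.map (subst (_≤ _) (Finₚ.toℕ-fromℕ< c<n)) (until-decreasing decreasing (Descending.order-complete _))))
    where
    decreasing : AllPairs (λ x y → toℕ y < toℕ x) Descending.order
    decreasing = AllPairsₚ.map⁻ (subst (AllPairs (λ x y → y < x)) (≡-sym Descending.order≡)
      (AllPairsₚ.filter⁺ (_∉? []) (AllPairsₚ.applyDownFrom⁺₁ id (suc n) λ j<i _ → j<i)))

  strip-lower : ∀ j → 2 ^ suc j ≤ suc n → ∃₂ λ T T′ → SearchTree G T × SearchTree G T′ ×
    (∀ k → FlipWalk G k T T′ → 1 + j * 2 ^ j ≤ 3 * k + 2 ^ j)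
  strip-lower j ≤n = _ , _ , Reversed.tree , Descending.tree , λ k w →
    ℕₚ.≤-trans (Φ-bitReversed {M = 2 ^ suc j} {W = word (tree-shape Reversed.tree)}
        (λ i i< → Reversed.word-even (ℕₚ.<-≤-trans i< ≤n) (even-2* i)) j 0 ℕₚ.≤-refl
        (Listₚ.filter-all (In? 0 (suc j)) (bitReversed-In j 0)))
      (ℕₚ.+-monoˡ-≤ (2 ^ j) (ℕₚ.≤-trans (Φ-walk (tree-shape Reversed.tree) (tree-shape Descending.tree) w (suc j) 0)
        (ℕₚ.≤-reflexive (trans (cong (3 * k +_) (Φ-descending (word (tree-shape Descending.tree)) (suc n) word-descending (suc j) 0 ≤n))
          (ℕₚ.+-identityʳ (3 * k))))))
    where
    module Reversed = Ordered {bitReversed j 0}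
      (All.zip (All.map (λ (_ , x<) → ℕₚ.<-≤-trans x< ≤n) (bitReversed-In j 0) , bitReversed-odd j zero))
      (bitReversed-unique j 0)

-- Rotation walks and the upper bound

∣p∣+∣q─p∣≤∣q∣ : ∀ {n} {p q : Subset n} → p ⊆ q → ∣ p ∣ + ∣ q ─ p ∣ ≤ ∣ q ∣
∣p∣+∣q─p∣≤∣q∣ {p = []ᵛ} {[]ᵛ} _ = z≤n
∣p∣+∣q─p∣≤∣q∣ {p = false ∷ᵛ p} {false ∷ᵛ q} s = ∣p∣+∣q─p∣≤∣q∣ (drop-∷-⊆ s)
∣p∣+∣q─p∣≤∣q∣ {p = false ∷ᵛ p} {true ∷ᵛ q} s = subst (_≤ suc ∣ q ∣) (≡-sym (ℕₚ.+-suc ∣ p ∣ ∣ q ─ p ∣)) (s≤s (∣p∣+∣q─p∣≤∣q∣ (drop-∷-⊆ s)))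
∣p∣+∣q─p∣≤∣q∣ {p = true ∷ᵛ p} {true ∷ᵛ q} s = s≤s (∣p∣+∣q─p∣≤∣q∣ (drop-∷-⊆ s))
∣p∣+∣q─p∣≤∣q∣ {p = true ∷ᵛ p} {false ∷ᵛ q} s with s here
... | ()

disjoint-card : ∀ {n} {p q r : Subset n} → p ⊆ r → q ⊆ r → (∀ {x} → x ∈ p → x ∉ q) → ∣ p ∣ + ∣ q ∣ ≤ ∣ r ∣
disjoint-card {p = p} p⊆r q⊆r dis = ℕₚ.≤-trans
  (ℕₚ.+-monoʳ-≤ ∣ p ∣ (p⊆q⇒∣p∣≤∣q∣ (λ x∈q → x∈p∧x∉q⇒x∈p─q (q⊆r x∈q) (λ x∈p → dis x∈p x∈q)))) (∣p∣+∣q─p∣≤∣q∣ p⊆r)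

module Flips {n : ℕ} (G : Graph n) where
  open Search G

  Family : Set
  Family = List (Subset n)

  same-refl : ∀ {T : Family} → SameSet G T T
  same-refl _ = mk⇔ id id

  same-sym : ∀ {T U : Family} → SameSet G T U → SameSet G U T
  same-sym s X = mk⇔ (from (s X)) (to (s X))

  same-trans : ∀ {T U V : Family} → SameSet G T U → SameSet G U V → SameSet G T V
  same-trans s s′ X = mk⇔ (to (s′ X) ∘ to (s X)) (from (s X) ∘ from (s′ X))

  rotation-respˡ : ∀ {T T′ U} → SameSet G T T′ → Rotation G T′ U → Rotation G T U
  rotation-respˡ s (A , B , A∈ , A∉ , B∈ , B∉ , oA , oB) =
    A , B , from (s A) A∈ , A∉ , B∈ , B∉ ∘ to (s B) , (λ X X∈ → oA X (to (s X) X∈)) , (λ X X∈ X∉ → oB X X∈ (X∉ ∘ from (s X)))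

  rotation-sym : ∀ {T U} → Rotation G T U → Rotation G U T
  rotation-sym (A , B , A∈ , A∉ , B∈ , B∉ , oA , oB) = B , A , B∈ , B∉ , A∈ , A∉ , oB , oA

  rotation-respʳ : ∀ {T U U′} → SameSet G U U′ → Rotation G T U → Rotation G T U′
  rotation-respʳ s r = rotation-sym (rotation-respˡ (same-sym s) (rotation-sym r))

  -- The predicate V keeps track of what each intermediate family is, a tree on C or a forest, so
  -- that walks inside a subtree can be transplanted into the whole tree. Lengths are upper bounds,
  -- which makes concatenation and weakening immediate.
  data Within (V : Family → Set) : ℕ → Family → Family → Set where
    done : ∀ {k T U} → SameSet G T U → Within V k T U
    flip : ∀ {k T U W} → V U → Rotation G T U → Within V k U W → Within V (suc k) T W

  module _ {V : Family → Set} where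

    within-mono : ∀ {k l T U} → k ≤ l → Within V k T U → Within V l T U
    within-mono _ (done s) = done s
    within-mono (s≤s k≤l) (flip v r w) = flip v r (within-mono k≤l w)

    within-respˡ : ∀ {k T T′ U} → SameSet G T T′ → Within V k T′ U → Within V k T U
    within-respˡ s (done s′)    = done (same-trans s s′)
    within-respˡ s (flip v r w) = flip v (rotation-respˡ s r) w

    within-trans : ∀ {k l T U W} → Within V k T U → Within V l U W → Within V (k + l) T W
    within-trans {k} {l} (done s) w′ = within-mono (ℕₚ.m≤n+m l k) (within-respˡ s w′)
    within-trans (flip v r w) w′ = flip v r (within-trans w w′)

    within-sym : ∀ {k T U} → V T → Within V k T U → Within V k U T
    within-sym v (done s) = done (same-sym s)
    within-sym {suc k} {T} {W} v (flip u r w) = subst (λ j → Within V j W T) (ℕₚ.+-comm k 1)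
      (within-trans (within-sym u w) (flip v (rotation-sym r) (done same-refl)))

    within⇒flipwalk : (∀ {T} → V T → SearchTree G T) → ∀ {k T U} → Within V k T U → ∃[ j ] (j ≤ k × FlipWalk G j T U)
    within⇒flipwalk h (done s) = 0 , z≤n , done s
    within⇒flipwalk h (flip v r w) = let (j , j≤ , fw) = within⇒flipwalk h w in suc j , s≤s j≤ , flip (h v) r fw

  within-map : ∀ {V V′ : Family → Set} (f : Family → Family) → (∀ {T} → V T → V′ (f T)) →
    (∀ {T U} → SameSet G T U → SameSet G (f T) (f U)) →
    (∀ {T U} → V T → V U → Rotation G T U → Rotation G (f T) (f U)) →
    ∀ {k T U} → V T → Within V k T U → Within V′ k (f T) (f U)
  within-map f fV fS fR v (done s) = done (fS s)
  within-map f fV fS fR v (flip u r w) = flip (fV u) (fR v u r) (within-map f fV fS fR u w)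

  Extends : Family → Family → Family → Set
  Extends T F T₁ = ∀ X → X ∈ᴸ T₁ ⇔ (X ∈ᴸ T ⊎ X ∈ᴸ F)

  extends-same : ∀ {T U F T₁ U₁} → Extends T F T₁ → Extends U F U₁ → SameSet G T U → SameSet G T₁ U₁
  extends-same e e′ s X = mk⇔ (λ X∈ → from (e′ X) (Sum.map₁ (to (s X)) (to (e X) X∈)))
                              (λ X∈ → from (e X) (Sum.map₁ (from (s X)) (to (e′ X) X∈)))

  -- Adding the same tubes F to both ends preserves a rotation; disjointness keeps A and B from
  -- being hidden by F.
  extends-rotation : ∀ {T U F T₁ U₁} → Extends T F T₁ → Extends U F U₁ →
    (∀ {X} → X ∈ᴸ T → X ∉ᴸ F) → (∀ {X} → X ∈ᴸ U → X ∉ᴸ F) → Rotation G T U → Rotation G T₁ U₁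
  extends-rotation {T} {U} {F} {T₁} {U₁} e e′ T∩F U∩F (A , B , A∈ , A∉ , B∈ , B∉ , oA , oB) =
    A , B , from (e A) (inj₁ A∈) , [ A∉ , T∩F A∈ ]′ ∘ to (e′ A) , from (e′ B) (inj₁ B∈) , [ B∉ , U∩F B∈ ]′ ∘ to (e B) ,
    only e e′ oA , only e′ e oB
    where
    only : ∀ {T U T₁ U₁ A} → Extends T F T₁ → Extends U F U₁ → (∀ X → X ∈ᴸ T → X ∉ᴸ U → X ≡ A) →
      ∀ X → X ∈ᴸ T₁ → X ∉ᴸ U₁ → X ≡ A
    only e e′ o X X∈ X∉ with to (e X) X∈
    ... | inj₁ X∈T = o X X∈T (λ X∈U → X∉ (from (e′ X) (inj₁ X∈U)))
    ... | inj₂ X∈F = contradiction (from (e′ X) (inj₂ X∈F)) X∉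

  extends-++ʳ : ∀ {T} F → Extends T F (T ++ F)
  extends-++ʳ {T} F X = mk⇔ (∈-++⁻ T) [ ∈-++⁺ˡ , ∈-++⁺ʳ T ]′

  extends-++ˡ : ∀ {F} T → Extends F T (T ++ F)
  extends-++ˡ T X = mk⇔ (Sum.swap ∘ ∈-++⁻ T) [ ∈-++⁺ʳ T , ∈-++⁺ˡ ]′

  extends-∷ : ∀ {F} C → Extends F (C ∷ []) (C ∷ F)
  extends-∷ C X = mk⇔ (λ { (here eq) → inj₂ (here eq) ; (there p) → inj₁ p }) λ { (inj₁ p) → there p ; (inj₂ (here eq)) → here eq }

  module _ {C Cs} (sep : All (Separated G C) Cs) where

    tubes-disjoint : ∀ {T F X} → Tree G C T → Forest G Cs F → X ∈ᴸ T → X ∉ᴸ F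
    tubes-disjoint t f X∈T X∈F with tree-tubes t X∈T | forest-tubes f X∈F
    ... | X⊆C , x , x∈X | D , D∈ , X⊆D , _ = proj₁ (All.lookup sep D∈ x x (X⊆C x∈X) (X⊆D x∈X)) refl

    within-headᶠ : ∀ {k T U F} → Tree G C T → Forest G Cs F → Within (Tree G C) k T U → Within (Forest G (C ∷ Cs)) k (T ++ F) (U ++ F)
    within-headᶠ {F = F} t f = within-map (_++ F) (_∷ f) (extends-same (extends-++ʳ F) (extends-++ʳ F))
      (λ t u → extends-rotation (extends-++ʳ F) (extends-++ʳ F) (tubes-disjoint t f) (tubes-disjoint u f)) t

    within-tailᶠ : ∀ {k T F F′} → Tree G C T → Forest G Cs F → Within (Forest G Cs) k F F′ → Within (Forest G (C ∷ Cs)) k (T ++ F) (T ++ F′)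
    within-tailᶠ {T = T} t f = within-map (T ++_) (t ∷_) (extends-same (extends-++ˡ T) (extends-++ˡ T))
      (λ f f′ → extends-rotation (extends-++ˡ T) (extends-++ˡ T) (λ p q → tubes-disjoint t f q p) (λ p q → tubes-disjoint t f′ q p)) f

  module _ {C r Cs} (r∈C : r ∈ C) (comps : IsComponents G (C minus r) Cs) where

    forest-⊆ : ∀ {F X} → Forest G Cs F → X ∈ᴸ F → X ⊆ C minus r
    forest-⊆ f X∈ x∈ with forest-tubes f X∈
    ... | D , D∈ , X⊆D , _ = from (proj₂ (proj₂ (proj₂ comps)) _) (lose D∈ (X⊆D x∈))

    top∉ : ∀ {F X} → Forest G Cs F → X ∈ᴸ F → X ∉ᴸ (C ∷ [])
    top∉ f X∈ (here refl) = proj₂ (∈-minus⁻ (forest-⊆ f X∈ r∈C)) refl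

    within-node : ∀ {k F F′} → Forest G Cs F → Within (Forest G Cs) k F F′ → Within (Tree G C) k (C ∷ F) (C ∷ F′)
    within-node f = within-map (C ∷_) (node r∈C comps) (extends-same (extends-∷ C) (extends-∷ C))
      (λ f f′ → extends-rotation (extends-∷ C) (extends-∷ C) (top∉ f) (top∉ f′)) f

  total : Family → ℕ
  total Cs = sum (map ∣_∣ Cs)

  total≤ : ∀ {S Cs} → AllPairs (Separated G) Cs → All (_⊆ S) Cs → total Cs ≤ ∣ S ∣
  total≤ [] _ = z≤n
  total≤ {S} {C ∷ Cs} (s ∷ ss) (C⊆S ∷ ps) = ℕₚ.≤-trans
    (ℕₚ.+-monoʳ-≤ ∣ C ∣ (total≤ {S ─ C} ss (All.zipWith outside (s , ps)))) (∣p∣+∣q─p∣≤∣q∣ C⊆S)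
    where
    outside : ∀ {D} → Separated G C D × D ⊆ S → D ⊆ S ─ C
    outside (sep , D⊆S) x∈D = x∈p∧x∉q⇒x∈p─q (D⊆S x∈D) (λ x∈C → proj₁ (sep _ _ x∈C x∈D) refl)

  components-⊆ : ∀ {S Cs} → IsComponents G S Cs → All (_⊆ S) Cs
  components-⊆ (_ , _ , _ , cover) = All.tabulate λ D∈ x∈ → from (cover _) (lose D∈ x∈)

  -- The trees are transformed one after the other, and bounds linear in the component sizes add up
  -- to one linear in the total.
  within-forest : ∀ {c Cs F F′} → AllPairs (Separated G) Cs →
    (∀ {D T U} → D ∈ᴸ Cs → Tree G D T → Tree G D U → Within (Tree G D) (c * ∣ D ∣) T U) →
    Forest G Cs F → Forest G Cs F′ → Within (Forest G Cs) (c * total Cs) F F′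
  within-forest _ H [] [] = done same-refl
  within-forest {c} {C ∷ Cs} (s ∷ ss) H (_∷_ {T = T} {F} t f) (_∷_ {T = U} {F′} t′ f′) =
    subst (λ k → Within (Forest G (C ∷ Cs)) k (T ++ F) (U ++ F′)) (≡-sym (ℕₚ.*-distribˡ-+ c ∣ C ∣ (total Cs)))
      (within-trans (within-headᶠ s t f (H (here refl) t t′)) (within-tailᶠ s t′ f (within-forest {c} ss (H ∘ there) f f′)))

  components-share : ∀ {S Cs Cs′ D} → IsComponents G S Cs → IsComponents G S Cs′ → D ∈ᴸ Cs → D ∈ᴸ Cs′
  components-share comps@(ne , _ , _ , cover) comps′@(_ , _ , _ , cover′) D∈ with All.lookup ne D∈
  ... | c , c∈D with find (to (cover′ c) (from (cover c) (lose D∈ c∈D)))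
  ... | D′ , D′∈ , c∈D′ = subst (_∈ᴸ _) (component-unique (components⇒component comps′ D′∈ c∈D′) (components⇒component comps D∈ c∈D)) D′∈

  -- `Forest` is indexed by a list of components, which S determines only up to order. Picking the
  -- subtree of each D in turn rebuilds the forest in the wanted order with the same tubes.
  realign : ∀ {S Cs Cs′ F′} → IsComponents G S Cs → IsComponents G S Cs′ → Forest G Cs′ F′ → ∃[ F ] (Forest G Cs F × SameSet G F′ F)
  realign {S} {Cs} {Cs′} {F′} comps comps′ f′ = let (F , f , tubes) = go Cs (λ D∈ → components-share comps comps′ D∈) in
      F , f , λ X → mk⇔
        (λ X∈ → let (D , D∈ , X⊆D , _) = forest-tubes f′ X∈ in proj₂ (tubes X) X∈ (components-share comps′ comps D∈) X⊆D)
        (λ X∈ → proj₁ (tubes X) X∈)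
    where
    go : ∀ Ds → (∀ {D} → D ∈ᴸ Ds → D ∈ᴸ Cs′) →
      ∃[ F ] (Forest G Ds F × (∀ X → (X ∈ᴸ F → X ∈ᴸ F′) × (X ∈ᴸ F′ → ∀ {D} → D ∈ᴸ Ds → X ⊆ D → X ∈ᴸ F)))
    go [] _ = [] , [] , λ X → (λ ()) , λ _ ()
    go (D ∷ Ds) h with go Ds (h ∘ there) | forest-shape f′ (proj₁ (proj₂ (proj₂ comps′))) (h (here refl))
    ... | F , f , tubes | U , tubesU , _ , u = U ++ F , u ∷ f , λ X →
      (λ X∈ → [ (λ p → proj₁ (proj₁ (tubesU X) p)) , proj₁ (tubes X) ]′ (∈-++⁻ U X∈)) ,
      λ { X∈ (here refl) X⊆D → ∈-++⁺ˡ (proj₂ (tubesU X) X∈ X⊆D) ; X∈ (there D∈) X⊆D → ∈-++⁺ʳ U (proj₂ (tubes X) X∈ D∈ X⊆D) }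

-- Lifting a vertex to the root

AllPairs-resp-↭ : ∀ {A : Set} {R : A → A → Set} → (∀ {x y} → R x y → R y x) → ∀ {xs ys} → xs ↭ ys → AllPairs R xs → AllPairs R ys
AllPairs-resp-↭ s Perm.refl ps = ps
AllPairs-resp-↭ s (Perm.prep x p) (px ∷ ps) = Permₚ.All-resp-↭ p px ∷ AllPairs-resp-↭ s p ps
AllPairs-resp-↭ s (Perm.swap x y p) ((xy ∷ px) ∷ py ∷ ps) =
  (s xy ∷ Permₚ.All-resp-↭ p py) ∷ Permₚ.All-resp-↭ p px ∷ AllPairs-resp-↭ s p ps
AllPairs-resp-↭ s (Perm.trans p q) ps = AllPairs-resp-↭ s q (AllPairs-resp-↭ s p ps)

∈-⋃⁺ : ∀ {n} {x : Fin n} {D Ds} → D ∈ᴸ Ds → x ∈ D → x ∈ ⋃ Ds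
∈-⋃⁺ (here refl) x∈ = x∈p∪q⁺ (inj₁ x∈)
∈-⋃⁺ (there D∈)  x∈ = x∈p∪q⁺ (inj₂ (∈-⋃⁺ D∈ x∈))

∈-⋃⁻ : ∀ {n} {x : Fin n} Ds → x ∈ ⋃ Ds → ∃[ D ] (D ∈ᴸ Ds × x ∈ D)
∈-⋃⁻ [] x∈ = contradiction x∈ ∉⊥
∈-⋃⁻ (D ∷ Ds) x∈ with x∈p∪q⁻ D (⋃ Ds) x∈
... | inj₁ p = D , here refl , p
... | inj₂ p = let (E , E∈ , q) = ∈-⋃⁻ Ds p in E , there E∈ , q

module Lifting {n : ℕ} (G : Graph n) where
  open Search G
  open Flips G

  Touches : Fin n → Subset n → Set
  Touches u D = ∃[ x ] (x ∈ D × adj G u x ≡ true)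

  touches? : ∀ u → Decidable (Touches u)
  touches? u D = Finₚ.any? (λ x → (x ∈? D) ×-dec (adj G u x Boolₚ.≟ true))

  separated-sym : ∀ {C D} → Separated G C D → Separated G D C
  separated-sym s x y x∈ y∈ = ≢-sym (proj₁ (s y x y∈ x∈)) , trans (sym G x y) (proj₂ (s y x y∈ x∈))

  -- Adding a vertex u to S merges u with the components it touches.
  module Merge {S S′ Cs u} (comps : IsComponents G S Cs) (u∉S : u ∉ S) (grow : ∀ x → x ∈ S′ ⇔ (x ≡ u ⊎ x ∈ S)) where
    private
      ne    = proj₁ comps
      conn  = proj₁ (proj₂ comps)
      sep   = proj₁ (proj₂ (proj₂ comps))
      cover = proj₂ (proj₂ (proj₂ comps))

    touched apart : Family
    touched = filter (touches? u) Cs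
    apart   = filter (λ D → ¬? (touches? u D)) Cs

    merged : Subset n
    merged = ⁅ u ⁆ ∪ ⋃ touched

    touched⁻ : ∀ {D} → D ∈ᴸ touched → D ∈ᴸ Cs × Touches u D
    touched⁻ = ∈-filter⁻ (touches? u)

    apart⁻ : ∀ {D} → D ∈ᴸ apart → D ∈ᴸ Cs × ¬ Touches u D
    apart⁻ = ∈-filter⁻ (λ D → ¬? (touches? u D))

    ⊆S : ∀ {x D} → D ∈ᴸ Cs → x ∈ D → x ∈ S
    ⊆S D∈ x∈ = from (cover _) (lose D∈ x∈)

    u∈merged : u ∈ merged
    u∈merged = x∈p∪q⁺ (inj₁ (x∈⁅x⁆ u))

    ⊆merged : ∀ {x D} → D ∈ᴸ touched → x ∈ D → x ∈ merged
    ⊆merged D∈ x∈ = x∈p∪q⁺ (inj₂ (∈-⋃⁺ D∈ x∈))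

    merged⁻ : ∀ {x} → x ∈ merged → x ≡ u ⊎ ∃[ D ] (D ∈ᴸ touched × x ∈ D)
    merged⁻ x∈ = Sum.map (x∈⁅y⁆⇒x≡y u) (∈-⋃⁻ touched) (x∈p∪q⁻ ⁅ u ⁆ (⋃ touched) x∈)

    merged-⊆ : ∀ {x} → x ∈ merged → x ≡ u ⊎ x ∈ S
    merged-⊆ x∈ = Sum.map₂ (λ (D , D∈ , x∈D) → ⊆S (proj₁ (touched⁻ D∈)) x∈D) (merged⁻ x∈)

    to-u : ∀ {x} → x ∈ merged → WalkIn G merged x u
    to-u x∈ with merged⁻ x∈
    ... | inj₁ refl = here x∈
    ... | inj₂ (D , D∈ , x∈D) with touched⁻ D∈
    ... | D∈Cs , y , y∈D , uy = walk-trans (walk-mono (⊆merged D∈) (All.lookup conn D∈Cs _ y x∈D y∈D))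
                                  (step (⊆merged D∈ y∈D) (adj-sym uy) (here u∈merged))

    separated : ∀ {N} → N ∈ᴸ apart → Separated G merged N
    separated N∈ x y x∈ y∈N with apart⁻ N∈ | merged⁻ x∈
    ... | N∈Cs , ¬t | inj₁ refl = (λ { refl → u∉S (⊆S N∈Cs y∈N) }) , Boolₚ.¬-not (λ e → ¬t (y , y∈N , e))
    ... | N∈Cs , ¬t | inj₂ (D , D∈ , x∈D) with touched⁻ D∈
    ... | D∈Cs , t with AllPairs-lookup sep D∈Cs N∈Cs
    ... | inj₁ refl     = contradiction t ¬t
    ... | inj₂ (inj₁ s) = s x y x∈D y∈N
    ... | inj₂ (inj₂ s) = separated-sym s x y x∈D y∈N

    covered : ∀ {x D} → D ∈ᴸ Cs → x ∈ D → x ∈ merged ⊎ Any (x ∈_) apart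
    covered {D = D} D∈ x∈ with touches? u D
    ... | yes t = inj₁ (⊆merged (∈-filter⁺ (touches? u) D∈ t) x∈)
    ... | no ¬t = inj₂ (lose (∈-filter⁺ (λ D → ¬? (touches? u D)) D∈ ¬t) x∈)

    components : IsComponents G S′ (merged ∷ apart)
    components = (u , u∈merged) ∷ Allₚ.filter⁺ _ ne ,
      (λ x y x∈ y∈ → walk-trans (to-u x∈) (walk-sym (to-u y∈))) ∷ Allₚ.filter⁺ _ conn ,
      All.tabulate separated ∷ AllPairsₚ.filter⁺ _ sep ,
      λ x → mk⇔ (λ x∈ → [ (λ { refl → here u∈merged })
                        , (λ x∈S → let (D , D∈ , x∈D) = find (to (cover x) x∈S) in [ here , there ]′ (covered D∈ x∈D)) ]′ (to (grow x) x∈))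
                (λ { (here x∈) → from (grow x) (merged-⊆ x∈)
                   ; (there p) → let (D , D∈ , x∈D) = find p in from (grow x) (inj₂ (⊆S (proj₁ (apart⁻ D∈)) x∈D)) })

    components-merged : IsComponents G (merged minus u) touched
    components-merged = Allₚ.filter⁺ _ ne , Allₚ.filter⁺ _ conn , AllPairsₚ.filter⁺ _ sep ,
      λ x → mk⇔ (λ x∈ → let (x∈m , x≢u) = ∈-minus⁻ x∈ in
                        [ (λ x≡u → contradiction x≡u x≢u) , (λ (D , D∈ , x∈D) → lose D∈ x∈D) ]′ (merged⁻ x∈m))
                (λ p → let (D , D∈ , x∈D) = find p in
                       ∈-minus⁺ (⊆merged D∈ x∈D) λ { refl → u∉S (⊆S (proj₁ (touched⁻ D∈)) x∈D) })

  forest-++ : ∀ {Cs Ds F F′} → Forest G Cs F → Forest G Ds F′ → Forest G (Cs ++ Ds) (F ++ F′)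
  forest-++ [] f′ = f′
  forest-++ {F′ = F′} (_∷_ {T = T} {F} t f) f′ = subst (Forest G _) (≡-sym (Listₚ.++-assoc T F F′)) (t ∷ forest-++ f f′)

  forest-partition : ∀ {P : Subset n → Set} (P? : Decidable P) {Cs F} → Forest G Cs F →
    ∃₂ λ F₁ F₂ → Forest G (filter P? Cs) F₁ × Forest G (filter (λ D → ¬? (P? D)) Cs) F₂ × Extends F₁ F₂ F
  forest-partition P? [] = [] , [] , [] , [] , λ X → mk⇔ inj₁ λ { (inj₁ ()) ; (inj₂ ()) }
  forest-partition P? {C ∷ Cs} (_∷_ {T = T} t f) with forest-partition P? f | P? C
  ... | F₁ , F₂ , f₁ , f₂ , e | yes p =
    T ++ F₁ , F₂ , t ∷ f₁ , f₂ ,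
    λ X → mk⇔ (λ X∈ → [ inj₁ ∘ ∈-++⁺ˡ , Sum.map₁ (∈-++⁺ʳ T) ∘ to (e X) ]′ (∈-++⁻ T X∈))
              [ (λ X∈ → [ ∈-++⁺ˡ , ∈-++⁺ʳ T ∘ from (e X) ∘ inj₁ ]′ (∈-++⁻ T X∈)) , ∈-++⁺ʳ T ∘ from (e X) ∘ inj₂ ]′
  ... | F₁ , F₂ , f₁ , f₂ , e | no np =
    F₁ , T ++ F₂ , f₁ , t ∷ f₂ ,
    λ X → mk⇔ (λ X∈ → [ inj₂ ∘ ∈-++⁺ˡ , Sum.map₂ (∈-++⁺ʳ T) ∘ to (e X) ]′ (∈-++⁻ T X∈))
              [ ∈-++⁺ʳ T ∘ from (e X) ∘ inj₁ , (λ X∈ → [ ∈-++⁺ˡ , ∈-++⁺ʳ T ∘ from (e X) ∘ inj₂ ]′ (∈-++⁻ T X∈)) ]′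

  components-refine : ∀ {S A Cs v Ds} → IsComponents G S (A ∷ Cs) → v ∈ A → IsComponents G (A minus v) Ds →
    IsComponents G (S minus v) (Ds ++ Cs)
  components-refine {S} {A} {Cs} {v} {Ds} comps@(_ ∷ ne , _ ∷ conn , sA ∷ sep , cover) v∈A comps′@(ne′ , conn′ , sep′ , cover′) =
    Allₚ.++⁺ ne′ ne , Allₚ.++⁺ conn′ conn ,
    AllPairsₚ.++⁺ sep′ sep (All.map (λ D⊆ → All.map (λ s x y x∈ → s x y (proj₁ (∈-minus⁻ (D⊆ x∈)))) sA) (components-⊆ comps′)) ,
    λ x → mk⇔ (λ x∈ → let (x∈S , x≢v) = ∈-minus⁻ x∈ in split (to (cover x) x∈S) x≢v)
              (λ p → [ (λ q → let x∈ = from (cover′ x) q in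
                         ∈-minus⁺ (from (cover x) (here (proj₁ (∈-minus⁻ x∈)))) (proj₂ (∈-minus⁻ x∈)))
                     , (λ q → ∈-minus⁺ (from (cover x) (there q))
                         λ { refl → let (D , D∈ , x∈D) = find q in proj₁ (All.lookup sA D∈ x x v∈A x∈D) refl }) ]′ (Anyₚ.++⁻ Ds p))
    where
    split : ∀ {x} → Any (x ∈_) (A ∷ Cs) → x ≢ v → Any (x ∈_) (Ds ++ Cs)
    split (here x∈A) x≢v = Anyₚ.++⁺ˡ (to (cover′ _) (∈-minus⁺ x∈A x≢v))
    split (there q) _ = Anyₚ.++⁺ʳ Ds q

  RootedAt : Fin n → Subset n → Family → Set
  RootedAt v C T = ∃₂ λ Cs F → IsComponents G (C minus v) Cs × Forest G Cs F × T ≡ C ∷ F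

  rooted⇒tree : ∀ {v C T} → v ∈ C → RootedAt v C T → Tree G C T
  rooted⇒tree v∈C (Cs , F , comps , f , refl) = node v∈C comps f

  -- Without v, the vertex u and the pieces of C minus u minus v that it touches form one component,
  -- `merged`, and deleting u from it returns these pieces. The subtrees on the pieces are merely
  -- redistributed, so A is exchanged for `merged`.
  rotate-root : ∀ {C u v A Cs Ds F F′} → u ∈ C → v ∈ A → IsComponents G (C minus u) (A ∷ Cs) → IsComponents G (A minus v) Ds →
    Forest G Ds F → Forest G Cs F′ → ∃[ T ] (RootedAt v C T × Rotation G (C ∷ (A ∷ F) ++ F′) T)
  rotate-root {C} {u} {v} {A} {Cs} {Ds} {F} {F′} u∈C v∈A comps comps′ f f′
    with forest-partition (touches? u) (forest-++ f f′)
  ... | F₁ , F₂ , f₁ , f₂ , ext = _ , (merged ∷ apart , _ , components , node u∈merged components-merged f₁ ∷ f₂ , refl) ,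
    A , merged , there (here refl) , A∉ , there (here refl) , merged∉ , onlyA , onlyB
    where
    A⊆ : A ⊆ C minus u
    A⊆ = All.lookup (components-⊆ comps) (here refl)
    v∈C : v ∈ C
    v∈C = proj₁ (∈-minus⁻ (A⊆ v∈A))
    v≢u : v ≢ u
    v≢u = proj₂ (∈-minus⁻ (A⊆ v∈A))
    refined : IsComponents G ((C minus u) minus v) (Ds ++ Cs)
    refined = components-refine comps v∈A comps′
    u∉A : u ∉ A
    u∉A u∈A = proj₂ (∈-minus⁻ (A⊆ u∈A)) refl
    grow : ∀ x → x ∈ C minus v ⇔ (x ≡ u ⊎ x ∈ (C minus u) minus v)
    grow x = mk⇔ (λ x∈ → let (x∈C , x≢v) = ∈-minus⁻ x∈ in split x∈C x≢v (x Fin.≟ u))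
      [ (λ { refl → ∈-minus⁺ u∈C (≢-sym v≢u) })
      , (λ x∈ → let (x∈′ , x≢v) = ∈-minus⁻ x∈ in ∈-minus⁺ (proj₁ (∈-minus⁻ x∈′)) x≢v) ]′
      where
      split : x ∈ C → x ≢ v → Dec (x ≡ u) → x ≡ u ⊎ x ∈ (C minus u) minus v
      split _ _ (yes eq) = inj₁ eq
      split x∈C x≢v (no x≢u) = inj₂ (∈-minus⁺ (∈-minus⁺ x∈C x≢u) x≢v)
    open Merge refined (λ u∈ → proj₂ (∈-minus⁻ (proj₁ (∈-minus⁻ u∈))) refl) grow

    rest-⊆ : ∀ {X} → X ∈ᴸ F ++ F′ → X ⊆ (C minus u) minus v
    rest-⊆ X∈ x∈ with forest-tubes (forest-++ f f′) X∈
    ... | D , D∈ , X⊆D , _ = ⊆S D∈ (X⊆D x∈)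

    v∉merged : v ∉ merged
    v∉merged v∈ = [ v≢u , (λ v∈S → proj₂ (∈-minus⁻ v∈S) refl) ]′ (merged-⊆ v∈)

    A∉rest : A ∉ᴸ F ++ F′
    A∉rest A∈ = proj₂ (∈-minus⁻ (rest-⊆ A∈ v∈A)) refl

    merged∉rest : merged ∉ᴸ F ++ F′
    merged∉rest m∈ = proj₂ (∈-minus⁻ (proj₁ (∈-minus⁻ (rest-⊆ m∈ u∈merged)))) refl

    A∉ : A ∉ᴸ C ∷ (merged ∷ F₁) ++ F₂
    A∉ (here refl) = u∉A u∈C
    A∉ (there (here A≡m)) = u∉A (subst (u ∈_) (≡-sym A≡m) u∈merged)
    A∉ (there (there p)) = A∉rest (from (ext A) (∈-++⁻ F₁ p))

    merged∉ : merged ∉ᴸ C ∷ (A ∷ F) ++ F′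
    merged∉ (here m≡C) = v∉merged (subst (v ∈_) (≡-sym m≡C) v∈C)
    merged∉ (there (here m≡A)) = u∉A (subst (u ∈_) m≡A u∈merged)
    merged∉ (there (there p)) = merged∉rest p

    onlyA : ∀ X → X ∈ᴸ C ∷ (A ∷ F) ++ F′ → X ∉ᴸ C ∷ (merged ∷ F₁) ++ F₂ → X ≡ A
    onlyA X (here eq) X∉ = contradiction (here eq) X∉
    onlyA X (there (here eq)) X∉ = eq
    onlyA X (there (there p)) X∉ = contradiction (there (there ([ ∈-++⁺ˡ , ∈-++⁺ʳ F₁ ]′ (to (ext X) p)))) X∉

    onlyB : ∀ X → X ∈ᴸ C ∷ (merged ∷ F₁) ++ F₂ → X ∉ᴸ C ∷ (A ∷ F) ++ F′ → X ≡ merged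
    onlyB X (here eq) X∉ = contradiction (here eq) X∉
    onlyB X (there (here eq)) X∉ = eq
    onlyB X (there (there p)) X∉ = contradiction (there (there (from (ext X) (∈-++⁻ F₁ p)))) X∉

  components-resp-↭ : ∀ {S Cs Ds} → Cs ↭ Ds → IsComponents G S Cs → IsComponents G S Ds
  components-resp-↭ p (ne , conn , sep , cover) = Permₚ.All-resp-↭ p ne , Permₚ.All-resp-↭ p conn ,
    AllPairs-resp-↭ separated-sym p sep ,
    λ x → mk⇔ (λ x∈ → Permₚ.Any-resp-↭ p (to (cover x) x∈)) (λ q → from (cover x) (Permₚ.Any-resp-↭ (↭-sym p) q))

  -- Recursion brings v to the top of its child A within the size of A, and one rotation then
  -- exchanges it with the root. As A misses the root, the extra rotation fits into the size of C.
  -- The number m bounds the recursion.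
  lift-root : ∀ m {C T v} → ∣ C ∣ ≤ m → Tree G C T → v ∈ C → ∃[ T′ ] (RootedAt v C T′ × Within (Tree G C) ∣ C ∣ T T′)
  lift-root zero {C} ∣C∣≤0 t v∈C = contradiction (ℕₚ.≤-trans (x∈p⇒∣p-x∣<∣p∣ v∈C) ∣C∣≤0) λ ()
  lift-root (suc m) {C} {_} {v} ∣C∣≤ t@(node {r = r} {Cs} {F} r∈C comps f) v∈C with v Fin.≟ r
  ... | yes refl = C ∷ F , (Cs , F , comps , f , refl) , done same-refl
  ... | no v≢r with find (to (proj₂ (proj₂ (proj₂ comps)) v) (∈-minus⁺ v∈C v≢r))
  ... | A , A∈Cs , v∈A with ∈-∃++ A∈Cs
  ... | xs , ys , refl with components-resp-↭ (Permₚ.shift A xs ys) comps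
  ... | comps₁@(_ , _ , sA ∷ _ , _) with realign comps₁ comps f
  ... | _ , (_∷_ {T = U} {F′} u f′) , F≈ with lift-root m (ℕₚ.≤-pred (ℕₚ.≤-trans ∣A∣<∣C∣ ∣C∣≤)) u v∈A
    where
    ∣A∣<∣C∣ : ∣ A ∣ < ∣ C ∣
    ∣A∣<∣C∣ = ℕₚ.≤-<-trans (p⊆q⇒∣p∣≤∣q∣ (All.lookup (components-⊆ comps) A∈Cs)) (x∈p⇒∣p-x∣<∣p∣ r∈C)
  ... | _ , (Ds , F₁ , comps₂ , f₁ , refl) , w with rotate-root r∈C v∈A comps₁ comps₂ f₁ f′
  ... | T′ , rooted , rot = T′ , rooted , within-mono ∣A∣<∣C∣
      (subst (λ k → Within (Tree G C) k (C ∷ F) T′) (ℕₚ.+-comm ∣ A ∣ 1)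
        (within-respˡ (extends-same (extends-∷ C) (extends-∷ C) F≈)
          (within-trans (within-node r∈C comps₁ (u ∷ f′) (within-headᶠ sA u f′ w)) (flip (rooted⇒tree v∈C rooted) rot (done same-refl)))))
    where
    ∣A∣<∣C∣ : suc ∣ A ∣ ≤ ∣ C ∣
    ∣A∣<∣C∣ = ℕₚ.≤-<-trans (p⊆q⇒∣p∣≤∣q∣ (All.lookup (components-⊆ comps) A∈Cs)) (x∈p⇒∣p-x∣<∣p∣ r∈C)

-- Balanced separators from interval representations

subsetOf : ∀ {n} {P : Fin n → Set} → Decidable P → Subset n
subsetOf P? = Data.Vec.tabulate (λ x → Dec.does (P? x))

∈-subsetOf : ∀ {n} {P : Fin n → Set} (P? : Decidable P) {x} → x ∈ subsetOf P? ⇔ P x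
∈-subsetOf P? {x} = mk⇔ (λ x∈ → read (P? x) (trans (≡-sym (Vecₚ.lookup∘tabulate _ x)) (Vecₚ.[]=⇒lookup x∈)))
  (λ p → Vecₚ.lookup⇒[]= x _ (trans (Vecₚ.lookup∘tabulate _ x) (write (P? x) p)))
  where
  read : ∀ {A : Set} (d : Dec A) → Dec.does d ≡ true → A
  read (yes a) _ = a
  write : ∀ {A : Set} (d : Dec A) → A → Dec.does d ≡ true
  write (yes _) _ = refl
  write (no na) a = contradiction a na

bounded : ∀ {n} (f : Fin n → ℕ) → ∃[ M ] (∀ x → f x < M)
bounded {zero} f = 0 , λ ()
bounded {suc n} f = let (M , <M) = bounded (f ∘ Fin.suc) in suc (f Fin.zero) + M , λ
  { Fin.zero → ℕₚ.m≤m+n (suc (f Fin.zero)) M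
  ; (Fin.suc x) → ℕₚ.<-≤-trans (<M x) (ℕₚ.m≤n+m M (suc (f Fin.zero))) }

AllPairs-members : ∀ {A : Set} {P : A → Set} {R : A → A → Set} → (∀ {x y} → P x → P y → x ≢ y → R x y) →
  ∀ {xs} → All P xs → Unique xs → AllPairs R xs
AllPairs-members h [] [] = []
AllPairs-members h (p ∷ ps) (x∉ ∷ un) = All.zipWith (λ (q , ne) → h p q ne) (ps , x∉) ∷ AllPairs-members h ps un

module Upper {n : ℕ} (G : Graph n) where
  open Search G
  open Flips G
  open Lifting G

  Diameter≤ : ℕ → Subset n → Set
  Diameter≤ b C = ∀ {T U} → Tree G C T → Tree G C U → Within (Tree G C) b T U

  Small : ℕ → List (Fin n) → Subset n → Set
  Small m S C = ∀ {D} → ConnectedOn G D → D ⊆ C → (∀ {x} → x ∈ᴸ S → x ∉ D) → ∣ D ∣ < m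

  -- Removing the separator S vertex by vertex costs 2∣C∣ rotations each: lift the vertex to the root of both trees.
  diameter-separator : ∀ {b m} → (∀ {D} → ConnectedOn G D → ∣ D ∣ < m → Diameter≤ (b * ∣ D ∣) D) →
    ∀ S {C} → ConnectedOn G C → Small m S C → Diameter≤ ((2 * length S + b) * ∣ C ∣) C
  diameter-separator H [] conn small = H conn (small conn id λ ())
  diameter-separator {b} {m} H (v ∷ S) {C} conn small {T} {U} t u = split (v ∈? C)
    where
    c = 2 * length S + b
    bound : c + 2 ≡ 2 * length (v ∷ S) + b
    bound = solve 2 (λ l b → con 2 :* l :+ b :+ con 2 := con 2 :* (con 1 :+ l) :+ b) refl (length S) b
    split : Dec (v ∈ C) → Within (Tree G C) ((2 * length (v ∷ S) + b) * ∣ C ∣) T U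
    -- S stays fixed while C breaks up, so v may have ended in another piece; it is then skipped.
    split (no v∉C) = within-mono (ℕₚ.*-monoˡ-≤ ∣ C ∣ (subst (c ≤_) bound (ℕₚ.m≤m+n c 2)))
      (diameter-separator {b} {m} H S conn (λ connD D⊆C av → small connD D⊆C λ { (here refl) x∈D → v∉C (D⊆C x∈D) ; (there p) → av p }) t u)
    split (yes v∈C) with lift-root ∣ C ∣ ℕₚ.≤-refl t v∈C | lift-root ∣ C ∣ ℕₚ.≤-refl u v∈C
    ... | _ , (Cs , F , comps@(_ , conns , sep , _) , f , refl) , w | _ , (Cs′ , F′ , comps′ , f′ , refl) , w′
      with realign comps comps′ f′
    ... | F″ , f″ , F′≈F″ = within-mono (ℕₚ.≤-trans (ℕₚ.+-monoʳ-≤ ∣ C ∣ (ℕₚ.+-monoˡ-≤ ∣ C ∣ (ℕₚ.*-monoʳ-≤ c total≤∣C∣))) (ℕₚ.≤-reflexive count))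
      (within-trans w (within-trans
        (within-node v∈C comps f (within-forest {c} sep
          (λ D∈ → diameter-separator {b} {m} H S (All.lookup conns D∈) (small′ D∈)) f f″))
        (within-respˡ (extends-same (extends-∷ C) (extends-∷ C) (same-sym F′≈F″)) (within-sym u w′))))
      where
      total≤∣C∣ : total Cs ≤ ∣ C ∣
      total≤∣C∣ = ℕₚ.≤-trans (total≤ sep (components-⊆ comps)) (∣p─q∣≤∣p∣ C ⁅ v ⁆)
      count : ∣ C ∣ + (c * ∣ C ∣ + ∣ C ∣) ≡ (2 * length (v ∷ S) + b) * ∣ C ∣
      count = trans (solve 2 (λ c x → x :+ (c :* x :+ x) := (c :+ con 2) :* x) refl c ∣ C ∣) (cong (_* ∣ C ∣) bound)
      small′ : ∀ {D} → D ∈ᴸ Cs → Small m S D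
      small′ D∈ connE E⊆D av = small connE (λ x∈ → proj₁ (∈-minus⁻ (⊆D (E⊆D x∈))))
        λ { (here refl) x∈E → proj₂ (∈-minus⁻ (⊆D (E⊆D x∈E))) refl ; (there p) → av p }
        where ⊆D = All.lookup (components-⊆ comps) D∈

  module _ (I : Intervals n) (super : IsSupergraph G I) {w : ℕ} (cliques : CliqueNumber≤ I w) where

    meets? : ∀ x → Decidable (λ v → lo I v ≤ x × x ≤ hi I v)
    meets? x v = (lo I v ≤? x) ×-dec (x ≤? hi I v)

    bag : ℕ → List (Fin n)
    bag x = filter (meets? x) (allFin n)

    bag-clique : ∀ x → length (bag x) ≤ w
    bag-clique x = cliques (bag x) (unique , AllPairs-members
        (λ (l , h) (l′ , h′) ne → ne , ℕₚ.≤-trans l h′ , ℕₚ.≤-trans l′ h)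
        (All.tabulate (λ v∈ → proj₂ (∈-filter⁻ (meets? x) {xs = allFin n} v∈))) unique)
      where
      unique : Unique (bag x)
      unique = Uniqueₚ.filter⁺ (meets? x) (Uniqueₚ.allFin⁺ n)

    below? : ∀ C x → Decidable (λ v → v ∈ C × hi I v < x)
    below? C x v = (v ∈? C) ×-dec (hi I v <? x)

    above? : ∀ C x → Decidable (λ v → v ∈ C × x < lo I v)
    above? C x v = (v ∈? C) ×-dec (x <? lo I v)

    below above : Subset n → ℕ → Subset n
    below C x = subsetOf (below? C x)
    above C x = subsetOf (above? C x)

    -- Consecutive vertices have intersecting intervals, and the intervals of vertices in D miss the
    -- point x, so no step can change sides.
    side : ∀ {D x y z} → WalkIn G D y z → (∀ {s} → s ∈ᴸ bag x → s ∉ D) →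
      (hi I y < x → hi I z < x) × (x < lo I y → x < lo I z)
    side (here _) _ = id , id
    side {D} {x} {y} {z} (step {z = y′} _ e w) av = (λ y<x → proj₁ rec (crossˡ y<x)) , (λ x<y → proj₂ rec (crossʳ x<y))
      where
      rec = side w av
      y′∉ : ¬ (lo I y′ ≤ x × x ≤ hi I y′)
      y′∉ m = av (∈-filter⁺ (meets? x) (∈-allFin y′) m) (walk-start w)
      iadj = super y y′ e
      crossˡ : hi I y < x → hi I y′ < x
      crossˡ y<x with hi I y′ <? x
      ... | yes p = p
      ... | no np = contradiction (ℕₚ.<⇒≤ (ℕₚ.≤-<-trans (proj₂ (proj₂ iadj)) y<x) , ℕₚ.≮⇒≥ np) y′∉
      crossʳ : x < lo I y → x < lo I y′
      crossʳ x<y with x <? lo I y′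
      ... | yes p = p
      ... | no np = contradiction (ℕₚ.≮⇒≥ np , ℕₚ.<⇒≤ (ℕₚ.<-≤-trans x<y (proj₁ (proj₂ iadj)))) y′∉

    bag-small : ∀ {C x m} → 0 < m → ∣ below C x ∣ < m → ∣ above C x ∣ < m → Small m (bag x) C
    bag-small {C} {x} {m} 0<m b< a< {D} conn D⊆C av with nonempty? D
    ... | no empty = subst (_< m) (≡-sym (trans (cong ∣_∣ (Empty-unique empty)) (∣⊥∣≡0 n))) 0<m
    ... | yes (d , d∈D) with hi I d <? x
    ... | yes d<x = ℕₚ.≤-<-trans (p⊆q⇒∣p∣≤∣q∣ (λ {y} y∈D → from (∈-subsetOf (below? C x)) (D⊆C y∈D , proj₁ (side (conn d y d∈D y∈D) av) d<x))) b<
    ... | no d≮x with x <? lo I d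
    ... | yes x<d = ℕₚ.≤-<-trans (p⊆q⇒∣p∣≤∣q∣ (λ {y} y∈D → from (∈-subsetOf (above? C x)) (D⊆C y∈D , proj₂ (side (conn d y d∈D y∈D) av) x<d))) a<
    ... | no x≮d = ⊥-elim (av (∈-filter⁺ (meets? x) (∈-allFin d) (ℕₚ.≮⇒≥ x≮d , ℕₚ.≮⇒≥ d≮x)) d∈D)

    -- A discrete intermediate value argument: scan x upwards until the intervals of C ending before
    -- x number at least m. The guard 0 < m takes care of m = 0, where the threshold is met from the
    -- start.
    balance : ∀ C m M → ∣ below C M ∣ < m ⊎ ∃[ x ] (m ≤ ∣ below C (suc x) ∣ × (0 < m → ∣ below C x ∣ < m))
    balance C m zero with 0 <? m
    ... | yes 0<m = inj₁ (subst (_< m) (≡-sym (trans (cong ∣_∣ (Empty-unique (λ (v , v∈) → ℕₚ.n≮0 (proj₂ (to (∈-subsetOf (below? C 0)) v∈))))) (∣⊥∣≡0 n))) 0<m)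
    ... | no 0≮m = inj₂ (0 , ℕₚ.≤-trans (ℕₚ.≮⇒≥ 0≮m) z≤n , λ 0<m → contradiction 0<m 0≮m)
    balance C m (suc M) with balance C m M | ∣ below C (suc M) ∣ <? m
    ... | inj₂ found | _ = inj₂ found
    ... | inj₁ _ | yes p = inj₁ p
    ... | inj₁ b< | no np = inj₂ (M , ℕₚ.≮⇒≥ np , λ _ → b<)

    -- At the crossing point, fewer than m vertices end before x. At least m end no later than x and
    -- are disjoint from those starting after x, which leaves fewer than m of the latter. Without a
    -- crossing, C itself is small.
    separator : ∀ C m → 0 < m → ∣ C ∣ < m + m → ∃[ x ] Small m (bag x) C
    separator C m 0<m ∣C∣< with bounded (hi I)
    ... | M , <M with balance C m M
    ... | inj₁ b< = M , λ _ D⊆C _ → ℕₚ.≤-<-trans (p⊆q⇒∣p∣≤∣q∣ (λ {y} y∈D → from (∈-subsetOf (below? C M)) (D⊆C y∈D , <M y))) b<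
    ... | inj₂ (x , m≤ , b<) = x , bag-small 0<m (b< 0<m) (ℕₚ.+-cancelˡ-< m _ _ (ℕₚ.≤-<-trans
        (ℕₚ.≤-trans (ℕₚ.+-monoˡ-≤ ∣ above C x ∣ m≤) (disjoint-card
          (λ v∈ → proj₁ (to (∈-subsetOf (below? C (suc x))) v∈)) (λ v∈ → proj₁ (to (∈-subsetOf (above? C x)) v∈))
          λ {v} v∈ v∈′ → ℕₚ.<⇒≱ (proj₂ (to (∈-subsetOf (above? C x)) v∈′))
            (ℕₚ.≤-trans (lo≤hi I v) (ℕₚ.≤-pred (proj₂ (to (∈-subsetOf (below? C (suc x))) v∈)))))) ∣C∣<))

    diameter-log : ∀ k {C} → ConnectedOn G C → ∣ C ∣ < 2 ^ k → Diameter≤ (2 * w * k * ∣ C ∣) C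
    diameter-log zero {C} _ ∣C∣<1 t _ = ⊥-elim (ℕₚ.n≮0 (ℕₚ.<-≤-trans (x∈p⇒∣p-x∣<∣p∣ (proj₂ (tree-nonempty t))) (ℕₚ.≤-pred ∣C∣<1)))
    diameter-log (suc k) {C} conn ∣C∣< t u with separator C (2 ^ k) (ℕₚ.m^n>0 2 k) (subst (∣ C ∣ <_) (double (2 ^ k)) ∣C∣<)
    ... | x , small = within-mono (ℕₚ.*-monoˡ-≤ ∣ C ∣ (ℕₚ.≤-trans
            (ℕₚ.+-monoˡ-≤ (2 * w * k) (ℕₚ.*-monoʳ-≤ 2 (bag-clique x)))
            (ℕₚ.≤-reflexive (≡-sym (ℕₚ.*-suc (2 * w) k)))))
          (diameter-separator {2 * w * k} {2 ^ k} (λ connD ∣D∣< → diameter-log k connD ∣D∣<) (bag x) conn small t u)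

-- Existence of the maximum

module Enumeration {n : ℕ} (G : Graph n) where
  open Search G
  open Flips G
  open Lifting G

  -- Vertices are added back one at a time, each merging the components that it touches.
  components-exist : ∀ m S → ∣ S ∣ ≤ m → ∃[ Cs ] IsComponents G S Cs
  components-exist m S ∣S∣≤ with nonempty? S
  ... | no empty = [] , [] , [] , [] , λ x → mk⇔ (λ x∈ → contradiction (x , x∈) empty) λ ()
  components-exist zero S ∣S∣≤ | yes (u , u∈S) = ⊥-elim (ℕₚ.n≮0 (ℕₚ.<-≤-trans (x∈p⇒∣p-x∣<∣p∣ u∈S) ∣S∣≤))
  components-exist (suc m) S ∣S∣≤ | yes (u , u∈S)
    with components-exist m (S minus u) (ℕₚ.≤-pred (ℕₚ.≤-trans (x∈p⇒∣p-x∣<∣p∣ u∈S) ∣S∣≤))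
  ... | Cs , comps = _ , Merge.components comps (λ u∈ → proj₂ (∈-minus⁻ u∈) refl) grow
    where
    grow : ∀ x → x ∈ S ⇔ (x ≡ u ⊎ x ∈ S minus u)
    grow x = mk⇔ (λ x∈ → split x∈ (x Fin.≟ u)) [ (λ { refl → u∈S }) , proj₁ ∘ ∈-minus⁻ ]′
      where
      split : x ∈ S → Dec (x ≡ u) → x ≡ u ⊎ x ∈ S minus u
      split _  (yes eq) = inj₁ eq
      split x∈ (no ne)  = inj₂ (∈-minus⁺ x∈ ne)

  componentsOf : Subset n → Family
  componentsOf S = proj₁ (components-exist ∣ S ∣ S ℕₚ.≤-refl)

  componentsOf-spec : ∀ S → IsComponents G S (componentsOf S)
  componentsOf-spec S = proj₂ (components-exist ∣ S ∣ S ℕₚ.≤-refl)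

  -- Walks are unbounded in length, so the decision goes through membership in the computed
  -- component of x.
  walk? : ∀ C x y → Dec (WalkIn G C x y)
  walk? C x y with x ∈? C
  ... | no x∉ = no (x∉ ∘ walk-start)
  ... | yes x∈ with find (to (proj₂ (proj₂ (proj₂ (componentsOf-spec C))) x) x∈)
  ... | D , D∈ , x∈D = map′ (proj₁ (comp y)) (proj₂ (comp y)) (y ∈? D)
    where comp = components⇒component (componentsOf-spec C) D∈ x∈D

  connected? : Dec (Connected G)
  connected? = map′ (λ f x y _ _ → f x y) (λ f x y → f x y ∈⊤ ∈⊤) (Finₚ.all? λ x → Finₚ.all? λ y → walk? ⊤ x y)

  mutual
    trees : ℕ → Subset n → List Family
    trees zero    C = []
    trees (suc m) C = concatMap (λ r → map (C ∷_) (forests m (componentsOf (C minus r)))) (filter (_∈? C) (allFin n))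

    forests : ℕ → Family → List Family
    forests m []       = [] ∷ []
    forests m (D ∷ Ds) = cartesianProductWith _++_ (trees m D) (forests m Ds)

  mutual
    trees-sound : ∀ m {C T} → T ∈ᴸ trees m C → Tree G C T
    trees-sound (suc m) {C} T∈ with find (∈-concatMap⁻ (λ r → map (C ∷_) (forests m (componentsOf (C minus r)))) {xs = filter (_∈? C) (allFin n)} T∈)
    ... | r , r∈ , T∈′ with ∈-map⁻ (C ∷_) T∈′
    ... | F , F∈ , refl = node (proj₂ (∈-filter⁻ (_∈? C) {xs = allFin n} r∈)) (componentsOf-spec (C minus r)) (forests-sound m _ F∈)

    forests-sound : ∀ m Ds {F} → F ∈ᴸ forests m Ds → Forest G Ds F
    forests-sound m [] (here refl) = []
    forests-sound m (D ∷ Ds) F∈ with ∈-cartesianProductWith⁻ _++_ (trees m D) (forests m Ds) F∈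
    ... | T , F′ , T∈ , F′∈ , refl = trees-sound m T∈ ∷ forests-sound m Ds F′∈

  components-small : ∀ {m C r} → r ∈ C → ∣ C ∣ ≤ suc m → All (λ D → ∣ D ∣ ≤ m) (componentsOf (C minus r))
  components-small {C = C} {r} r∈C ∣C∣≤ = All.tabulate λ D∈ → ℕₚ.≤-pred (ℕₚ.≤-trans
    (ℕₚ.≤-<-trans (p⊆q⇒∣p∣≤∣q∣ (All.lookup (components-⊆ (componentsOf-spec (C minus r))) D∈)) (x∈p⇒∣p-x∣<∣p∣ r∈C)) ∣C∣≤)

  mutual
    trees-complete : ∀ m {C T} → ∣ C ∣ ≤ m → Tree G C T → ∃[ T′ ] (T′ ∈ᴸ trees m C × SameSet G T T′)
    trees-complete zero ∣C∣≤ (node r∈C _ _) = ⊥-elim (ℕₚ.n≮0 (ℕₚ.<-≤-trans (x∈p⇒∣p-x∣<∣p∣ r∈C) ∣C∣≤))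
    trees-complete (suc m) {C} ∣C∣≤ (node {r = r} r∈C comps f) with realign (componentsOf-spec (C minus r)) comps f
    ... | F′ , f′ , s with forests-complete m (components-small r∈C ∣C∣≤) f′
    ... | F″ , F″∈ , s′ = C ∷ F″ ,
      ∈-concatMap⁺ (λ r → map (C ∷_) (forests m (componentsOf (C minus r))))
        (lose (∈-filter⁺ (_∈? C) (∈-allFin r) r∈C) (∈-map⁺ (C ∷_) F″∈)) ,
      extends-same (extends-∷ C) (extends-∷ C) (same-trans s s′)

    forests-complete : ∀ m {Ds F} → All (λ D → ∣ D ∣ ≤ m) Ds → Forest G Ds F → ∃[ F′ ] (F′ ∈ᴸ forests m Ds × SameSet G F F′)
    forests-complete m _ [] = [] , here refl , same-refl
    forests-complete m {D ∷ Ds} (≤m ∷ ps) (_∷_ {T = T} {F} t f) with trees-complete m ≤m t | forests-complete m ps f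
    ... | T′ , T′∈ , s | F′ , F′∈ , s′ = T′ ++ F′ , ∈-cartesianProductWith⁺ _++_ T′∈ F′∈ ,
      same-trans (extends-same (extends-++ʳ F) (extends-++ʳ F) s) (extends-same (extends-++ˡ T′) (extends-++ˡ T′) s′)

  mutual
    tree-exists : ∀ m {C} → ∣ C ∣ ≤ m → Nonempty C → ∃ (Tree G C)
    tree-exists zero ∣C∣≤ (r , r∈C) = ⊥-elim (ℕₚ.n≮0 (ℕₚ.<-≤-trans (x∈p⇒∣p-x∣<∣p∣ r∈C) ∣C∣≤))
    tree-exists (suc m) {C} ∣C∣≤ (r , r∈C) =
      let comps = componentsOf-spec (C minus r)
          (F , f) = forest-exists m (All.zip (proj₁ comps , components-small r∈C ∣C∣≤))
      in C ∷ F , node r∈C comps f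

    forest-exists : ∀ m {Ds} → All (λ D → Nonempty D × ∣ D ∣ ≤ m) Ds → ∃ (Forest G Ds)
    forest-exists m [] = [] , []
    forest-exists m ((ne , ≤m) ∷ ps) = let (T , t) = tree-exists m ≤m ne ; (F , f) = forest-exists m ps in T ++ F , t ∷ f

  searchTrees : List Family
  searchTrees = trees n ⊤

  searchTrees-complete : ∀ {T} → SearchTree G T → ∃[ T′ ] (T′ ∈ᴸ searchTrees × SameSet G T T′)
  searchTrees-complete = trees-complete n (ℕₚ.≤-reflexive (∣⊤∣≡n n))

  sameSet? : ∀ T U → Dec (SameSet G T U)
  sameSet? T U = map′ (λ (p , q) X → mk⇔ (All.lookup p) (All.lookup q)) (λ s → All.tabulate (to (s _)) , All.tabulate (from (s _)))
    (All.all? (_∈ᴸ? U) T ×-dec All.all? (_∈ᴸ? T) U)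

  rotation? : ∀ T U → Dec (Rotation G T U)
  rotation? T U = map′ fwd bwd (Any.any? (λ A → Any.any? (λ B → ¬? (A ∈ᴸ? U) ×-dec ¬? (B ∈ᴸ? T) ×-dec
      All.all? (λ X → (X ∈ᴸ? U) ⊎-dec (X ≟ˢ A)) T ×-dec All.all? (λ X → (X ∈ᴸ? T) ⊎-dec (X ≟ˢ B)) U) U) T)
    where
    R : Subset n → Subset n → Set
    R A B = A ∉ᴸ U × B ∉ᴸ T × All (λ X → X ∈ᴸ U ⊎ X ≡ A) T × All (λ X → X ∈ᴸ T ⊎ X ≡ B) U
    fwd : Any (λ A → Any (R A) U) T → Rotation G T U
    fwd p with find p
    ... | A , A∈ , q with find q
    ... | B , B∈ , A∉ , B∉ , oA , oB = A , B , A∈ , A∉ , B∈ , B∉ ,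
      (λ X X∈ X∉ → [ (λ X∈U → contradiction X∈U X∉) , id ]′ (All.lookup oA X∈)) ,
      (λ X X∈ X∉ → [ (λ X∈T → contradiction X∈T X∉) , id ]′ (All.lookup oB X∈))
    decide : ∀ {T U A} → (∀ X → X ∈ᴸ T → X ∉ᴸ U → X ≡ A) → ∀ {X} → X ∈ᴸ T → Dec (X ∈ᴸ U) → X ∈ᴸ U ⊎ X ≡ A
    decide o X∈ (yes p) = inj₁ p
    decide o X∈ (no np) = inj₂ (o _ X∈ np)
    bwd : Rotation G T U → Any (λ A → Any (R A) U) T
    bwd (A , B , A∈ , A∉ , B∈ , B∉ , oA , oB) = lose A∈ (lose B∈ (A∉ , B∉ ,
      All.tabulate (λ {X} X∈ → decide oA X∈ (X ∈ᴸ? U)) , All.tabulate (λ {X} X∈ → decide oB X∈ (X ∈ᴸ? T))))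

  flipwalk-respˡ : ∀ {k T T′ U} → SameSet G T T′ → FlipWalk G k T′ U → FlipWalk G k T U
  flipwalk-respˡ s (done s′)    = done (same-trans s s′)
  flipwalk-respˡ s (flip u r w) = flip u (rotation-respˡ s r) w

  flipwalk-respʳ : ∀ {k T U U′} → SameSet G U U′ → FlipWalk G k T U → FlipWalk G k T U′
  flipwalk-respʳ s (done s′)    = done (same-trans s′ s)
  flipwalk-respʳ s (flip u r w) = flip u r (flipwalk-respʳ s w)

  -- Rotations respect equality of tube sets, so intermediate trees may be taken from the finite
  -- list of representatives.
  flipwalk? : ∀ k T U → Dec (FlipWalk G k T U)
  flipwalk? zero T U = map′ done (λ { (done s) → s }) (sameSet? T U)
  flipwalk? (suc k) T U = map′ fwd bwd (Any.any? (λ V → rotation? T V ×-dec flipwalk? k V U) searchTrees)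
    where
    fwd : Any (λ V → Rotation G T V × FlipWalk G k V U) searchTrees → FlipWalk G (suc k) T U
    fwd p = let (V , V∈ , r , w) = find p in flip (trees-sound n V∈) r w
    bwd : FlipWalk G (suc k) T U → Any (λ V → Rotation G T V × FlipWalk G k V U) searchTrees
    bwd (flip v r w) = let (V′ , V′∈ , s) = searchTrees-complete v in
      lose V′∈ (rotation-respʳ s r , flipwalk-respˡ (same-sym s) w)

least : ∀ {P : ℕ → Set} → Decidable P → ∀ j → P j → ∃[ k ] (P k × (∀ i → P i → k ≤ i))
least P? zero p = 0 , p , λ _ _ → z≤n
least P? (suc j) p with P? 0
... | yes p₀ = 0 , p₀ , λ _ _ → z≤n
... | no ¬p₀ = let (k , q , min) = least (P? ∘ suc) j p in
  suc k , q , λ { zero p₀ → contradiction p₀ ¬p₀ ; (suc i) p → s≤s (min i p) }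

Best : ∀ {A : Set} → (A → Set) → (A → ℕ → Set) → Set
Best P Q = ∃[ x ] ∃[ m ] (P x × Q x m)

-- A running maximum over a list. The initial record b makes it exist even if no entry satisfies P.
-- It serves both for distances of pairs of trees and for diameters of graphs.
best : ∀ {A : Set} {P : A → Set} {Q : A → ℕ → Set} → (∀ {x} → P x → ∃ (Q x)) → (∀ {x a b} → Q x a → Q x b → a ≤ b) →
  (b : Best P Q) → ∀ xs → All (Dec ∘ P) xs → ∃[ b′ ] (proj₁ (proj₂ b) ≤ proj₁ (proj₂ b′) ×
    All (λ x → P x → ∀ d → Q x d → d ≤ proj₁ (proj₂ {B = λ x → ∃[ m ] (P x × Q x m)} b′)) xs)
best total mono b [] [] = b , ℕₚ.≤-refl , []
best total mono b (x ∷ xs) (no ¬p ∷ ds) = let (b′ , b≤ , all) = best total mono b xs ds in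
  b′ , b≤ , (λ p → contradiction p ¬p) ∷ all
best total mono b@(_ , m , _) (x ∷ xs) (yes p ∷ ds) with total p
... | d , q with ℕₚ.≤-total d m
... | inj₁ d≤m = let (b′ , b≤ , all) = best total mono b xs ds in
  b′ , b≤ , (λ _ e q′ → ℕₚ.≤-trans (mono q′ q) (ℕₚ.≤-trans d≤m b≤)) ∷ all
... | inj₂ m≤d = let (b′ , b≤ , all) = best total mono (x , d , p , q) xs ds in
  b′ , ℕₚ.≤-trans m≤d b≤ , (λ _ e q′ → ℕₚ.≤-trans (mono q′ q) b≤) ∷ all

module Diameter {n : ℕ} (G : Graph (suc n)) where
  open Flips G
  open Enumeration G

  Dist : Family × Family → ℕ → Set
  Dist (T , U) d = FlipWalk G d T U × (∀ k → FlipWalk G k T U → d ≤ k)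

  Both : Family × Family → Set
  Both (T , U) = SearchTree G T × SearchTree G U

  dist-mono : ∀ {x a b} → Dist x a → Dist x b → a ≤ b
  dist-mono (_ , min) (w , _) = min _ w

  both? : ∀ {Ts} → (∀ {T} → T ∈ᴸ Ts → SearchTree G T) → All (Dec ∘ Both) (cartesianProduct Ts Ts)
  both? {Ts} sound = All.tabulate λ x∈ → let (T∈ , U∈) = ∈-cartesianProduct⁻ Ts Ts x∈ in yes (sound T∈ , sound U∈)

  diameter-from : (∀ {x} → Both x → ∃ (Dist x)) → ∀ {Ts} → (∀ {T} → T ∈ᴸ Ts → SearchTree G T) →
    (∀ {T} → SearchTree G T → ∃[ T′ ] (T′ ∈ᴸ Ts × SameSet G T T′)) →
    (b : Best Both Dist) →
    All (λ x → Both x → ∀ d → Dist x d → d ≤ proj₁ (proj₂ b)) (cartesianProduct Ts Ts) → ∃ (IsDiameter G)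
  diameter-from distance {Ts} sound complete ((T , U) , m , (t , u) , (w , min)) maximal =
    m , within , T , U , t , u , min
    where
    within : ∀ T U → SearchTree G T → SearchTree G U → ∃[ k ] (k ≤ m × FlipWalk G k T U)
    within T U t u =
      let (T′ , T′∈ , s) = complete t
          (U′ , U′∈ , s′) = complete u
          both = sound T′∈ , sound U′∈
          (d , q) = distance both
      in d , All.lookup maximal (∈-cartesianProduct⁺ T′∈ U′∈) both d q ,
         flipwalk-respˡ s (flipwalk-respʳ (same-sym s′) (proj₁ q))

  diameter-exists : ∀ {b} → (∀ {T U} → SearchTree G T → SearchTree G U → Within (Tree G ⊤) b T U) → ∃ (IsDiameter G)
  diameter-exists bound = pick (tree-exists (suc n) (ℕₚ.≤-reflexive (∣⊤∣≡n (suc n))) (Fin.zero , ∈⊤))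
    where
    distance : ∀ {x} → Both x → ∃ (Dist x)
    -- The upper bound provides some walk, which bounds the search for the shortest one.
    distance {T , U} (t , u) = let (j , _ , w) = within⇒flipwalk id (bound t u) in
      least {P = λ k → FlipWalk G k T U} (λ k → flipwalk? k T U) j w
    finish : (b : Best Both Dist) → ∃[ b′ ] (proj₁ (proj₂ b) ≤ proj₁ (proj₂ b′) ×
      All (λ x → Both x → ∀ d → Dist x d → d ≤ proj₁ (proj₂ b′)) (cartesianProduct searchTrees searchTrees)) → ∃ (IsDiameter G)
    finish _ (b′ , _ , maximal) = diameter-from distance (trees-sound (suc n)) searchTrees-complete b′ maximal
    pick : ∃ (SearchTree G) → ∃ (IsDiameter G)
    pick (T , t) = let (d , q) = distance (t , t) ; b = (T , T) , d , (t , t) , q in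
      finish b (best {P = Both} {Dist} distance (λ {x} → dist-mono {x}) b (cartesianProduct searchTrees searchTrees) (both? (trees-sound (suc n))))

-- Graphs are records of functions, so they can only be enumerated up to pointwise equality of adjacency.
module Transport {n : ℕ} {G H : Graph n} (eq : ∀ u v → adj G u v ≡ adj H u v) where

  walkᵗ : ∀ {C x y} → WalkIn G C x y → WalkIn H C x y
  walkᵗ (here p)     = here p
  walkᵗ (step p e w) = step p (trans (≡-sym (eq _ _)) e) (walkᵗ w)

  connectedᵗ : ∀ {C} → ConnectedOn G C → ConnectedOn H C
  connectedᵗ c x y p q = walkᵗ (c x y p q)

  componentsᵗ : ∀ {S Cs} → IsComponents G S Cs → IsComponents H S Cs
  componentsᵗ (ne , conn , sep , cover) = ne , All.map connectedᵗ conn ,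
    AllPairs.map (λ s x y p q → proj₁ (s x y p q) , trans (≡-sym (eq x y)) (proj₂ (s x y p q))) sep , cover

  mutual
    treeᵗ : ∀ {C T} → Tree G C T → Tree H C T
    treeᵗ (node r∈C comps f) = node r∈C (componentsᵗ comps) (forestᵗ f)

    forestᵗ : ∀ {Cs F} → Forest G Cs F → Forest H Cs F
    forestᵗ []      = []
    forestᵗ (t ∷ f) = treeᵗ t ∷ forestᵗ f

  flipwalkᵗ : ∀ {k T U} → FlipWalk G k T U → FlipWalk H k T U
  flipwalkᵗ (done s)     = done s
  flipwalkᵗ (flip t r w) = flip (treeᵗ t) r (flipwalkᵗ w)

  pathwidthᵗ : ∀ {k} → Pathwidth≤ G k → Pathwidth≤ H k
  pathwidthᵗ (I , super , cliques) = I , (λ u v e → super u v (trans (eq u v) e)) , cliques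

InFamily : ∀ {n} → Graph n → Set
InFamily G = Connected G × PathwidthTwo G

module _ {n : ℕ} {G H : Graph n} (eq : ∀ u v → adj G u v ≡ adj H u v) where
  private
    module To   = Transport {G = G} {H} eq
    module From = Transport {G = H} {G} (λ u v → ≡-sym (eq u v))

  diameter-transport : ∀ {d} → IsDiameter G d → IsDiameter H d
  diameter-transport (within , T , U , t , u , min) =
    (λ T U t u → let (k , k≤ , w) = within T U (From.treeᵗ t) (From.treeᵗ u) in k , k≤ , To.flipwalkᵗ w) ,
    T , U , To.treeᵗ t , To.treeᵗ u , λ k w → min k (From.flipwalkᵗ w)

  family-transport : InFamily G → InFamily H
  family-transport (conn , pw≤ , pw≰) = To.connectedᵗ conn , To.pathwidthᵗ pw≤ , pw≰ ∘ From.pathwidthᵗ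

-- Deciding pathwidth

vectors : ∀ {A : Set} → List A → ∀ m → List (Vec A m)
vectors xs zero    = []ᵛ ∷ []
vectors xs (suc m) = cartesianProductWith _∷ᵛ_ xs (vectors xs m)

vectors-complete : ∀ {A : Set} {xs : List A} → (∀ x → x ∈ᴸ xs) → ∀ {m} (v : Vec A m) → v ∈ᴸ vectors xs m
vectors-complete h []ᵛ      = here refl
vectors-complete h (x ∷ᵛ v) = ∈-cartesianProductWith⁺ _∷ᵛ_ (h x) (vectors-complete h v)

any-complete? : ∀ {A : Set} {P : A → Set} {xs : List A} → (∀ x → x ∈ᴸ xs) → Decidable P → Dec (∃ P)
any-complete? {xs = xs} h P? = map′ (λ p → let (x , _ , px) = find p in x , px) (λ (x , px) → lose (h x) px) (Any.any? P? xs)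

module Pathwidth {n : ℕ} (G : Graph n) where

  iadj? : ∀ (I : Intervals n) u v → Dec (IAdj I u v)
  iadj? I u v = ¬? (u Fin.≟ v) ×-dec (lo I u ≤? hi I v) ×-dec (lo I v ≤? hi I u)

  clique? : ∀ (I : Intervals n) K → Dec (IsClique I K)
  clique? I K = AllPairs.allPairs? (λ u v → ¬? (u Fin.≟ v)) K ×-dec AllPairs.allPairs? (iadj? I) K

  prefix : ∀ {A : Set} m (K : List A) → m ≤ length K → ∃[ v ] Data.Vec.toList {n = m} v ≡ take m K
  prefix zero    K       _       = []ᵛ , refl
  prefix (suc m) (x ∷ K) (s≤s p) = let (v , eq) = prefix m K p in x ∷ᵛ v , cong (x ∷_) eq

  -- A clique with more than w vertices can be truncated to w + 1 of them, and there are finitely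
  -- many vectors of that length.
  cliqueNumber? : ∀ (I : Intervals n) w → Dec (CliqueNumber≤ I w)
  cliqueNumber? I w = map′ fwd bwd (¬? (any-complete? {P = Big} (vectors-complete ∈-allFin) (λ v → clique? I (Data.Vec.toList v))))
    where
    Big : Vec (Fin n) (suc w) → Set
    Big v = IsClique I (Data.Vec.toList v)
    fwd : ¬ ∃ Big → CliqueNumber≤ I w
    fwd none K (un , cl) with length K ≤? w
    ... | yes p = p
    ... | no K≰w = let (v , eq) = prefix (suc w) K (ℕₚ.≰⇒> K≰w) in
      contradiction (v , subst (IsClique I) (≡-sym eq) (Uniqueₚ.take⁺ (suc w) un , AllPairsₚ.take⁺ (suc w) cl)) none
    bwd : CliqueNumber≤ I w → ¬ ∃ Big
    bwd c (v , cl) = ℕₚ.n≮n w (subst (_≤ w) (Vecₚ.length-toList v) (c (Data.Vec.toList v) cl))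

  supergraph? : ∀ (I : Intervals n) → Dec (IsSupergraph G I)
  supergraph? I = Finₚ.all? λ u → Finₚ.all? λ v → (adj G u v Boolₚ.≟ true) →-dec iadj? I u v

  Endpoints : Set
  Endpoints = Vec (Fin (suc n)) n

  at : Endpoints → Fin n → ℕ
  at ls v = toℕ (Data.Vec.lookup ls v)

  Ordered : Endpoints × Endpoints → Set
  Ordered (ls , hs) = ∀ v → at ls v ≤ at hs v

  intervals : (e : Endpoints × Endpoints) → Ordered e → Intervals n
  intervals (ls , hs) p = record { lo = at ls ; hi = at hs ; lo≤hi = p }

  Represents : ℕ → Endpoints × Endpoints → Set
  Represents k e = Σ (Ordered e) λ p → IsSupergraph G (intervals e p) × CliqueNumber≤ (intervals e p) (suc k)

  represents? : ∀ k → Decidable (Represents k)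
  represents? k e with Finₚ.all? (λ v → at (proj₁ e) v ≤? at (proj₂ e) v)
  ... | no np = no (np ∘ proj₁)
  ... | yes p = map′ (p ,_) proj₂ (supergraph? (intervals e p) ×-dec cliqueNumber? (intervals e p) (suc k))

  -- Only the order of the endpoints matters, so each is replaced by the number of left endpoints up to it.
  module _ (I : Intervals n) where

    upto? : ∀ x → Decidable (λ v → lo I v ≤ x)
    upto? x v = lo I v ≤? x

    rank : ℕ → Fin (suc n)
    rank x = Fin.fromℕ< (s≤s (∣p∣≤n (subsetOf (upto? x))))

    rank≡ : ∀ x → toℕ (rank x) ≡ ∣ subsetOf (upto? x) ∣
    rank≡ x = Finₚ.toℕ-fromℕ< _

    rank-mono : ∀ {x y} → x ≤ y → toℕ (rank x) ≤ toℕ (rank y)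
    rank-mono {x} {y} x≤y = subst₂ _≤_ (≡-sym (rank≡ x)) (≡-sym (rank≡ y))
      (p⊆q⇒∣p∣≤∣q∣ (λ v∈ → from (∈-subsetOf (upto? y)) (ℕₚ.≤-trans (to (∈-subsetOf (upto? x)) v∈) x≤y)))

    rank-strict : ∀ {x} v → x < lo I v → toℕ (rank x) < toℕ (rank (lo I v))
    rank-strict {x} v x<v = subst₂ _<_ (≡-sym (rank≡ x)) (≡-sym (rank≡ (lo I v)))
      (p⊂q⇒∣p∣<∣q∣ ((λ u∈ → from (∈-subsetOf (upto? (lo I v))) (ℕₚ.≤-trans (to (∈-subsetOf (upto? x)) u∈) (ℕₚ.<⇒≤ x<v))) ,
        v , from (∈-subsetOf (upto? (lo I v))) ℕₚ.≤-refl , λ v∈ → ℕₚ.<⇒≱ x<v (to (∈-subsetOf (upto? x)) v∈)))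

    -- If x < `lo I v`, then v itself is counted at `lo I v` but not at x. `IAdj` compares left
    -- endpoints with right ones, so this direction of reflection is enough to keep adjacency.
    rank-reflects : ∀ {v x} → toℕ (rank (lo I v)) ≤ toℕ (rank x) → lo I v ≤ x
    rank-reflects {v} {x} p with lo I v ≤? x
    ... | yes q = q
    ... | no nq = contradiction p (ℕₚ.<⇒≱ (rank-strict v (ℕₚ.≰⇒> nq)))

    endpoints : Endpoints × Endpoints
    endpoints = Data.Vec.tabulate (rank ∘ lo I) , Data.Vec.tabulate (rank ∘ hi I)

    at-tabulate : ∀ (f : Fin n → Fin (suc n)) v → at (Data.Vec.tabulate f) v ≡ toℕ (f v)
    at-tabulate f v = cong toℕ (Vecₚ.lookup∘tabulate f v)

    compress : ∀ {k} → IsSupergraph G I → CliqueNumber≤ I (suc k) → Represents k endpoints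
    compress super cliques = ordered , (λ u v e → fwd (super u v e)) , λ K (un , cl) → cliques K (un , AllPairs.map bwd cl)
      where
      ordered : Ordered endpoints
      ordered v = subst₂ _≤_ (≡-sym (at-tabulate (rank ∘ lo I) v)) (≡-sym (at-tabulate (rank ∘ hi I) v)) (rank-mono (lo≤hi I v))
      ≤⁺ : ∀ {u v} → lo I u ≤ hi I v → at (proj₁ endpoints) u ≤ at (proj₂ endpoints) v
      ≤⁺ {u} {v} p = subst₂ _≤_ (≡-sym (at-tabulate (rank ∘ lo I) u)) (≡-sym (at-tabulate (rank ∘ hi I) v)) (rank-mono p)
      ≤⁻ : ∀ {u v} → at (proj₁ endpoints) u ≤ at (proj₂ endpoints) v → lo I u ≤ hi I v
      ≤⁻ {u} {v} p = rank-reflects (subst₂ _≤_ (at-tabulate (rank ∘ lo I) u) (at-tabulate (rank ∘ hi I) v) p)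
      fwd : ∀ {u v} → IAdj I u v → IAdj (intervals endpoints ordered) u v
      fwd (ne , p , q) = ne , ≤⁺ p , ≤⁺ q
      bwd : ∀ {u v} → IAdj (intervals endpoints ordered) u v → IAdj I u v
      bwd (ne , p , q) = ne , ≤⁻ p , ≤⁻ q

  pathwidth≤? : ∀ k → Dec (Pathwidth≤ G k)
  pathwidth≤? k = map′ (λ (e , p , super , cliques) → intervals e p , super , cliques)
    (λ (I , super , cliques) → endpoints I , compress I super cliques)
    (any-complete? {P = Represents k} (λ (ls , hs) → ∈-cartesianProduct⁺ (vectors-complete ∈-allFin ls) (vectors-complete ∈-allFin hs)) (represents? k))

  inFamily? : Dec (InFamily G)
  inFamily? = Enumeration.connected? G ×-dec pathwidth≤? 2 ×-dec ¬? (pathwidth≤? 1)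

-- Enumerating graphs and maximizing the diameter

Matrix : ℕ → Set
Matrix n = Vec (Vec Bool n) n

entry : ∀ {n} → Matrix n → Fin n → Fin n → Bool
entry M u v = Data.Vec.lookup (Data.Vec.lookup M u) v

-- Reading only entries above the diagonal lets every matrix decode to a symmetric irreflexive
-- relation.
upper : ∀ {n} → Matrix n → Fin n → Fin n → Bool
upper M u v with Finₚ.<-cmp u v
... | tri< _ _ _ = entry M u v
... | tri≈ _ _ _ = false
... | tri> _ _ _ = entry M v u

decode : ∀ {n} → Matrix n → Graph n
decode {n} M = record { adj = upper M ; sym = symmetric ; irrefl = irreflexive }
  where
  symmetric : ∀ u v → upper M u v ≡ upper M v u
  symmetric u v with Finₚ.<-cmp u v | Finₚ.<-cmp v u
  ... | tri< _ _ _   | tri> _ _ _   = refl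
  ... | tri> _ _ _   | tri< _ _ _   = refl
  ... | tri≈ _ _ _   | tri≈ _ _ _   = refl
  ... | tri< a _ _   | tri< b _ _   = contradiction b (ℕₚ.<-asym a)
  ... | tri> _ _ a   | tri> _ _ b   = contradiction b (ℕₚ.<-asym a)
  ... | tri≈ _ e _   | tri< _ ne _  = contradiction (≡-sym e) ne
  ... | tri≈ _ e _   | tri> _ ne _  = contradiction (≡-sym e) ne
  ... | tri< _ ne _  | tri≈ _ e _   = contradiction (≡-sym e) ne
  ... | tri> _ ne _  | tri≈ _ e _   = contradiction (≡-sym e) ne
  irreflexive : ∀ v → upper M v v ≡ false
  irreflexive v with Finₚ.<-cmp v v
  ... | tri< a _ _ = contradiction a (ℕₚ.n≮n (toℕ v))
  ... | tri≈ _ _ _ = refl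
  ... | tri> _ _ a = contradiction a (ℕₚ.n≮n (toℕ v))

encode : ∀ {n} → Graph n → Matrix n
encode G = Data.Vec.tabulate λ u → Data.Vec.tabulate (adj G u)

entry-encode : ∀ {n} (G : Graph n) u v → entry (encode G) u v ≡ adj G u v
entry-encode G u v = trans (cong (λ r → Data.Vec.lookup r v) (Vecₚ.lookup∘tabulate _ u)) (Vecₚ.lookup∘tabulate (adj G u) v)

decode-encode : ∀ {n} (G : Graph n) u v → adj G u v ≡ adj (decode (encode G)) u v
decode-encode G u v with Finₚ.<-cmp u v
... | tri< _ _ _    = ≡-sym (entry-encode G u v)
... | tri≈ _ refl _ = irrefl G u
... | tri> _ _ _    = trans (sym G u v) (≡-sym (entry-encode G v u))

matrices : ∀ n → List (Matrix n)
matrices n = vectors (vectors (false ∷ true ∷ []) n) n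

matrices-complete : ∀ {n} (M : Matrix n) → M ∈ᴸ matrices n
matrices-complete = vectors-complete (vectors-complete λ { false → here refl ; true → there (here refl) })

diameter-unique : ∀ {n} {G : Graph n} {a b} → IsDiameter G a → IsDiameter G b → a ≤ b
diameter-unique (_ , T , U , t , u , min) (within , _) = let (k , k≤ , w) = within T U t u in ℕₚ.≤-trans (min k w) k≤

-- Each of the k halvings lifts up to 3 bag vertices in each of 2 trees, at most n rotations per
-- lift.
log-bound : ℕ → ℕ → ℕ
log-bound n k = 2 * 3 * k * n

module _ {n k : ℕ} (n<2^k : suc n < 2 ^ k) where

  family-within : ∀ {G : Graph (suc n)} → InFamily G → ∀ {T U} → SearchTree G T → SearchTree G U →
    Flips.Within G (Tree G ⊤) (log-bound (suc n) k) T U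
  family-within {G} (conn , (I , super , cliques) , _) {T} {U} t u =
    subst (λ c → Flips.Within G (Tree G ⊤) (log-bound c k) T U) (∣⊤∣≡n (suc n))
      (Upper.diameter-log G I super cliques k conn (subst (_< 2 ^ k) (≡-sym (∣⊤∣≡n (suc n))) n<2^k) t u)

  family-diameter : ∀ {G : Graph (suc n)} → InFamily G → ∃ (IsDiameter G)
  family-diameter {G} fam = Diameter.diameter-exists G (family-within fam)

  diameter≤log : ∀ {G : Graph (suc n)} {d} → InFamily G → IsDiameter G d → d ≤ log-bound (suc n) k
  diameter≤log {G} fam (_ , T , U , t , u , min) =
    let (j , j≤ , w) = Flips.within⇒flipwalk G id (family-within fam t u) in ℕₚ.≤-trans (min j w) j≤

  -- G₀ shows that the family is nonempty and starts the search; that every member has a diameter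
  -- comes from the upper bound.
  maximum-exists : ∀ {G₀ : Graph (suc n)} → InFamily G₀ → ∃[ m ] (IsMaxDiam (suc n) m × m ≤ log-bound (suc n) k)
  maximum-exists {G₀} fam₀ = finish (family-diameter fam₀)
    where
    P : Matrix (suc n) → Set
    P M = InFamily (decode M)
    Q : Matrix (suc n) → ℕ → Set
    Q M = IsDiameter (decode M)
    maximal⇒ : (b : Best P Q) → All (λ M → P M → ∀ d → Q M d → d ≤ proj₁ (proj₂ b)) (matrices (suc n)) →
      ∃[ m ] (IsMaxDiam (suc n) m × m ≤ log-bound (suc n) k)
    maximal⇒ (M , m , fam , q) maximal = m , ((λ G conn pw d dia →
        All.lookup maximal (matrices-complete (encode G)) (family-transport (decode-encode G) (conn , pw)) d
          (diameter-transport (decode-encode G) dia)) ,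
      decode M , proj₁ fam , proj₂ fam , q) , diameter≤log fam q
    finish : ∃ (IsDiameter G₀) → ∃[ m ] (IsMaxDiam (suc n) m × m ≤ log-bound (suc n) k)
    finish (d , q) =
      let (b , _ , maximal) = best {P = P} {Q} family-diameter diameter-unique
            (encode G₀ , d , family-transport (decode-encode G₀) fam₀ , diameter-transport (decode-encode G₀) q)
            (matrices (suc n)) (All.tabulate λ {M} _ → Pathwidth.inFamily? (decode M))
      in maximal⇒ b maximal

-- Logarithms and the final constants

<2^log : ∀ n → n < 2 ^ suc ⌊log₂ n ⌋
<2^log n with n <? 2 ^ suc ⌊log₂ n ⌋
... | yes p = p
... | no np = contradiction (ℕₚ.≤-trans (ℕₚ.≤-reflexive (≡-sym (⌊log₂[2^n]⌋≡n (suc ⌊log₂ n ⌋)))) (⌊log₂⌋-mono-≤ (ℕₚ.≮⇒≥ np))) (ℕₚ.n≮n ⌊log₂ n ⌋)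

2^log≤ : ∀ k n → 0 < n → ⌊log₂ n ⌋ ≡ k → 2 ^ k ≤ n
2^log≤ zero    n 0<n _ = 0<n
2^log≤ (suc k) (suc zero) _ ()
2^log≤ (suc k) n@(suc (suc n′)) _ eq = ℕₚ.≤-trans (ℕₚ.*-monoʳ-≤ 2 (2^log≤ k ⌊ n /2⌋ (s≤s z≤n) (trans (⌊log₂⌊n/2⌋⌋≡⌊log₂n⌋∸1 n) (cong (_∸ 1) eq))))
  (subst (_≤ n) (≡-sym (double ⌊ n /2⌋)) (ℕₚ.≤-trans (ℕₚ.+-monoʳ-≤ ⌊ n /2⌋ (ℕₚ.⌊n/2⌋≤⌈n/2⌉ n)) (ℕₚ.≤-reflexive (ℕₚ.⌊n/2⌋+⌈n/2⌉≡n n))))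

theorem7 : ∃[ c₁ ] ∃[ c₂ ] ∃[ N ] (∀ n → N ≤ n →
    ∃[ m ] (IsMaxDiam n m ×
    n * ⌊log₂ n ⌋ ≤ c₁ * m ×
    m ≤ c₂ * (n * ⌊log₂ n ⌋)))
-- From n ≥ 16 the logarithm K is at least 4, which gives K ≤ 2 (K - 2) for the lower bound and
-- guarantees the triangle of the strip. The constant 24 is 8 times the 3 per rotation, and 12 is
-- the 6 of `log-bound` doubled by K + 1 ≤ 2 K.
theorem7 = 24 , 12 , 16 , λ { 0 () ; 1 (s≤s ()) ; 2 (s≤s (s≤s ())) ; (suc (suc (suc n))) 16≤n → bounds n 16≤n }
  where
  -- With K = i + 2 and 3m ≥ i · 2^(i+1) the claim is n K ≤ 8 i · 2^(i+1).
  lower : ∀ i {n m} → 2 ≤ i → n ≤ 2 ^ (3 + i) → 1 + (1 + i) * 2 ^ (1 + i) ≤ 3 * m + 2 ^ (1 + i) → n * (2 + i) ≤ 24 * m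
  lower i {n} {m} 2≤i n≤ h = begin
    n * (2 + i)                  ≤⟨ ℕₚ.*-mono-≤ n≤ (ℕₚ.+-monoˡ-≤ i 2≤i) ⟩
    2 ^ (3 + i) * (i + i)        ≡⟨ solve 2 (λ p i → (con 2 :* (con 2 :* p)) :* (i :+ i) := con 8 :* (i :* p)) refl (2 ^ (1 + i)) i ⟩
    8 * (i * 2 ^ (1 + i))        ≤⟨ ℕₚ.*-monoʳ-≤ 8 (ℕₚ.+-cancelˡ-≤ (2 ^ (1 + i)) _ _ (begin
      2 ^ (1 + i) + i * 2 ^ (1 + i)     ≤⟨ ℕₚ.n≤1+n _ ⟩
      1 + (1 + i) * 2 ^ (1 + i)         ≤⟨ h ⟩
      3 * m + 2 ^ (1 + i)               ≡⟨ ℕₚ.+-comm (3 * m) _ ⟩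
      2 ^ (1 + i) + 3 * m               ∎)) ⟩
    8 * (3 * m)                  ≡⟨ ≡-sym (ℕₚ.*-assoc 8 3 m) ⟩
    24 * m                       ∎
    where open ℕₚ.≤-Reasoning

  bounds : ∀ n′ → let n = 3 + n′ in 16 ≤ n → ∃[ m ] (IsMaxDiam n m × n * ⌊log₂ n ⌋ ≤ 24 * m × m ≤ 12 * (n * ⌊log₂ n ⌋))
  bounds n′ 16≤n = go ⌊log₂ n ⌋ refl (ℕₚ.≤-trans (ℕₚ.≤-reflexive (≡-sym (⌊log₂[2^n]⌋≡n 4))) (⌊log₂⌋-mono-≤ 16≤n))
    where
    n = 3 + n′
    fam : InFamily (strip n)
    fam = Strip.connected n , strip-pathwidth n′
    go : ∀ K → ⌊log₂ n ⌋ ≡ K → 4 ≤ K → ∃[ m ] (IsMaxDiam n m × n * ⌊log₂ n ⌋ ≤ 24 * m × m ≤ 12 * (n * ⌊log₂ n ⌋))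
    go K@(suc (suc i)) eq (s≤s (s≤s 2≤i)) = conclude (maximum-exists {k = suc K} n< fam)
      where
      n< : n < 2 ^ suc K
      n< = subst (λ z → n < 2 ^ suc z) eq (<2^log n)
      large : ∀ m → IsMaxDiam n m → 1 + (1 + i) * 2 ^ (1 + i) ≤ 3 * m + 2 ^ (1 + i)
      large m (≤m , _) =
        -- Since 2^K ≤ n < 2^(K + 1), the largest admissible exponent is j = K - 1 = 1 + i.
        let (T , U , t , u , bound) = StripBound.strip-lower (2 + n′) (1 + i) (2^log≤ K n (s≤s z≤n) eq)
            (d , dia@(within , _)) = family-diameter {k = suc K} n< fam
            (k , k≤d , w) = within T U t u
        in ℕₚ.≤-trans (bound k w) (ℕₚ.+-monoˡ-≤ (2 ^ (1 + i)) (ℕₚ.*-monoʳ-≤ 3 (ℕₚ.≤-trans k≤d (≤m (strip n) (proj₁ fam) (proj₂ fam) d dia))))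
      conclude : ∃[ m ] (IsMaxDiam n m × m ≤ log-bound n (suc K)) → ∃[ m ] (IsMaxDiam n m × n * ⌊log₂ n ⌋ ≤ 24 * m × m ≤ 12 * (n * ⌊log₂ n ⌋))
      conclude (m , max , m≤) = m , max , subst (λ z → n * z ≤ 24 * m) (≡-sym eq) (lower i {m = m} 2≤i (ℕₚ.<⇒≤ n<) (large m max)) ,
        subst (λ z → m ≤ 12 * (n * z)) (≡-sym eq) (ℕₚ.≤-trans m≤ (ℕₚ.≤-trans
          (ℕₚ.*-monoˡ-≤ n (ℕₚ.*-monoʳ-≤ 6 (ℕₚ.+-monoˡ-≤ K {1} {K} (s≤s z≤n))))
          (ℕₚ.≤-reflexive (solve 2 (λ K n → con 6 :* (K :+ K) :* n := con 12 :* (n :* K)) refl K n))))
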